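{- Let $W$ be a finite Coxeter group of rank $n$, let $\mathcal{A}$ be its arrangement of root hyperplanes, and let $x\ne0$ be real. Then the measure $H_{W,x}$ arises from the card-shuffling walk on the chambers of $\mathcal{A}$ with face weights $v_x(F)=\frac{\chi(L^{z(F)},x)}{x^n|z^{ -1}(z(F))|}$: for every $w\in W$, the transition weight of this walk from the chamber of the identity to the chamber of $w$ (the sum of $v_x(F)$ over all faces $F$ which move the identity chamber to the chamber of $w$) equals $H_{W,x}(w)$.
   Context: General definition (for any real arrangement). Let $\mathcal{A}=\{H_i\}_{i\in I}$ be a finite hyperplane arrangement in a real vector space $V$ of dimension $n$. Chambers are the components of the complement; faces are the nonempty sets $\bigcap_{i}H_i^{\epsilon_i}$, $\epsilon_i\in\{0,+,-\}$, with $H_i^0=H_i$ and $H_i^\pm$ the two open half-spaces. $L$ is the set of nonempty intersections of hyperplanes (including $V$), ordered by reverse inclusion, with Möbius function $\mu$; for $X\in L$, $L^X=\{Y\in L:Y\ge X\}$ and $\chi(L^X,x)=\sum_{Y\ge X}\mu(X,Y)x^{\dim Y}$. The map $z$ sends a face $F$ to its support $z(F)\in L$, the intersection of $V$ with all hyperplanes containing $F$. A face $F$ moves a chamber $C$ to the unique chamber whose closure contains $F$ and which among such chambers is separated from $C$ by the fewest hyperplanes. The card-shuffling walk of $\mathcal{A}$ with parameter $x\neq0$ is the (possibly signed) chain on chambers whose transition weight from $C$ to $C'$ is the sum of $v_x(F)=\frac{\chi(L^{z(F)},x)}{x^n|z^{ -1}(z(F))|}$ over faces $F$ moving $C$ to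 $C'$; by Zaslavsky's theorem $|z^{ -1}(Y)|=(-1)^{\dim Y}\chi(L^Y,-1)$. Coxeter case. $W$ acts on its $n$-dimensional real reflection representation $V$ with base $\Pi$ of simple roots; $\mathcal{A}$ is the set of root hyperplanes. The chamber of $w$ is $wC$ with $C=\{v:\langle v,\alpha\rangle>0\ \forall\alpha\in\Pi\}$. $Des(w)$ is the set of $\alpha\in\Pi$ with $w(\alpha)$ negative. For $K\subseteq\Pi$, $W_K$ is the parabolic subgroup generated by reflections in the roots of $K$, $Fix(W_K)$ its fixed space, $N_W(W_K)$ its normalizer in $W$, and $\lambda(K)$ the set of subsets $J\subseteq\Pi$ with $w(K)=J$ for some $w\in W$. By definition $$H_{W,x}(w)=\sum_{K\subseteq\Pi-Des(w)}\frac{|W_K|\chi(L^{Fix(W_K)},x)}{x^n|N_W(W_K)||\lambda(K)|}.$$ -}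

module Defs where

open import Algebra.Bundles using (CommutativeRing; Group; Semiring)
import Algebra.Definitions.RawMonoid as RawMonoidDefinitions
import Algebra.Definitions.RawSemiring as RawSemiringDefinitions
open import Algebra.Morphism.Structures using (IsGroupHomomorphism)
open import Axiom.ExcludedMiddle using (ExcludedMiddle)
open import Data.Bool.Base using (Bool; true; false; if_then_else_)
open import Data.Fin.Base using (Fin)
import Data.Fin.Subset as Subset
open Subset using (Subset; ∁)
open import Data.List.Base as List using (List; []; _∷_; [_]; map; filter; length; cartesianProductWith; allFin)
import Data.List.Relation.Unary.Enumerates.Setoid as Enumerates
import Data.List.Relation.Unary.Unique.Setoid as UniqueSetoid
open import Data.Nat.Base as ℕ using (ℕ; zero; suc)
open import Data.Product.Base using (∃; _×_; _,_)
open import Data.Sum.Base using (_⊎_)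
open import Data.Vec.Base as Vec using (Vec)
open import Data.Vec.Functional using (Vector)
import Data.Vec.Functional.Relation.Binary.Equality.Setoid as VectorEquality
open import Function.Base using (_∘_)
open import Level using (0ℓ)
open import Relation.Binary.Core using (Rel)
open import Relation.Binary.Structures using (IsStrictTotalOrder)
import Relation.Binary.Construct.StrictToNonStrict as StrictToNonStrict
open import Relation.Binary.PropositionalEquality.Core using (_≡_; _≢_)
open import Relation.Nullary.Decidable.Core using (does)
open import Relation.Nullary.Negation.Core using (¬_)
open import Relation.Unary using (Pred; _∈_; _⊆′_; Satisfiable)

-- The real numbers, given by the axioms of a complete ordered field, which
-- determine them up to isomorphism.  The inverse is total; its value at 0 is
-- left unspecified.

record RealNumbers : Set₁ where
  field
    commutativeRing : CommutativeRing 0ℓ 0ℓ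

  open CommutativeRing commutativeRing public hiding (zero)

  infix 4 _<_
  infix 9 _⁻¹

  field
    _<_                : Rel Carrier 0ℓ
    isStrictTotalOrder : IsStrictTotalOrder _≈_ _<_
    0<1                : 0# < 1#
    +-monoˡ-<          : ∀ {x y} z → x < y → x + z < y + z
    *-pos              : ∀ {x y} → 0# < x → 0# < y → 0# < x * y
    _⁻¹                : Carrier → Carrier
    ⁻¹-cong            : ∀ {x y} → x ≈ y → x ⁻¹ ≈ y ⁻¹
    *-inverseʳ         : ∀ x → ¬ (x ≈ 0#) → x * x ⁻¹ ≈ 1#

  open StrictToNonStrict _≈_ _<_ public using (_≤_)

  UpperBound : Pred Carrier 0ℓ → Pred Carrier 0ℓ
  UpperBound P u = ∀ x → x ∈ P → x ≤ u

  field
    complete : (P : Pred Carrier 0ℓ) → Satisfiable P → Satisfiable (UpperBound P) →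
               ∃ λ s → UpperBound P s × (∀ u → UpperBound P u → s ≤ u)

  open RawSemiringDefinitions (Semiring.rawSemiring semiring) public using (_^_; sum) renaming (_×_ to _×ℕ_)

  infixl 7 _/_

  _/_ : Carrier → Carrier → Carrier
  x / y = x * y ⁻¹

  fromℕ : ℕ → Carrier
  fromℕ k = k ×ℕ 1#

  sumList : ∀ {A : Set} → List A → (A → Carrier) → Carrier
  sumList xs f = List.foldr (λ a s → f a + s) 0# xs


module EuclideanSpace (ℝ : RealNumbers) where
  open RealNumbers ℝ
  open VectorEquality setoid public using (_≋_)

  V : ℕ → Set
  V n = Vector Carrier n

  module _ {n : ℕ} where

    infixl 6 _+ᵛ_ _-ᵛ_
    infixr 7 _*ᵛ_

    0ᵛ : V n
    0ᵛ _ = 0#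

    _+ᵛ_ _-ᵛ_ : V n → V n → V n
    (u +ᵛ v) k = u k + v k
    (u -ᵛ v) k = u k - v k

    -ᵛ_ : V n → V n
    (-ᵛ v) k = - v k

    _*ᵛ_ : Carrier → V n → V n
    (c *ᵛ v) k = c * v k

    ⟨_,_⟩ : V n → V n → Carrier
    ⟨ u , v ⟩ = sum (λ k → u k * v k)

    linComb : ∀ {d} → (Fin d → Carrier) → (Fin d → V n) → V n
    linComb c b k = sum (λ j → c j * b j k)

    LinearlyIndependent : ∀ {d} → (Fin d → V n) → Set
    LinearlyIndependent b = ∀ c → linComb c b ≋ 0ᵛ → ∀ j → c j ≈ 0#

    IsBasis : ∀ {d} → (Fin d → V n) → Set
    IsBasis b = LinearlyIndependent b × (∀ v → ∃ λ c → v ≋ linComb c b)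

    Cone : ∀ {d} → (Fin d → V n) → Pred (V n) 0ℓ
    Cone b v = ∃ λ c → (∀ j → 0# ≤ c j) × v ≋ linComb c b

    reflect : V n → V n → V n
    reflect α v = v -ᵛ (((1# + 1#) * ⟨ v , α ⟩) / ⟨ α , α ⟩) *ᵛ α

    -- Topological closure, using the open cubes around v as neighbourhoods.
    Closure : Pred (V n) 0ℓ → Pred (V n) 0ℓ
    Closure P v = ∀ ε → 0# < ε → ∃ λ u → u ∈ P × (∀ k → u k - v k < ε × v k - u k < ε)


-- Excluded middle makes every subset of a finite set decidable, so that it can
-- be listed and counted.

module Classical (lem : ExcludedMiddle 0ℓ) where

  select : ∀ {A : Set} → Pred A 0ℓ → List A → List A
  select P = filter (λ a → lem {P a})

  count : ∀ {A : Set} → Pred A 0ℓ → List A → ℕ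
  count P xs = length (select P xs)

  subset : ∀ {m} → Pred (Fin m) 0ℓ → Subset m
  subset P = Vec.tabulate (λ i → does (lem {P i}))

  decide : Set → Bool
  decide P = does (lem {P})

allVecs : ∀ {A : Set} → List A → ∀ m → List (Vec A m)
allVecs xs zero    = [ Vec.[] ]
allVecs xs (suc m) = cartesianProductWith Vec._∷_ xs (allVecs xs m)

allSubsets : ∀ m → List (Subset m)
allSubsets = allVecs (true ∷ false ∷ [])

data Sign : Set where
  zer pos neg : Sign

SignVector : ℕ → Set
SignVector = Vec Sign


-- The i-th hyperplane is { v | ⟨ normal i , v ⟩ = offset i }.

record Arrangement (ℝ : RealNumbers) (n : ℕ) : Set where
  open RealNumbers ℝ
  open EuclideanSpace ℝ
  field
    size     : ℕ
    normal   : Fin size → V n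
    normal≉0 : ∀ i → ¬ (normal i ≋ 0ᵛ)
    offset   : Fin size → Carrier


module ArrangementTheory (lem : ExcludedMiddle 0ℓ) (ℝ : RealNumbers) {n : ℕ}
                         (𝒜 : Arrangement ℝ n) where
  open Classical lem
  open RealNumbers ℝ
  open EuclideanSpace ℝ
  open Arrangement 𝒜

  HalfSpace : Sign → Fin size → Pred (V n) 0ℓ
  HalfSpace zer i v = ⟨ normal i , v ⟩ ≈ offset i
  HalfSpace pos i v = offset i < ⟨ normal i , v ⟩
  HalfSpace neg i v = ⟨ normal i , v ⟩ < offset i

  Hyperplane : Fin size → Pred (V n) 0ℓ
  Hyperplane = HalfSpace zer

  -- A face is encoded by its sign vector, which determines it and is determined
  -- by it.  The components of the complement are the faces without a zero sign.

  Cell : SignVector size → Pred (V n) 0ℓ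
  Cell σ v = ∀ i → v ∈ HalfSpace (Vec.lookup σ i) i

  IsFace : Pred (SignVector size) 0ℓ
  IsFace σ = Satisfiable (Cell σ)

  IsChamber : Pred (SignVector size) 0ℓ
  IsChamber σ = IsFace σ × (∀ i → Vec.lookup σ i ≢ zer)

  faces : List (SignVector size)
  faces = select IsFace (allVecs (zer ∷ pos ∷ neg ∷ []) size)

  -- The sign vector of a face that is given as a set of points.
  signVector : Pred (V n) 0ℓ → SignVector size
  signVector P = Vec.tabulate λ i →
    if decide (P ⊆′ HalfSpace pos i) then pos else
    if decide (P ⊆′ HalfSpace neg i) then neg else zer

  -- An element X of L is encoded by the set of all i with X ⊆ Hyperplane i.

  support : Pred (V n) 0ℓ → Subset size
  support P = subset (λ i → P ⊆′ Hyperplane i)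

  Intersection : Subset size → Pred (V n) 0ℓ
  Intersection S v = ∀ i → i Subset.∈ S → v ∈ Hyperplane i

  IsFlat : Pred (Subset size) 0ℓ
  IsFlat S = Satisfiable (Intersection S) × support (Intersection S) ≡ S

  flats : List (Subset size)
  flats = select IsFlat (allSubsets size)

  infix 4 _≼_ _≺_

  _≼_ _≺_ : Rel (Subset size) 0ℓ
  X ≼ Y = Intersection Y ⊆′ Intersection X
  X ≺ Y = X ≼ Y × X ≢ Y

  -- The first argument bounds the recursion depth.  The recursion descends along
  -- a chain of flats, so the number of flats is a sufficient bound.
  möbiusUpTo : ℕ → Subset size → Subset size → Carrier
  möbiusUpTo zero    X Y = 0#
  möbiusUpTo (suc k) X Y =
    if decide (X ≡ Y) then 1#
    else - sumList (select (λ Z → X ≼ Z × Z ≺ Y) flats) (λ Z → möbiusUpTo k X Z)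

  μ : Subset size → Subset size → Carrier
  μ = möbiusUpTo (length flats)

  -- Whether P contains d + 1 affinely independent points.
  HasIndependent : Pred (V n) 0ℓ → ℕ → Set
  HasIndependent P d =
    ∃ λ (p : V n) → ∃ λ (b : Fin d → V n) →
      LinearlyIndependent b × p ∈ P × (∀ j → (p +ᵛ b j) ∈ P)

  largestUpTo : Pred ℕ 0ℓ → ℕ → ℕ
  largestUpTo Q zero    = zero
  largestUpTo Q (suc d) = if decide (Q (suc d)) then suc d else largestUpTo Q d

  dim : Pred (V n) 0ℓ → ℕ
  dim P = largestUpTo (HasIndependent P) n

  -- χ X x is χ(L^X , x).
  χ : Subset size → Carrier → Carrier
  χ X x = sumList (select (X ≼_) flats) (λ Y → μ X Y * x ^ dim (Intersection Y))

  z : SignVector size → Subset size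
  z F = support (Cell F)

  facesWithSupport : Subset size → ℕ
  facesWithSupport X = count (λ F → z F ≡ X) faces

  separation : SignVector size → SignVector size → ℕ
  separation C D = count (λ i → Vec.lookup C i ≢ Vec.lookup D i) (allFin size)

  IsChamberAt : SignVector size → Pred (SignVector size) 0ℓ
  IsChamberAt F D = IsChamber D × Cell F ⊆′ Closure (Cell D)

  Moves : SignVector size → SignVector size → SignVector size → Set
  Moves F C D =
    IsChamberAt F D ×
    (∀ E → IsChamberAt F E → E ≢ D → separation C D ℕ.< separation C E)

  faceWeight : Carrier → SignVector size → Carrier
  faceWeight x F = χ (z F) x / (x ^ n * fromℕ (facesWithSupport (z F)))

  transitionWeight : Carrier → SignVector size → SignVector size → Carrier
  transitionWeight x C D = sumList (select (λ F → Moves F C D) faces) (faceWeight x)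


module _ (W : Group 0ℓ 0ℓ) where
  open Group W

  data Generated (P : Pred Carrier 0ℓ) : Pred Carrier 0ℓ where
    gen  : ∀ {g} → P g → Generated P g
    unit : Generated P ε
    mul  : ∀ {g h} → Generated P g → Generated P h → Generated P (g ∙ h)
    inv  : ∀ {g} → Generated P g → Generated P (g ⁻¹)
    resp : ∀ {g h} → g ≈ h → Generated P g → Generated P h

  Normalizes : Pred Carrier 0ℓ → Pred Carrier 0ℓ
  Normalizes P w = ∀ g → (P g → P (w ∙ g ∙ w ⁻¹)) × (P (w ∙ g ∙ w ⁻¹) → P g)

  -- In a Coxeter matrix, the entry 0 stands for ∞.
  CoxeterRelations : ∀ {n} → (Fin n → Fin n → ℕ) → (Fin n → Carrier) → Set
  CoxeterRelations m s = ∀ i j → (m i j ×ᵍ (s i ∙ s j)) ≈ ε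
    where open RawMonoidDefinitions rawMonoid using () renaming (_×_ to _×ᵍ_)


record FiniteCoxeterGroup (n : ℕ) : Set₁ where
  field
    group : Group 0ℓ 0ℓ

  open Group group public

  field
    elements          : List Carrier
    elements-complete : Enumerates.IsEnumeration setoid elements
    elements-unique   : UniqueSetoid.Unique setoid elements

    m          : Fin n → Fin n → ℕ
    m-diagonal : ∀ i → m i i ≡ 1
    m-sym      : ∀ i j → m i j ≡ m j i
    m-off      : ∀ i j → i ≢ j → m i j ≢ 1

    -- The group is presented by the generators s i and the Coxeter relations.
    s            : Fin n → Carrier
    s-generates  : ∀ w → Generated group (λ g → ∃ λ i → g ≈ s i) w
    s-relations  : CoxeterRelations group m s
    presentation : ∀ (G : Group 0ℓ 0ℓ) (t : Fin n → Group.Carrier G) →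
                   CoxeterRelations G m t →
                   ∃ λ (f : Carrier → Group.Carrier G) →
                     IsGroupHomomorphism rawGroup (Group.rawGroup G) f ×
                     (∀ i → Group._≈_ G (f (s i)) (t i))


-- The group acts on ℝⁿ as the reflection group of a reduced root system Φ, given
-- by the list of its roots, in such a way that the Coxeter generators are the
-- reflections in the simple roots.  The root lengths are not normalised.

record ReflectionRepresentation (ℝ : RealNumbers) {n : ℕ} (W : FiniteCoxeterGroup n) : Set where
  open RealNumbers ℝ hiding (refl; sym; trans)
  open EuclideanSpace ℝ
  open FiniteCoxeterGroup W using (s) renaming (Carrier to |W|; _≈_ to _≈ᵂ_; _∙_ to _∙ᵂ_; ε to εᵂ)

  infixr 8 _•_

  field
    _•_        : |W| → V n → V n
    •-cong     : ∀ {g h u v} → g ≈ᵂ h → u ≋ v → g • u ≋ h • v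
    •-identity : ∀ v → εᵂ • v ≋ v
    •-assoc    : ∀ g h v → (g ∙ᵂ h) • v ≋ g • h • v
    •-+ᵛ       : ∀ g u v → g • (u +ᵛ v) ≋ (g • u) +ᵛ (g • v)
    •-*ᵛ       : ∀ g c v → g • (c *ᵛ v) ≋ c *ᵛ (g • v)
    •-faithful : ∀ g h → (∀ v → g • v ≋ h • v) → g ≈ᵂ h

    rootCount    : ℕ
    root         : Fin rootCount → V n
    root-unique  : ∀ i j → root i ≋ root j → i ≡ j
    root≉0       : ∀ i → ¬ (root i ≋ 0ᵛ)
    root-reduced : ∀ i j c → root j ≋ c *ᵛ root i → root j ≋ root i ⊎ root j ≋ -ᵛ root i
    root-reflect : ∀ i j → ∃ λ k → root k ≋ reflect (root i) (root j)

    simple    : Fin n → Fin rootCount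

  α : Fin n → V n
  α i = root (simple i)

  Positive : Pred (V n) 0ℓ
  Positive v = v ∈ Cone α

  Negative : Pred (V n) 0ℓ
  Negative v = (-ᵛ v) ∈ Cone α

  field
    α-basis           : IsBasis α
    positive∨negative : ∀ j → Positive (root j) ⊎ Negative (root j)
    s-reflects        : ∀ i v → s i • v ≋ reflect (α i) v


module CoxeterTheory (lem : ExcludedMiddle 0ℓ) (ℝ : RealNumbers) {n : ℕ}
                     (W : FiniteCoxeterGroup n) (ρ : ReflectionRepresentation ℝ W) where
  open Classical lem
  open RealNumbers ℝ
  open EuclideanSpace ℝ
  open FiniteCoxeterGroup W using (group; elements; s) renaming (Carrier to |W|; _≈_ to _≈ᵂ_)
  open ReflectionRepresentation ρ

  -- A root and its negative define the same hyperplane, so the positive roots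
  -- list every root hyperplane once.

  positiveRoots : List (Fin rootCount)
  positiveRoots = select (λ j → Positive (root j)) (allFin rootCount)

  coxeterArrangement : Arrangement ℝ n
  coxeterArrangement = record
    { size     = length positiveRoots
    ; normal   = root ∘ List.lookup positiveRoots
    ; normal≉0 = root≉0 ∘ List.lookup positiveRoots
    ; offset   = λ _ → 0#
    }

  open ArrangementTheory lem ℝ coxeterArrangement public

  FundamentalChamber : Pred (V n) 0ℓ
  FundamentalChamber v = ∀ i → 0# < ⟨ v , α i ⟩

  chamber : |W| → SignVector (length positiveRoots)
  chamber w = signVector (λ u → ∃ λ v → v ∈ FundamentalChamber × u ≋ w • v)

  -- A subset K of Π is given by the set of all i with α i ∈ K.

  Des : |W| → Subset n
  Des w = subset (λ i → Negative (w • α i))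

  Parabolic : Subset n → Pred |W| 0ℓ
  Parabolic K = Generated group (λ g → ∃ λ i → i Subset.∈ K × g ≈ᵂ s i)

  Fix : Pred |W| 0ℓ → Pred (V n) 0ℓ
  Fix P v = ∀ g → g ∈ P → g • v ≋ v

  MapsOnto : |W| → Subset n → Subset n → Set
  MapsOnto w K J =
    (∀ i → i Subset.∈ K → ∃ λ j → j Subset.∈ J × w • α i ≋ α j) ×
    (∀ j → j Subset.∈ J → ∃ λ i → i Subset.∈ K × w • α i ≋ α j)

  |Parabolic| |Normalizer| |λ| : Subset n → ℕ
  |Parabolic|  K = count (Parabolic K) elements
  |Normalizer| K = count (Normalizes group (Parabolic K)) elements
  |λ|          K = count (λ J → ∃ λ w → MapsOnto w K J) (allSubsets n)

  -- Fix (Parabolic K) is an element of L; its code is its support.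
  H : Carrier → |W| → Carrier
  H x w = sumList (select (λ K → K Subset.⊆ ∁ (Des w)) (allSubsets n)) λ K →
    (fromℕ (|Parabolic| K) * χ (support (Fix (Parabolic K))) x)
      / (x ^ n * fromℕ (|Normalizer| K) * fromℕ (|λ| K))

-- Every face of the Coxeter arrangement is w F_K for a unique K ⊆ Π and a w
-- that is unique if it is required to send K to positive roots; here F_K is the
-- face of the fundamental chamber on which exactly the roots of K vanish.  The
-- face w F_K, with w so chosen, moves the identity chamber to the chamber of w,
-- so the faces moving it there are the w F_K with K ⊆ Π - Des(w).  The support
-- of w F_K is w Fix(W_K), whose χ is that of Fix(W_K).  It remains to count the
-- faces u F_J with that support.  The pairs (u F_J , h), h ∈ W_K, correspond to
-- the pairs (J , g) with g Fix(W_J) = Fix(W_K); such g exist iff J ∈ λ(K), and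
-- then they form a coset of N_W(W_K).  Hence the number of faces times |W_K| is
-- |N_W(W_K)| |λ(K)|.
-- W_K is recognised throughout as the stabiliser of an interior point of F_K,
-- which is where the exchange condition enters.

module Submission where

open import Defs
open import Axiom.ExcludedMiddle using (ExcludedMiddle)
open import Data.Nat.Base as ℕ using (ℕ; zero; suc; z≤n; s≤s)
import Data.Nat.Properties as ℕₚ
open import Level using (0ℓ)
open import Relation.Nullary.Negation.Core using (¬_; contradiction)
open import Algebra.Bundles using (Group)
import Algebra.Properties.Ring as RingProperties
import Algebra.Properties.Group as GroupProperties
import Algebra.Properties.Semiring.Sum as SumProperties
import Algebra.Properties.Semiring.Mult as MultProperties
open import Data.Fin.Base using (Fin; zero; suc)
import Data.Fin.Properties as Fin
import Data.Fin.Subset as Subset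
open Subset using (Subset; ∁)
import Data.Fin.Subset.Properties as Subset
open import Data.Bool.Base using (true; false; if_then_else_)
open import Data.Product.Base using (∃; _×_; _,_; proj₁; proj₂)
open import Data.Sum.Base using (_⊎_; inj₁; inj₂)
open import Data.Vec.Base as Vec using (Vec)
import Data.Vec.Properties as Vec
open import Data.List.Base as List using (List; []; _∷_; length; cartesianProduct; allFin)
import Data.List.Properties as List
open import Data.List.Relation.Unary.Any using (here; there)
import Data.List.Relation.Unary.Any as Any
import Data.List.Relation.Unary.Any.Properties as Any
open import Data.List.Relation.Unary.All as All using ([]; _∷_)
open import Data.List.Relation.Unary.AllPairs as AllPairs using ([]; _∷_)
open import Data.List.Membership.Propositional using (_∈_; find)
open import Data.List.Membership.Propositional.Properties
open import Data.List.Relation.Unary.Unique.Propositional using (Unique)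
import Data.List.Relation.Unary.Unique.Propositional.Properties as Unique
open import Data.List.Relation.Binary.Permutation.Propositional as ↭ using (_↭_)
open import Data.List.Relation.Binary.BagAndSetEquality using (∼bag⇒↭)
open import Data.List.Membership.Propositional.Properties.WithK using (unique∧set⇒bag)
import Data.List.Relation.Unary.All.Properties as All
open import Function.Bundles using (mk⇔)
open import Data.List.Relation.Binary.Permutation.Propositional.Properties using (↭-length)
open import Function.Base using (_∘_; case_of_)
open import Relation.Binary.Structures using (IsStrictTotalOrder)
open import Relation.Binary.Definitions using (tri<; tri≈; tri>)
open import Relation.Binary.PropositionalEquality as ≡ using (_≡_; _≢_)
open import Relation.Nullary.Decidable.Core using (yes; no; does; decidable-stable)
import Relation.Binary.Reasoning.Setoid as SetoidReasoning
open import Relation.Unary using (Pred; _⊆′_)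

-- Faces and their supports are handled through single points, by two relations: `≈±`, lying in the
-- same face, and `≈₀`, lying on the same root hyperplanes. Both are tested on all roots, which W
-- permutes, and not on the positive roots indexing the hyperplanes, which it does not permute; so
-- they are invariant under W without bookkeeping of indices. Normalising W_K and belonging to λ(K)
-- likewise become `g • weight K ≈₀ weight K` and the existence of an `a` with
-- `a • weight J ≈₀ weight K`. There is no length function: exchange counts the letters of words,
-- and shortest coset representatives come from maximising a pairing over the finite group. Counting
-- faces requires choices, a representative u of each face and an `a` for each J. The chosen u is
-- determined only up to right multiplication by W_J, and the factor h in W_K absorbs this
-- ambiguity, so that no coset spaces are formed.

-- Arithmetic of ordered fields

module OrderedField (ℝ : RealNumbers) where
  open RealNumbers ℝ
  open RingProperties ring public
  open SumProperties semiring public hiding (sum)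
  open IsStrictTotalOrder isStrictTotalOrder public
    using (compare; <-respʳ-≈; <-respˡ-≈) renaming (trans to <-trans; irrefl to <-irrefl)
  open SetoidReasoning setoid

  <-resp : ∀ {x x′ y y′} → x ≈ x′ → y ≈ y′ → x < y → x′ < y′
  <-resp p q = <-respˡ-≈ p ∘ <-respʳ-≈ q

  <-asym : ∀ {x y} → x < y → ¬ y < x
  <-asym p q = <-irrefl refl (<-trans p q)

  ≤-resp : ∀ {x x′ y y′} → x ≈ x′ → y ≈ y′ → x ≤ y → x′ ≤ y′
  ≤-resp p q (inj₁ r) = inj₁ (<-resp p q r)
  ≤-resp p q (inj₂ r) = inj₂ (trans (sym p) (trans r q))

  ≤-antisym : ∀ {x y} → x ≤ y → y ≤ x → x ≈ y
  ≤-antisym (inj₂ p) _        = p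
  ≤-antisym (inj₁ p) (inj₂ q) = sym q
  ≤-antisym (inj₁ p) (inj₁ q) = contradiction q (<-asym p)

  ≮⇒≥ : ∀ {x y} → ¬ x < y → y ≤ x
  ≮⇒≥ {x} {y} x≮y with compare x y
  ... | tri< p _ _ = contradiction p x≮y
  ... | tri≈ _ p _ = inj₂ (sym p)
  ... | tri> _ _ p = inj₁ p

  <⇒≱ : ∀ {x y} → x < y → ¬ y ≤ x
  <⇒≱ p (inj₁ q) = <-asym p q
  <⇒≱ p (inj₂ q) = <-irrefl (sym q) p

  1≉0 : ¬ 1# ≈ 0#
  1≉0 p = <-irrefl (sym p) 0<1

  -‿pos : ∀ {x} → x < 0# → 0# < - x
  -‿pos {x} p = <-resp (-‿inverseʳ x) (+-identityˡ (- x)) (+-monoˡ-< (- x) p)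

  -‿neg : ∀ {x} → 0# < x → - x < 0#
  -‿neg {x} p = <-resp (+-identityˡ (- x)) (-‿inverseʳ x) (+-monoˡ-< (- x) p)

  -‿nonneg : ∀ {x} → x ≤ 0# → 0# ≤ - x
  -‿nonneg (inj₁ p) = inj₁ (-‿pos p)
  -‿nonneg (inj₂ p) = inj₂ (sym (trans (-‿cong p) -0#≈0#))

  -‿nonpos : ∀ {x} → 0# ≤ - x → x ≤ 0#
  -‿nonpos (inj₁ p) = inj₁ (<-respˡ-≈ (-‿involutive _) (-‿neg p))
  -‿nonpos (inj₂ p) = inj₂ (trans (sym (-‿involutive _)) (trans (-‿cong (sym p)) -0#≈0#))

  x≈-x⇒x≈0 : ∀ {x} → x ≈ - x → x ≈ 0#
  x≈-x⇒x≈0 {x} p with compare x 0#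
  ... | tri< q _ _ = contradiction (<-respʳ-≈ (sym p) (-‿pos q)) (<-asym q)
  ... | tri≈ _ q _ = q
  ... | tri> _ _ q = contradiction (<-respˡ-≈ (sym p) (-‿neg q)) (<-asym q)

  <⇒0<- : ∀ {x y} → x < y → 0# < y - x
  <⇒0<- {x} p = <-respˡ-≈ (-‿inverseʳ x) (+-monoˡ-< (- x) p)

  0<-⇒< : ∀ {x y} → 0# < y - x → x < y
  0<-⇒< {x} {y} p = <-resp (+-identityˡ x) lemma (+-monoˡ-< x p)
    where
    lemma : y - x + x ≈ y
    lemma = trans (+-assoc y (- x) x) (trans (+-congˡ (-‿inverseˡ x)) (+-identityʳ y))

  +-monoʳ-< : ∀ {x y} z → x < y → z + x < z + y
  +-monoʳ-< z p = <-resp (+-comm _ z) (+-comm _ z) (+-monoˡ-< z p)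

  0<+ : ∀ {x y} → 0# < x → 0# ≤ y → 0# < x + y
  0<+ {x} p (inj₁ q) = <-trans p (<-respˡ-≈ (+-identityʳ x) (+-monoʳ-< x q))
  0<+ {x} p (inj₂ q) = <-respʳ-≈ (trans (sym (+-identityʳ x)) (+-congˡ q)) p

  +-nonneg : ∀ {x y} → 0# ≤ x → 0# ≤ y → 0# ≤ x + y
  +-nonneg (inj₁ p) q = inj₁ (0<+ p q)
  +-nonneg (inj₂ p) q = ≤-resp refl (trans (sym (+-identityˡ _)) (+-congʳ p)) q

  *-nonneg : ∀ {x y} → 0# ≤ x → 0# ≤ y → 0# ≤ x * y
  *-nonneg (inj₁ p) (inj₁ q) = inj₁ (*-pos p q)
  *-nonneg (inj₂ p) _        = inj₂ (trans (sym (zeroˡ _)) (*-congʳ p))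
  *-nonneg _        (inj₂ q) = inj₂ (trans (sym (zeroʳ _)) (*-congˡ q))

  +≈0ˡ : ∀ {x y} → 0# ≤ x → 0# ≤ y → x + y ≈ 0# → x ≈ 0#
  +≈0ˡ (inj₁ p) q r = contradiction (0<+ p q) (<-irrefl (sym r))
  +≈0ˡ (inj₂ p) q r = sym p

  +≈0ʳ : ∀ {x y} → 0# ≤ x → 0# ≤ y → x + y ≈ 0# → y ≈ 0#
  +≈0ʳ p q r = +≈0ˡ q p (trans (+-comm _ _) r)

  sum-nonneg : ∀ {k} (f : Fin k → Carrier) → (∀ i → 0# ≤ f i) → 0# ≤ sum f
  sum-nonneg {zero}  f p = inj₂ refl
  sum-nonneg {suc k} f p = +-nonneg (p zero) (sum-nonneg (f ∘ suc) (p ∘ suc))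

  sum≈0 : ∀ {k} (f : Fin k → Carrier) → (∀ i → 0# ≤ f i) → sum f ≈ 0# → ∀ i → f i ≈ 0#
  sum≈0 f p r zero    = +≈0ˡ (p zero) (sum-nonneg (f ∘ suc) (p ∘ suc)) r
  sum≈0 f p r (suc i) = sum≈0 (f ∘ suc) (p ∘ suc)
                          (+≈0ʳ (p zero) (sum-nonneg (f ∘ suc) (p ∘ suc)) r) i

  sum-zero : ∀ {k} (f : Fin k → Carrier) → (∀ i → f i ≈ 0#) → sum f ≈ 0#
  sum-zero {k} f p = trans (sum-cong-≋ p) (sum-replicate-zero k)

  sum-single : ∀ {k} (f : Fin k → Carrier) i → (∀ j → j ≢ i → f j ≈ 0#) → sum f ≈ f i
  sum-single f zero p =
    trans (+-congˡ (sum-zero (f ∘ suc) (λ j → p (suc j) λ ()))) (+-identityʳ _)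
  sum-single f (suc i) p =
    trans (+-cong (p zero λ ()) (sum-single (f ∘ suc) i (λ j q → p (suc j) (q ∘ Fin.suc-injective))))
          (+-identityˡ _)

  -x*-y≈x*y : ∀ x y → - x * - y ≈ x * y
  -x*-y≈x*y x y = begin
    - x * - y      ≈⟨ -‿distribˡ-* x (- y) ⟨
    - (x * - y)    ≈⟨ -‿cong (-‿distribʳ-* x y) ⟨
    - - (x * y)    ≈⟨ -‿involutive _ ⟩
    x * y          ∎

  *-neg : ∀ {x y} → 0# < x → y < 0# → x * y < 0#
  *-neg {x} {y} p q =
    <-respˡ-≈ (trans (-‿distribʳ-* x (- y)) (*-congˡ (-‿involutive y))) (-‿neg (*-pos p (-‿pos q)))

  square-pos : ∀ {x} → ¬ x ≈ 0# → 0# < x * x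
  square-pos {x} x≉0 with compare x 0#
  ... | tri< q _ _ = <-respʳ-≈ (-x*-y≈x*y x x) (*-pos (-‿pos q) (-‿pos q))
  ... | tri≈ _ q _ = contradiction q x≉0
  ... | tri> _ _ q = *-pos q q

  square-nonneg : ∀ x → 0# ≤ x * x
  square-nonneg x with compare x 0#
  ... | tri< _ q _ = inj₁ (square-pos q)
  ... | tri≈ _ q _ = inj₂ (sym (trans (*-congʳ q) (zeroˡ x)))
  ... | tri> _ q _ = inj₁ (square-pos q)

  x*y≈0⇒y≈0 : ∀ {x y} → ¬ x ≈ 0# → x * y ≈ 0# → y ≈ 0#
  x*y≈0⇒y≈0 {x} {y} x≉0 p = begin
    y                 ≈⟨ *-identityˡ y ⟨
    1# * y            ≈⟨ *-congʳ (trans (*-comm _ _) (*-inverseʳ x x≉0)) ⟨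
    x ⁻¹ * x * y      ≈⟨ *-assoc _ _ _ ⟩
    x ⁻¹ * (x * y)    ≈⟨ *-congˡ p ⟩
    x ⁻¹ * 0#         ≈⟨ zeroʳ _ ⟩
    0#                ∎

  *≉0 : ∀ {x y} → ¬ x ≈ 0# → ¬ y ≈ 0# → ¬ x * y ≈ 0#
  *≉0 x≉0 y≉0 p = y≉0 (x*y≈0⇒y≈0 x≉0 p)

  pos⇒≉0 : ∀ {x} → 0# < x → ¬ x ≈ 0#
  pos⇒≉0 p q = <-irrefl (sym q) p

  ⁻¹-pos : ∀ {x} → 0# < x → 0# < x ⁻¹
  ⁻¹-pos {x} p with compare (x ⁻¹) 0#
  ... | tri< q _ _ = contradiction (<-respˡ-≈ (*-inverseʳ x (pos⇒≉0 p)) (*-neg p q)) (<-asym 0<1)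
  ... | tri≈ _ q _ = contradiction (trans (sym (*-inverseʳ x (pos⇒≉0 p))) (trans (*-congˡ q) (zeroʳ x))) 1≉0
  ... | tri> _ _ q = q

  fromℕ-nonneg : ∀ k → 0# ≤ fromℕ k
  fromℕ-nonneg zero    = inj₂ refl
  fromℕ-nonneg (suc k) = +-nonneg (inj₁ 0<1) (fromℕ-nonneg k)

  fromℕ≉0 : ∀ {k} → 0 ℕ.< k → ¬ fromℕ k ≈ 0#
  fromℕ≉0 {suc k} _ = pos⇒≉0 (0<+ 0<1 (fromℕ-nonneg k))

  ^≉0 : ∀ {x} k → ¬ x ≈ 0# → ¬ x ^ k ≈ 0#
  ^≉0 zero    x≉0 = 1≉0
  ^≉0 (suc k) x≉0 = *≉0 x≉0 (^≉0 k x≉0)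

  /-unique : ∀ {x y z} → ¬ y ≈ 0# → z * y ≈ x → z ≈ x / y
  /-unique {x} {y} {z} y≉0 p = begin
    z                 ≈⟨ *-identityʳ z ⟨
    z * 1#            ≈⟨ *-congˡ (*-inverseʳ y y≉0) ⟨
    z * (y * y ⁻¹)    ≈⟨ *-assoc _ _ _ ⟨
    z * y * y ⁻¹      ≈⟨ *-congʳ p ⟩
    x * y ⁻¹          ∎

  /-*-cancel : ∀ {x y} → ¬ y ≈ 0# → x / y * y ≈ x
  /-*-cancel {x} {y} y≉0 = begin
    x * y ⁻¹ * y      ≈⟨ *-assoc _ _ _ ⟩
    x * (y ⁻¹ * y)    ≈⟨ *-congˡ (trans (*-comm _ _) (*-inverseʳ y y≉0)) ⟩
    x * 1#            ≈⟨ *-identityʳ x ⟩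
    x                 ∎

  -- Cross-multiplied, so that the natural numbers need not be divided.
  fraction : ∀ a b c d y t → 0 ℕ.< a → 0 ℕ.< c → ¬ y ≈ 0# →
             c ℕ.* a ≡ b ℕ.* d →
             t / (y * fromℕ c) ≈ fromℕ a * t / (y * fromℕ b * fromℕ d)
  fraction a b c d y t a>0 c>0 y≉0 ca≡bd = /-unique ybd≉0 (begin
      t / yc * (y * fromℕ b * fromℕ d)    ≈⟨ *-congˡ eq ⟩
      t / yc * (yc * fromℕ a)             ≈⟨ *-assoc _ _ _ ⟨
      t / yc * yc * fromℕ a               ≈⟨ *-congʳ (/-*-cancel (*≉0 y≉0 (fromℕ≉0 c>0))) ⟩
      t * fromℕ a                         ≈⟨ *-comm _ _ ⟩
      fromℕ a * t                         ∎)
    where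
    open MultProperties semiring using (×1-homo-*)
    yc : Carrier
    yc = y * fromℕ c
    eq : y * fromℕ b * fromℕ d ≈ yc * fromℕ a
    eq = begin
      y * fromℕ b * fromℕ d      ≈⟨ *-assoc _ _ _ ⟩
      y * (fromℕ b * fromℕ d)    ≈⟨ *-congˡ (×1-homo-* b d) ⟨
      y * fromℕ (b ℕ.* d)        ≡⟨ ≡.cong (λ k → y * fromℕ k) ca≡bd ⟨
      y * fromℕ (c ℕ.* a)        ≈⟨ *-congˡ (×1-homo-* c a) ⟩
      y * (fromℕ c * fromℕ a)    ≈⟨ *-assoc _ _ _ ⟨
      yc * fromℕ a               ∎
    ybd≉0 : ¬ y * fromℕ b * fromℕ d ≈ 0#
    ybd≉0 p = *≉0 (*≉0 y≉0 (fromℕ≉0 c>0)) (fromℕ≉0 a>0) (trans (sym eq) p)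


-- Finite lists and subsets under excluded middle

module Enumeration (lem : ExcludedMiddle 0ℓ) where
  open Classical lem

  module _ {A : Set} {P : Pred A 0ℓ} where

    ∈-select⁺ : ∀ {a xs} → a ∈ xs → P a → a ∈ select P xs
    ∈-select⁺ = ∈-filter⁺ (λ a → lem {P a})

    ∈-select⁻ : ∀ {a} xs → a ∈ select P xs → a ∈ xs × P a
    ∈-select⁻ xs = ∈-filter⁻ (λ a → lem {P a}) {xs = xs}

    select-unique : ∀ {xs} → Unique xs → Unique (select P xs)
    select-unique = Unique.filter⁺ (λ a → lem {P a})

    count-pos : ∀ {a xs} → a ∈ xs → P a → 0 ℕ.< count P xs
    count-pos a∈xs Pa = ∈-length (∈-select⁺ a∈xs Pa)

  module _ {A : Set} {P Q : Pred A 0ℓ} (P⊆Q : ∀ a → P a → Q a) where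

    count-mono : ∀ xs → count P xs ℕ.≤ count Q xs
    count-mono []       = z≤n
    count-mono (a ∷ xs) with lem {P a} | lem {Q a}
    ... | yes _ | yes _ = s≤s (count-mono xs)
    ... | yes p | no ¬q = contradiction (P⊆Q a p) ¬q
    ... | no _  | yes _ = ℕₚ.m≤n⇒m≤1+n (count-mono xs)
    ... | no _  | no _  = count-mono xs

    count-mono-< : ∀ {a xs} → a ∈ xs → Q a → ¬ P a → count P xs ℕ.< count Q xs
    count-mono-< {a} {_ ∷ xs} (here ≡.refl) q ¬p with lem {P a} | lem {Q a}
    ... | yes p | _     = contradiction p ¬p
    ... | no _  | yes _ = s≤s (count-mono xs)
    ... | no _  | no ¬q = contradiction q ¬q
    count-mono-< {a} {b ∷ xs} (there a∈xs) q ¬p with lem {P b} | lem {Q b}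
    ... | yes _ | yes _ = s≤s (count-mono-< a∈xs q ¬p)
    ... | yes p | no ¬q = contradiction (P⊆Q b p) ¬q
    ... | no _  | yes _ = ℕₚ.m≤n⇒m≤1+n (count-mono-< a∈xs q ¬p)
    ... | no _  | no _  = count-mono-< a∈xs q ¬p

  decide-true : ∀ {P} → P → decide P ≡ true
  decide-true {P} p with lem {P}
  ... | yes _ = ≡.refl
  ... | no ¬p = contradiction p ¬p

  decide-false : ∀ {P} → ¬ P → decide P ≡ false
  decide-false {P} ¬p with lem {P}
  ... | yes p = contradiction p ¬p
  ... | no _  = ≡.refl

  decide-cong : ∀ {P Q} → (P → Q) → (Q → P) → decide P ≡ decide Q
  decide-cong {P} f g with lem {P}
  ... | yes p = ≡.sym (decide-true (f p))
  ... | no ¬p = ≡.sym (decide-false (¬p ∘ g))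

  module _ {k : ℕ} {P : Pred (Fin k) 0ℓ} where

    ∈-subset⁺ : ∀ {i} → P i → i Subset.∈ subset P
    ∈-subset⁺ {i} p = Vec.lookup⇒[]= i _ (≡.trans (Vec.lookup∘tabulate _ i) (decide-true p))

    ∈-subset⁻ : ∀ {i} → i Subset.∈ subset P → P i
    ∈-subset⁻ {i} i∈ with lem {P i} | ≡.trans (≡.sym (Vec.lookup∘tabulate (λ j → does (lem {P j})) i)) (Vec.[]=⇒lookup i∈)
    ... | yes p | _ = p
    ... | no _  | ()

  subset-cong : ∀ {k} {P Q : Pred (Fin k) 0ℓ} → (∀ i → P i → Q i) → (∀ i → Q i → P i) → subset P ≡ subset Q
  subset-cong P⊆Q Q⊆P = Vec.tabulate-cong (λ i → decide-cong (P⊆Q i) (Q⊆P i))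

  -- The second argument is a default, returned only when nothing satisfies the predicate. No
  -- existence proof is taken, so the chosen element depends on the predicate and the default alone.
  choose : ∀ {A : Set} → Pred A 0ℓ → A → A
  choose P d with lem {∃ P}
  ... | yes (a , _) = a
  ... | no _        = d

  choose-spec : ∀ {A : Set} {P : Pred A 0ℓ} d → ∃ P → P (choose P d)
  choose-spec {P = P} d ∃P with lem {∃ P}
  ... | yes (_ , p) = p
  ... | no ¬∃P      = contradiction ∃P ¬∃P

module _ {A : Set} where

  ∈-allVecs : ∀ {xs : List A} → (∀ a → a ∈ xs) → ∀ {k} (v : Vec A k) → v ∈ allVecs xs k
  ∈-allVecs complete Vec.[]      = here ≡.refl
  ∈-allVecs complete (a Vec.∷ v) = ∈-cartesianProductWith⁺ Vec._∷_ (complete a) (∈-allVecs complete v)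

  allVecs-unique : ∀ {xs : List A} → Unique xs → ∀ k → Unique (allVecs xs k)
  allVecs-unique xs! zero    = [] ∷ []
  allVecs-unique xs! (suc k) =
    Unique.cartesianProductWith⁺ Vec._∷_ Vec.∷-injective xs! (allVecs-unique xs! k)

allSubsets-unique : ∀ k → Unique (allSubsets k)
allSubsets-unique = allVecs-unique (((λ ()) ∷ []) ∷ [] ∷ [])

∈-allSubsets : ∀ {k} (S : Subset k) → S ∈ allSubsets k
∈-allSubsets = ∈-allVecs λ { true → here ≡.refl ; false → there (here ≡.refl) }

-- Bijections between finite lists, and sums over lists

map-unique : ∀ {A B : Set} (f : A → B) {xs} → (∀ {a b} → a ∈ xs → b ∈ xs → f a ≡ f b → a ≡ b) →
             Unique xs → Unique (List.map f xs)
map-unique f inj []           = []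
map-unique f inj (x∉xs ∷ xs!) =
  All.map⁺ (All.tabulate λ y∈xs eq → All.lookup x∉xs y∈xs (inj (here ≡.refl) (there y∈xs) eq)) ∷
  map-unique f (λ a∈ b∈ → inj (there a∈) (there b∈)) xs!

-- Only listed elements are constrained, so a map defined on a whole type can serve as a bijection
-- between finite parts. Equal lengths and equal sums both come from the permutation `map-to-↭`.
record _⤖ᴸ_ {A B : Set} (xs : List A) (ys : List B) : Set where
  field
    to         : A → B
    to-∈       : ∀ {a} → a ∈ xs → to a ∈ ys
    injective  : ∀ {a b} → a ∈ xs → b ∈ xs → to a ≡ to b → a ≡ b
    surjective : ∀ {b} → b ∈ ys → ∃ λ a → a ∈ xs × to a ≡ b

  module _ (xs! : Unique xs) (ys! : Unique ys) where

    map-to-↭ : List.map to xs ↭ ys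
    map-to-↭ = ∼bag⇒↭ (unique∧set⇒bag (map-unique to injective xs!) ys! (mk⇔ forth back))
      where
      forth : ∀ {b} → b ∈ List.map to xs → b ∈ ys
      forth b∈ with ∈-map⁻ to b∈
      ... | a , a∈xs , ≡.refl = to-∈ a∈xs
      back : ∀ {b} → b ∈ ys → b ∈ List.map to xs
      back b∈ with surjective b∈
      ... | a , a∈xs , ≡.refl = ∈-map⁺ to a∈xs

    length-≡ : length xs ≡ length ys
    length-≡ = ≡.trans (≡.sym (List.length-map to xs)) (↭-length map-to-↭)

length-cartesianProduct : ∀ {A B : Set} (xs : List A) (ys : List B) →
                          length (cartesianProduct xs ys) ≡ length xs ℕ.* length ys
length-cartesianProduct []       ys = ≡.refl
length-cartesianProduct (x ∷ xs) ys =
  ≡.trans (List.length-++ (List.map (x ,_) ys))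
          (≡.cong₂ ℕ._+_ (List.length-map (x ,_) ys) (length-cartesianProduct xs ys))

module ListSums (ℝ : RealNumbers) where
  open RealNumbers ℝ
  open OrderedField ℝ

  sumList-cong : ∀ {A : Set} {f g : A → Carrier} xs → (∀ {a} → a ∈ xs → f a ≈ g a) →
                 sumList xs f ≈ sumList xs g
  sumList-cong []       p = refl
  sumList-cong (x ∷ xs) p = +-cong (p (here ≡.refl)) (sumList-cong xs (p ∘ there))

  sumList-map : ∀ {A B : Set} (h : A → B) (f : B → Carrier) xs →
                sumList (List.map h xs) f ≈ sumList xs (f ∘ h)
  sumList-map h f []       = refl
  sumList-map h f (x ∷ xs) = +-congˡ (sumList-map h f xs)

  sumList-↭ : ∀ {A : Set} (f : A → Carrier) {xs ys} → xs ↭ ys → sumList xs f ≈ sumList ys f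
  sumList-↭ f ↭.refl          = refl
  sumList-↭ f (↭.prep x p)    = +-congˡ (sumList-↭ f p)
  sumList-↭ f (↭.swap x y p)  =
    trans (sym (+-assoc _ _ _)) (trans (+-cong (+-comm _ _) (sumList-↭ f p)) (+-assoc _ _ _))
  sumList-↭ f (↭.trans p q)   = trans (sumList-↭ f p) (sumList-↭ f q)

  sumList-⤖ : ∀ {A B : Set} {xs : List A} {ys : List B} (φ : xs ⤖ᴸ ys) → Unique xs → Unique ys →
              ∀ {f g} → (∀ {a} → a ∈ xs → f a ≈ g (_⤖ᴸ_.to φ a)) → sumList xs f ≈ sumList ys g
  sumList-⤖ {xs = xs} φ xs! ys! {f} {g} f≈g =
    trans (sumList-cong xs f≈g)
      (trans (sym (sumList-map to g xs)) (sumList-↭ g (map-to-↭ xs! ys!)))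
    where open _⤖ᴸ_ φ

  maximum : ∀ {A : Set} (f : A → Carrier) {a} xs → a ∈ xs →
            ∃ λ m → m ∈ xs × (∀ {b} → b ∈ xs → ¬ f m < f b)
  maximum f (x ∷ [])       _ = x , here ≡.refl , λ { (here ≡.refl) → <-irrefl refl }
  maximum f (x ∷ xs@(y ∷ _)) _ with maximum f xs (here ≡.refl)
  ... | m , m∈xs , m-max with compare (f m) (f x)
  ... | tri< m<x _ _ = x , here ≡.refl ,
        λ { (here ≡.refl) → <-irrefl refl ; (there b∈xs) x<b → m-max b∈xs (<-trans m<x x<b) }
  ... | tri≈ m≮x _ _ = m , there m∈xs , λ { (here ≡.refl) → m≮x ; (there b∈xs) → m-max b∈xs }
  ... | tri> m≮x _ _ = m , there m∈xs , λ { (here ≡.refl) → m≮x ; (there b∈xs) → m-max b∈xs }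


-- Euclidean space

module EuclideanProperties (ℝ : RealNumbers) where
  open RealNumbers ℝ
  open OrderedField ℝ
  open EuclideanSpace ℝ
  open SetoidReasoning setoid

  module _ {n : ℕ} where

    ≋-refl : {u : V n} → u ≋ u
    ≋-refl k = refl

    ≋-sym : {u v : V n} → u ≋ v → v ≋ u
    ≋-sym p k = sym (p k)

    ≋-trans : {u v w : V n} → u ≋ v → v ≋ w → u ≋ w
    ≋-trans p q k = trans (p k) (q k)

    ⟨⟩-cong : {u u′ v v′ : V n} → u ≋ u′ → v ≋ v′ → ⟨ u , v ⟩ ≈ ⟨ u′ , v′ ⟩
    ⟨⟩-cong p q = sum-cong-≋ (λ k → *-cong (p k) (q k))

    ⟨⟩-comm : (u v : V n) → ⟨ u , v ⟩ ≈ ⟨ v , u ⟩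
    ⟨⟩-comm u v = sum-cong-≋ (λ k → *-comm (u k) (v k))

    ⟨⟩-+ʳ : (u v w : V n) → ⟨ u , v +ᵛ w ⟩ ≈ ⟨ u , v ⟩ + ⟨ u , w ⟩
    ⟨⟩-+ʳ u v w = trans (sum-cong-≋ (λ k → distribˡ (u k) (v k) (w k))) (∑-distrib-+ (λ k → u k * v k) (λ k → u k * w k))

    ⟨⟩-*ʳ : (u : V n) (c : Carrier) (v : V n) → ⟨ u , c *ᵛ v ⟩ ≈ c * ⟨ u , v ⟩
    ⟨⟩-*ʳ u c v = trans (sum-cong-≋ lemma) (sym (*-distribˡ-sum c (λ k → u k * v k)))
      where
      lemma : ∀ k → u k * (c * v k) ≈ c * (u k * v k)
      lemma k = trans (sym (*-assoc _ _ _)) (trans (*-congʳ (*-comm _ _)) (*-assoc _ _ _))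

    -ᵛ≋-1*ᵛ : (v : V n) → -ᵛ v ≋ (- 1#) *ᵛ v
    -ᵛ≋-1*ᵛ v k = sym (-1*x≈-x (v k))

    ⟨⟩-negʳ : (u v : V n) → ⟨ u , -ᵛ v ⟩ ≈ - ⟨ u , v ⟩
    ⟨⟩-negʳ u v = trans (⟨⟩-cong ≋-refl (-ᵛ≋-1*ᵛ v)) (trans (⟨⟩-*ʳ u (- 1#) v) (-1*x≈-x _))

    ⟨⟩-negˡ : (u v : V n) → ⟨ -ᵛ u , v ⟩ ≈ - ⟨ u , v ⟩
    ⟨⟩-negˡ u v = trans (⟨⟩-comm _ v) (trans (⟨⟩-negʳ v u) (-‿cong (⟨⟩-comm v u)))

    ⟨⟩--ʳ : (u v w : V n) → ⟨ u , v -ᵛ w ⟩ ≈ ⟨ u , v ⟩ - ⟨ u , w ⟩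
    ⟨⟩--ʳ u v w = trans (⟨⟩-+ʳ u v (-ᵛ w)) (+-congˡ (⟨⟩-negʳ u w))

    ⟨⟩-linCombʳ : ∀ {d} (u : V n) (c : Fin d → Carrier) (b : Fin d → V n) →
                  ⟨ u , linComb c b ⟩ ≈ sum (λ j → c j * ⟨ u , b j ⟩)
    ⟨⟩-linCombʳ u c b = begin
      sum (λ k → u k * sum (λ j → c j * b j k))      ≈⟨ sum-cong-≋ (λ k → *-distribˡ-sum (u k) (λ j → c j * b j k)) ⟩
      sum (λ k → sum (λ j → u k * (c j * b j k)))    ≈⟨ ∑-comm (λ k j → u k * (c j * b j k)) ⟩
      sum (λ j → ⟨ u , c j *ᵛ b j ⟩)                 ≈⟨ sum-cong-≋ (λ j → ⟨⟩-*ʳ u (c j) (b j)) ⟩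
      sum (λ j → c j * ⟨ u , b j ⟩)                  ∎

    ⟨⟩-pos-def : (v : V n) → ¬ v ≋ 0ᵛ → 0# < ⟨ v , v ⟩
    ⟨⟩-pos-def v v≉0 with sum-nonneg (λ k → v k * v k) (λ k → square-nonneg (v k))
    ... | inj₁ p = p
    ... | inj₂ p = contradiction v≋0 v≉0
      where
      v≋0 : v ≋ 0ᵛ
      v≋0 k with compare (v k) 0#
      ... | tri< _ q _ = contradiction (sum≈0 _ (λ k → square-nonneg (v k)) (sym p) k) (*≉0 q q)
      ... | tri≈ _ q _ = q
      ... | tri> _ q _ = contradiction (sum≈0 _ (λ k → square-nonneg (v k)) (sym p) k) (*≉0 q q)

    -- Spelled exactly as in `reflect`, so that `reflect α v` is `v -ᵛ coroot α v *ᵛ α` by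
    -- definition.
    coroot : V n → V n → Carrier
    coroot α v = ((1# + 1#) * ⟨ v , α ⟩) / ⟨ α , α ⟩

    ⟨⟩-reflectʳ : (α u v : V n) → ⟨ u , reflect α v ⟩ ≈ ⟨ u , v ⟩ - coroot α v * ⟨ u , α ⟩
    ⟨⟩-reflectʳ α u v = trans (⟨⟩--ʳ u v _) (+-congˡ (-‿cong (⟨⟩-*ʳ u _ α)))

    -- Both sides are 2⟨u,α⟩⟨v,α⟩/⟨α,α⟩. This symmetry in u and v makes a reflection self-adjoint.
    coroot-exchange : (α u v : V n) → coroot α v * ⟨ u , α ⟩ ≈ coroot α u * ⟨ v , α ⟩
    coroot-exchange α u v = begin
      (2# * a) * N⁻¹ * b       ≈⟨ *-assoc _ _ _ ⟩
      (2# * a) * (N⁻¹ * b)     ≈⟨ *-congˡ (*-comm _ _) ⟩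
      (2# * a) * (b * N⁻¹)     ≈⟨ *-assoc _ _ _ ⟨
      (2# * a) * b * N⁻¹       ≈⟨ *-congʳ lemma ⟩
      (2# * b) * a * N⁻¹       ≈⟨ *-assoc _ _ _ ⟩
      (2# * b) * (a * N⁻¹)     ≈⟨ *-congˡ (*-comm _ _) ⟩
      (2# * b) * (N⁻¹ * a)     ≈⟨ *-assoc _ _ _ ⟨
      (2# * b) * N⁻¹ * a       ∎
      where
      2# a b N⁻¹ : Carrier
      2#  = 1# + 1#
      a   = ⟨ v , α ⟩
      b   = ⟨ u , α ⟩
      N⁻¹ = ⟨ α , α ⟩ ⁻¹
      lemma : (2# * a) * b ≈ (2# * b) * a
      lemma = trans (*-assoc _ _ _) (trans (*-congˡ (*-comm a b)) (sym (*-assoc _ _ _)))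

    reflect-adjoint : (α u v : V n) → ⟨ reflect α u , v ⟩ ≈ ⟨ u , reflect α v ⟩
    reflect-adjoint α u v = begin
      ⟨ reflect α u , v ⟩                        ≈⟨ ⟨⟩-comm _ v ⟩
      ⟨ v , reflect α u ⟩                        ≈⟨ ⟨⟩-reflectʳ α v u ⟩
      ⟨ v , u ⟩ - coroot α u * ⟨ v , α ⟩         ≈⟨ +-cong (⟨⟩-comm v u) (-‿cong (coroot-exchange α v u)) ⟩
      ⟨ u , v ⟩ - coroot α v * ⟨ u , α ⟩         ≈⟨ ⟨⟩-reflectʳ α u v ⟨
      ⟨ u , reflect α v ⟩                        ∎

    reflect-self : (α : V n) → ¬ α ≋ 0ᵛ → reflect α α ≋ -ᵛ α
    reflect-self α α≉0 k = begin
      α k - coroot α α * α k             ≈⟨ +-congˡ (-‿cong (*-congʳ c≈2)) ⟩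
      α k - (1# + 1#) * α k              ≈⟨ +-congˡ (-‿cong (trans (distribʳ _ _ _) (+-cong (*-identityˡ _) (*-identityˡ _)))) ⟩
      α k - (α k + α k)                  ≈⟨ +-congˡ (-‿+-comm _ _) ⟨
      α k + (- α k + - α k)              ≈⟨ +-assoc _ _ _ ⟨
      α k - α k + - α k                  ≈⟨ +-congʳ (-‿inverseʳ _) ⟩
      0# + - α k                         ≈⟨ +-identityˡ _ ⟩
      - α k                              ∎
      where
      c≈2 : coroot α α ≈ 1# + 1#
      c≈2 = sym (/-unique (pos⇒≉0 (⟨⟩-pos-def α α≉0)) refl)

    reflect-fixes : (α v : V n) → ⟨ v , α ⟩ ≈ 0# → reflect α v ≋ v
    reflect-fixes α v p k = begin
      v k - coroot α v * α k    ≈⟨ +-congˡ (-‿cong (*-congʳ (*-congʳ (*-congˡ p)))) ⟩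
      v k - (1# + 1#) * 0# * ⟨ α , α ⟩ ⁻¹ * α k  ≈⟨ +-congˡ (-‿cong (*-congʳ (*-congʳ (zeroʳ _)))) ⟩
      v k - 0# * ⟨ α , α ⟩ ⁻¹ * α k  ≈⟨ +-congˡ (-‿cong (*-congʳ (zeroˡ _))) ⟩
      v k - 0# * α k            ≈⟨ +-congˡ (-‿cong (zeroˡ _)) ⟩
      v k - 0#                  ≈⟨ +-congˡ -0#≈0# ⟩
      v k + 0#                  ≈⟨ +-identityʳ _ ⟩
      v k                       ∎

    coroot-neg : (α v : V n) → ¬ α ≋ 0ᵛ → ⟨ v , α ⟩ < 0# → coroot α v < 0#
    coroot-neg α v α≉0 p =
      <-respˡ-≈ (*-comm _ _) (*-neg (⁻¹-pos (⟨⟩-pos-def α α≉0)) (*-neg (0<+ 0<1 (inj₁ 0<1)) p))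

  -- Besides being the Kronecker symbol, `δ j` with one index is the j-th standard basis vector.
  δ : ∀ {n} → Fin n → Fin n → Carrier
  δ i j = if does (i Fin.≟ j) then 1# else 0#

  δ-≡ : ∀ {n} (i : Fin n) → δ i i ≈ 1#
  δ-≡ i with i Fin.≟ i
  ... | yes _  = refl
  ... | no i≢i = contradiction ≡.refl i≢i

  δ-≢ : ∀ {n} {i j : Fin n} → i ≢ j → δ i j ≈ 0#
  δ-≢ {i = i} {j} i≢j with i Fin.≟ j
  ... | yes i≡j = contradiction i≡j i≢j
  ... | no _    = refl

  sum-δ : ∀ {n} (i : Fin n) (f : Fin n → Carrier) → sum (λ j → δ i j * f j) ≈ f i
  sum-δ i f = begin
    sum (λ j → δ i j * f j)    ≈⟨ sum-single _ i (λ j j≢i → trans (*-congʳ (δ-≢ (j≢i ∘ ≡.sym))) (zeroˡ _)) ⟩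
    δ i i * f i                ≈⟨ *-congʳ (δ-≡ i) ⟩
    1# * f i                   ≈⟨ *-identityˡ _ ⟩
    f i                        ∎

  module DualBasis {n : ℕ} (b : Fin n → V n) (b-basis : IsBasis b) where

    private
      coefficient : Fin n → Fin n → Carrier
      coefficient j = proj₁ (proj₂ b-basis (δ j))

      δ-expand : ∀ j → δ j ≋ linComb (coefficient j) b
      δ-expand j = proj₂ (proj₂ b-basis (δ j))

    -- The coordinate functional of `b i`, as the vector of its values on the standard basis: entry
    -- j is the i-th coordinate of e_j. For the simple roots these are the fundamental weights up to
    -- positive factors.
    dual : Fin n → V n
    dual i j = coefficient j i

    private
      -- Any v is Σⱼ v j · eⱼ, and eⱼ = Σᵢ dual i j · b i.
      expand′ : ∀ v → linComb (λ i → ⟨ dual i , v ⟩) b ≋ v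
      expand′ v l = begin
        sum (λ i → ⟨ dual i , v ⟩ * b i l)                            ≈⟨ sum-cong-≋ (λ i → *-distribʳ-sum (b i l) (λ j → coefficient j i * v j)) ⟩
        sum (λ i → sum (λ j → coefficient j i * v j * b i l))         ≈⟨ ∑-comm (λ i j → coefficient j i * v j * b i l) ⟩
        sum (λ j → sum (λ i → coefficient j i * v j * b i l))         ≈⟨ sum-cong-≋ (λ j → sum-cong-≋ (λ i → swap (coefficient j i) (v j) (b i l))) ⟩
        sum (λ j → sum (λ i → v j * (coefficient j i * b i l)))       ≈⟨ sum-cong-≋ (λ j → *-distribˡ-sum (v j) (λ i → coefficient j i * b i l)) ⟨
        sum (λ j → v j * linComb (coefficient j) b l)                 ≈⟨ sum-cong-≋ (λ j → *-congˡ (δ-expand j l)) ⟨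
        sum (λ j → v j * δ j l)                                       ≈⟨ sum-cong-≋ (λ j → trans (*-comm _ _) (*-congʳ (δ-sym j l))) ⟩
        sum (λ j → δ l j * v j)                                       ≈⟨ sum-δ l v ⟩
        v l                                                           ∎
        where
        swap : ∀ x y z → x * y * z ≈ y * (x * z)
        swap x y z = trans (*-congʳ (*-comm x y)) (*-assoc y x z)
        δ-sym : ∀ i j → δ i j ≈ δ j i
        δ-sym i j with i Fin.≟ j
        ... | yes ≡.refl = sym (δ-≡ i)
        ... | no i≢j     = sym (δ-≢ (i≢j ∘ ≡.sym))

    expand : ∀ v → v ≋ linComb (λ i → ⟨ dual i , v ⟩) b
    expand v = ≋-sym (expand′ v)

    ⟨⟩-expand : ∀ u v → ⟨ u , v ⟩ ≈ sum (λ i → ⟨ dual i , v ⟩ * ⟨ u , b i ⟩)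
    ⟨⟩-expand u v = trans (⟨⟩-cong ≋-refl (expand v)) (⟨⟩-linCombʳ u _ b)

    coordinates-unique : ∀ c v → v ≋ linComb c b → ∀ i → ⟨ dual i , v ⟩ ≈ c i
    coordinates-unique c v v≋ i =
      x∙y⁻¹≈ε⇒x≈y _ _ (proj₁ b-basis (λ j → ⟨ dual j , v ⟩ - c j) zero-comb i)
      where
      zero-comb : linComb (λ j → ⟨ dual j , v ⟩ - c j) b ≋ 0ᵛ
      zero-comb k = begin
        sum (λ j → (⟨ dual j , v ⟩ - c j) * b j k)                            ≈⟨ sum-cong-≋ (λ j → distribʳ (b j k) ⟨ dual j , v ⟩ (- c j)) ⟩
        sum (λ j → ⟨ dual j , v ⟩ * b j k + - c j * b j k)                    ≈⟨ ∑-distrib-+ (λ j → ⟨ dual j , v ⟩ * b j k) (λ j → - c j * b j k) ⟩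
        linComb (λ j → ⟨ dual j , v ⟩) b k + sum (λ j → - c j * b j k)        ≈⟨ +-cong (expand′ v k) (sum-cong-≋ (λ j → trans (*-congʳ (sym (-1*x≈-x (c j)))) (*-assoc (- 1#) (c j) (b j k)))) ⟩
        v k + sum (λ j → - 1# * (c j * b j k))                                ≈⟨ +-congˡ (*-distribˡ-sum (- 1#) (λ j → c j * b j k)) ⟨
        v k + - 1# * linComb c b k                                            ≈⟨ +-congˡ (trans (-1*x≈-x _) (-‿cong (sym (v≋ k)))) ⟩
        v k - v k                                                             ≈⟨ -‿inverseʳ _ ⟩
        0#                                                                    ∎

    dual-pairing : ∀ i k → ⟨ dual i , b k ⟩ ≈ δ k i
    dual-pairing i k = coordinates-unique (δ k) (b k) (λ l → sym (sum-δ k (λ j → b j l))) i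

  -- Bounds on pairings over small cubes

  private
    -- A substitute for the absolute value: 1 + x² exceeds both x and -x and is even in x.
    bound : Carrier → Carrier
    bound x = 1# + x * x

    bound-neg : ∀ x → bound (- x) ≈ bound x
    bound-neg x = +-congˡ (-x*-y≈x*y x x)

    <bound : ∀ x → x < bound x
    -- The difference 1 + x² - x is regrouped as (1 - x) + x² for x < 1 and as 1 + x(x - 1) for x >
    -- 1, where every summand is visibly nonnegative.
    <bound x = 0<-⇒< (case compare x 1# of λ where
        (tri< p _ _) → <-respʳ-≈ +-swap (0<+ (<⇒0<- p) (square-nonneg x))
        (tri≈ _ p _) → <-respʳ-≈ (sym (1+y-z≈1 (trans (*-congʳ p) (*-identityˡ x)))) 0<1
        (tri> _ _ p) → <-respʳ-≈ factor (0<+ 0<1 (*-nonneg (inj₁ (<-trans 0<1 p)) (inj₁ (<⇒0<- p)))))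
      where
      +-swap : 1# - x + x * x ≈ bound x - x
      +-swap = trans (+-assoc _ _ _) (trans (+-congˡ (+-comm _ _)) (sym (+-assoc _ _ _)))
      1+y-z≈1 : ∀ {y z} → y ≈ z → 1# + y - z ≈ 1#
      1+y-z≈1 p = trans (+-assoc _ _ _) (trans (+-congˡ (x≈y⇒x∙y⁻¹≈ε p)) (+-identityʳ 1#))
      factor : 1# + x * (x - 1#) ≈ bound x - x
      factor = trans (+-congˡ (trans (x[y-z]≈xy-xz x x 1#) (+-congˡ (-‿cong (*-identityʳ x)))))
                     (sym (+-assoc _ _ _))

    bound-nonneg : ∀ x → 0# ≤ bound x
    bound-nonneg x = inj₁ (0<+ 0<1 (square-nonneg x))

    -- Exceeds every coordinate of u and -u, and also the sum of their absolute values. The first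
    -- fact scales a vector into a cube, the second bounds a pairing on a cube. The leading 1 keeps
    -- it positive in dimension 0 and `⟨⟩-estimate` strict.
    majorant : ∀ {n} → V n → Carrier
    majorant u = 1# + sum (λ k → bound (u k))

    majorant-pos : ∀ {n} (u : V n) → 0# < majorant u
    majorant-pos u = 0<+ 0<1 (sum-nonneg _ (λ k → bound-nonneg (u k)))

    majorant-neg : ∀ {n} (u : V n) → majorant (-ᵛ u) ≈ majorant u
    majorant-neg u = +-congˡ (sum-cong-≋ (λ k → bound-neg (u k)))

    term≤sum : ∀ {k} (f : Fin k → Carrier) → (∀ i → 0# ≤ f i) → ∀ i → 0# ≤ sum f - f i
    term≤sum f p zero =
      ≤-resp refl (sym (xyx⁻¹≈y _ _)) (sum-nonneg (f ∘ suc) (p ∘ suc))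
    term≤sum f p (suc i) =
      ≤-resp refl (sym (+-assoc _ _ _)) (+-nonneg (p zero) (term≤sum (f ∘ suc) (p ∘ suc) i))

    <majorant : ∀ {n} (u : V n) k → u k < majorant u
    <majorant u k = 0<-⇒< (<-respʳ-≈ lemma (0<+ 0<1 (+-nonneg (inj₁ (<⇒0<- (<bound (u k))))
                                                   (term≤sum _ (λ i → bound-nonneg (u i)) k))))
      where
      S : Carrier
      S = sum (λ i → bound (u i))
      lemma : 1# + (bound (u k) - u k + (S - bound (u k))) ≈ 1# + S - u k
      lemma = begin
        1# + (bound (u k) - u k + (S - bound (u k)))        ≈⟨ +-congˡ (+-comm _ _) ⟩
        1# + (S - bound (u k) + (bound (u k) - u k))        ≈⟨ +-congˡ (+-assoc _ _ _) ⟩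
        1# + (S + (- bound (u k) + (bound (u k) - u k)))    ≈⟨ +-congˡ (+-congˡ (\\-leftDividesʳ _ _)) ⟩
        1# + (S - u k)                                      ≈⟨ +-assoc _ _ _ ⟨
        1# + S - u k                                        ∎

  -- Closure is taken with respect to cubes: this replaces the continuity of
  -- scalar multiplication at 0.
  small-multiple : ∀ {n} (u : V n) {ε} → 0# < ε → ∃ λ t → 0# < t × (∀ k → t * u k < ε × - (t * u k) < ε)
  small-multiple u {ε} ε>0 = t , t>0 , λ k → estimate k , estimate-neg k
    where
    t : Carrier
    t = ε * majorant u ⁻¹
    t>0 : 0# < t
    t>0 = *-pos ε>0 (⁻¹-pos (majorant-pos u))
    tM≈ε : t * majorant u ≈ ε
    tM≈ε = /-*-cancel (pos⇒≉0 (majorant-pos u))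
    scale : ∀ {y} → y < majorant u → t * y < ε
    scale {y} p = <-respʳ-≈ tM≈ε (0<-⇒< (<-respʳ-≈ (x[y-z]≈xy-xz t _ y) (*-pos t>0 (<⇒0<- p))))
    estimate : ∀ k → t * u k < ε
    estimate k = scale (<majorant u k)
    estimate-neg : ∀ k → - (t * u k) < ε
    estimate-neg k = <-respˡ-≈ (sym (-‿distribʳ-* t (u k)))
                       (scale (<-respʳ-≈ (majorant-neg u) (<majorant (-ᵛ u) k)))

  private
    abs<⇒pos : ∀ {d ε} → d < ε → - d < ε → 0# < ε
    abs<⇒pos {d} {ε} p q with compare d 0#
    ... | tri< d<0 _ _ = <-trans (-‿pos d<0) q
    ... | tri≈ _ d≈0 _ = <-respˡ-≈ d≈0 p
    ... | tri> _ _ d>0 = <-trans d>0 p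

    -- With b = `bound a`, the expression is (b - a)ε + a(ε - d), a sum of products of nonnegative
    -- factors; the two bounds on d give ε > 0.
    product-estimate⁺ : ∀ {a} → 0# ≤ a → ∀ {d ε} → d < ε → - d < ε → 0# ≤ bound a * ε - a * d
    product-estimate⁺ {a} a≥0 {d} {ε} p q =
      ≤-resp refl lemma (+-nonneg (*-nonneg (inj₁ (<⇒0<- (<bound a))) (inj₁ (abs<⇒pos p q)))
                                  (*-nonneg a≥0 (inj₁ (<⇒0<- p))))
      where
      b : Carrier
      b = bound a
      lemma : (b - a) * ε + a * (ε - d) ≈ b * ε - a * d
      lemma = begin
        (b - a) * ε + a * (ε - d)              ≈⟨ +-cong ([y-z]x≈yx-zx ε b a) (x[y-z]≈xy-xz a ε d) ⟩
        b * ε - a * ε + (a * ε - a * d)        ≈⟨ +-assoc _ _ _ ⟩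
        b * ε + (- (a * ε) + (a * ε - a * d))  ≈⟨ +-congˡ (\\-leftDividesʳ _ _) ⟩
        b * ε - a * d                          ∎

    product-estimate : ∀ a {d ε} → d < ε → - d < ε → 0# ≤ bound a * ε - a * d
    product-estimate a {d} p q with compare a 0#
    ... | tri< a<0 _ _ = ≤-resp refl (+-cong (*-congʳ (bound-neg a)) (-‿cong (-x*-y≈x*y a d)))
                           (product-estimate⁺ (inj₁ (-‿pos a<0)) q (<-respˡ-≈ (sym (-‿involutive d)) p))
    ... | tri≈ _ a≈0 _ = product-estimate⁺ (inj₂ (sym a≈0)) p q
    ... | tri> _ _ a>0 = product-estimate⁺ (inj₁ a>0) p q

    ⟨⟩-estimate : ∀ {n} (a d : V n) ε → (∀ k → d k < ε × - d k < ε) → 0# < ε →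
                  ⟨ a , d ⟩ < majorant a * ε
    ⟨⟩-estimate a d ε p ε>0 = 0<-⇒< (<-respʳ-≈ lemma
        (0<+ ε>0 (sum-nonneg _ (λ k → product-estimate (a k) (proj₁ (p k)) (proj₂ (p k))))))
      where
      lemma : ε + sum (λ k → bound (a k) * ε - a k * d k) ≈ majorant a * ε - ⟨ a , d ⟩
      lemma = begin
        ε + sum (λ k → bound (a k) * ε - a k * d k)                                  ≈⟨ +-congˡ (∑-distrib-+ (λ k → bound (a k) * ε) (λ k → - (a k * d k))) ⟩
        ε + (sum (λ k → bound (a k) * ε) + sum (λ k → - (a k * d k)))                ≈⟨ +-congˡ (+-cong (sym (*-distribʳ-sum ε (λ k → bound (a k)))) (sum-cong-≋ (λ k → -‿distribʳ-* (a k) (d k)))) ⟩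
        ε + (sum (λ k → bound (a k)) * ε + ⟨ a , -ᵛ d ⟩)                             ≈⟨ +-assoc _ _ _ ⟨
        ε + sum (λ k → bound (a k)) * ε + ⟨ a , -ᵛ d ⟩                               ≈⟨ +-cong (+-congʳ (sym (*-identityˡ ε))) (⟨⟩-negʳ a d) ⟩
        1# * ε + sum (λ k → bound (a k)) * ε - ⟨ a , d ⟩                             ≈⟨ +-congʳ (distribʳ ε 1# _) ⟨
        majorant a * ε - ⟨ a , d ⟩                                                   ∎

  -- If ⟨a,v⟩ were positive, the cube of radius ⟨a,v⟩ / `majorant a` around v would contain a point
  -- u of P; there ⟨a,v-u⟩ < ⟨a,v⟩, which makes ⟨a,u⟩ positive.
  closure-nonpos : ∀ {n} (P : Pred (V n) 0ℓ) (a v : V n) → (∀ u → P u → ⟨ a , u ⟩ < 0#) →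
                   Closure P v → ⟨ a , v ⟩ ≤ 0#
  closure-nonpos P a v u-neg v∈ = ≮⇒≥ λ t>0 →
    let M>0 = majorant-pos a
        ε>0 = *-pos t>0 (⁻¹-pos M>0)
        u , u∈P , near = v∈ (⟨ a , v ⟩ * majorant a ⁻¹) ε>0
        near′ k = proj₂ (near k) , <-respˡ-≈ (sym (⁻¹-anti-homo‿- (v k) (u k))) (proj₁ (near k))
        eq = trans (*-comm _ _) (/-*-cancel (pos⇒≉0 M>0))
        small = <-resp (⟨⟩--ʳ a v u) eq (⟨⟩-estimate a (v -ᵛ u) _ near′ ε>0)
    in <-irrefl refl (<-trans small (0<-⇒< (<-respʳ-≈ (sym (xyx⁻¹≈y _ _)) (-‿pos (u-neg u u∈P)))))

  closure-nonneg : ∀ {n} (P : Pred (V n) 0ℓ) (a v : V n) → (∀ u → P u → 0# < ⟨ a , u ⟩) →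
                   Closure P v → 0# ≤ ⟨ a , v ⟩
  closure-nonneg P a v u-pos v∈ = ≤-resp refl (-‿involutive _) (-‿nonneg (≤-resp (⟨⟩-negˡ a v) refl
    (closure-nonpos P (-ᵛ a) v (λ u u∈P → <-respˡ-≈ (sym (⟨⟩-negˡ a u)) (-‿neg (u-pos u u∈P))) v∈)))


-- Roots and words

module CoxeterGeometry (lem : ExcludedMiddle 0ℓ) (ℝ : RealNumbers) {n : ℕ}
                       (W : FiniteCoxeterGroup n) (ρ : ReflectionRepresentation ℝ W) where
  open RealNumbers ℝ
  open OrderedField ℝ
  open EuclideanSpace ℝ
  open EuclideanProperties ℝ
  open FiniteCoxeterGroup W public
    using (group; elements; elements-complete; elements-unique; s; s-generates; s-relations; m-diagonal)
    renaming (Carrier to |W|; _≈_ to _≈ᵂ_; _∙_ to _∙ᵂ_; ε to εᵂ; _⁻¹ to infix 9 _⁻¹ᵂ; setoid to W-setoid)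
  module Wᴳ = Group group
  module Wᴾ = GroupProperties group
  open ReflectionRepresentation ρ
  open CoxeterTheory lem ℝ W ρ using (FundamentalChamber; Parabolic; Fix)
  open DualBasis α α-basis public
  module ≈-Reasoning = SetoidReasoning setoid
  module ≈ᵂ-Reasoning = SetoidReasoning W-setoid

  •-congˡ : ∀ g {u v} → u ≋ v → g • u ≋ g • v
  •-congˡ g = •-cong Wᴳ.refl

  •-congʳ : ∀ {g h} v → g ≈ᵂ h → g • v ≋ h • v
  •-congʳ v p = •-cong p ≋-refl

  •-inverseʳ : ∀ g v → g • g ⁻¹ᵂ • v ≋ v
  •-inverseʳ g v = ≋-trans (≋-sym (•-assoc g _ v)) (≋-trans (•-congʳ v (Wᴳ.inverseʳ g)) (•-identity v))

  •-inverseˡ : ∀ g v → g ⁻¹ᵂ • g • v ≋ v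
  •-inverseˡ g v = ≋-trans (≋-sym (•-assoc _ g v)) (≋-trans (•-congʳ v (Wᴳ.inverseˡ g)) (•-identity v))

  •-transpose : ∀ g {u v} → u ≋ g • v → g ⁻¹ᵂ • u ≋ v
  •-transpose g {v = v} p = ≋-trans (•-congˡ (g ⁻¹ᵂ) p) (•-inverseˡ g v)

  •-neg : ∀ g v → g • (-ᵛ v) ≋ -ᵛ (g • v)
  •-neg g v = ≋-trans (•-congˡ g (-ᵛ≋-1*ᵛ v)) (≋-trans (•-*ᵛ g (- 1#) v) (≋-sym (-ᵛ≋-1*ᵛ (g • v))))

  -ᵛ-cong : {u v : V n} → u ≋ v → -ᵛ u ≋ -ᵛ v
  -ᵛ-cong p k = -‿cong (p k)

  -ᵛ-involutive : (v : V n) → -ᵛ (-ᵛ v) ≋ v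
  -ᵛ-involutive v k = -‿involutive (v k)

  s-involutive : ∀ i → s i ∙ᵂ s i ≈ᵂ εᵂ
  s-involutive i with FiniteCoxeterGroup.m W i i | m-diagonal i | s-relations i i
  ... | .1 | ≡.refl | p = Wᴳ.trans (Wᴳ.sym (Wᴳ.identityʳ _)) p

  s-inverse : ∀ i → s i ≈ᵂ s i ⁻¹ᵂ
  s-inverse i = Wᴾ.inverseˡ-unique _ _ (s-involutive i)

  word : List (Fin n) → |W|
  word []       = εᵂ
  word (i ∷ is) = s i ∙ᵂ word is

  word-++ : ∀ is js → word (is List.++ js) ≈ᵂ word is ∙ᵂ word js
  word-++ []       js = Wᴳ.sym (Wᴳ.identityˡ _)
  word-++ (i ∷ is) js = Wᴳ.trans (Wᴳ.∙-congˡ (word-++ is js)) (Wᴳ.sym (Wᴳ.assoc _ _ _))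

  word-inverse : ∀ is → ∃ λ js → word js ≈ᵂ word is ⁻¹ᵂ
  word-inverse []       = [] , Wᴳ.sym Wᴾ.ε⁻¹≈ε
  word-inverse (i ∷ is) with word-inverse is
  ... | js , p = js List.++ i ∷ [] , (let open ≈ᵂ-Reasoning in begin
      word (js List.++ i ∷ [])     ≈⟨ word-++ js (i ∷ []) ⟩
      word js ∙ᵂ (s i ∙ᵂ εᵂ)       ≈⟨ Wᴳ.∙-cong p (Wᴳ.trans (Wᴳ.identityʳ _) (s-inverse i)) ⟩
      word is ⁻¹ᵂ ∙ᵂ s i ⁻¹ᵂ       ≈⟨ Wᴾ.⁻¹-anti-homo-∙ _ _ ⟨
      (s i ∙ᵂ word is) ⁻¹ᵂ         ∎)

  word-surjective : ∀ g → ∃ λ is → word is ≈ᵂ g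
  word-surjective g = go (s-generates g)
    where
    go : ∀ {g} → Generated group (λ g → ∃ λ i → g ≈ᵂ s i) g → ∃ λ is → word is ≈ᵂ g
    go (gen (i , p)) = i ∷ [] , Wᴳ.trans (Wᴳ.identityʳ _) (Wᴳ.sym p)
    go unit          = [] , Wᴳ.refl
    go (mul p q)     = let is , eq = go p ; js , eq′ = go q in
      is List.++ js , Wᴳ.trans (word-++ is js) (Wᴳ.∙-cong eq eq′)
    go (inv p)       = let is , eq = go p ; js , eq′ = word-inverse is in
      js , Wᴳ.trans eq′ (Wᴳ.⁻¹-cong eq)
    go (resp r p)    = let is , eq = go p in is , Wᴳ.trans eq r

  -- Every element is a word in the generators, and each generator acts as a self-adjoint
  -- involution; orthogonality of the action follows by induction on the word.
  •-adjoint : ∀ g u v → ⟨ g • u , v ⟩ ≈ ⟨ u , g ⁻¹ᵂ • v ⟩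
  •-adjoint g u v with word-surjective g
  ... | is , p = let open ≈-Reasoning in begin
      ⟨ g • u , v ⟩              ≈⟨ ⟨⟩-cong (•-congʳ u (Wᴳ.sym p)) ≋-refl ⟩
      ⟨ word is • u , v ⟩        ≈⟨ go is u v ⟩
      ⟨ u , word is ⁻¹ᵂ • v ⟩    ≈⟨ ⟨⟩-cong ≋-refl (•-congʳ v (Wᴳ.⁻¹-cong p)) ⟩
      ⟨ u , g ⁻¹ᵂ • v ⟩          ∎
    where
    go : ∀ is u v → ⟨ word is • u , v ⟩ ≈ ⟨ u , word is ⁻¹ᵂ • v ⟩
    go [] u v = ⟨⟩-cong (•-identity u) (≋-sym (≋-trans (•-congʳ v Wᴾ.ε⁻¹≈ε) (•-identity v)))
    go (i ∷ is) u v = let open ≈-Reasoning in begin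
      ⟨ (s i ∙ᵂ w) • u , v ⟩             ≈⟨ ⟨⟩-cong (•-assoc (s i) w u) ≋-refl ⟩
      ⟨ s i • w • u , v ⟩                ≈⟨ ⟨⟩-cong (s-reflects i (w • u)) ≋-refl ⟩
      ⟨ reflect (α i) (w • u) , v ⟩      ≈⟨ reflect-adjoint (α i) (w • u) v ⟩
      ⟨ w • u , reflect (α i) v ⟩        ≈⟨ go is u (reflect (α i) v) ⟩
      ⟨ u , w ⁻¹ᵂ • reflect (α i) v ⟩    ≈⟨ ⟨⟩-cong ≋-refl (•-cong Wᴳ.refl (≋-trans (≋-sym (s-reflects i v)) (•-congʳ v (s-inverse i)))) ⟩
      ⟨ u , w ⁻¹ᵂ • s i ⁻¹ᵂ • v ⟩        ≈⟨ ⟨⟩-cong ≋-refl (≋-sym (•-assoc _ _ v)) ⟩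
      ⟨ u , (w ⁻¹ᵂ ∙ᵂ s i ⁻¹ᵂ) • v ⟩     ≈⟨ ⟨⟩-cong ≋-refl (•-congʳ v (Wᴳ.sym (Wᴾ.⁻¹-anti-homo-∙ _ _))) ⟩
      ⟨ u , (s i ∙ᵂ w) ⁻¹ᵂ • v ⟩         ∎
      where
      w : |W|
      w = word is

  •-adjoint′ : ∀ g u v → ⟨ u , g • v ⟩ ≈ ⟨ g ⁻¹ᵂ • u , v ⟩
  •-adjoint′ g u v = trans (⟨⟩-comm u (g • v)) (trans (•-adjoint g v u) (⟨⟩-comm v (g ⁻¹ᵂ • u)))

  •-isometry : ∀ g u v → ⟨ g • u , g • v ⟩ ≈ ⟨ u , v ⟩
  •-isometry g u v = trans (•-adjoint g u (g • v)) (⟨⟩-cong ≋-refl (•-inverseˡ g v))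

  -- The k-th coordinate is the pairing with `δ k`, so g can be moved to the other side, where the
  -- sum is expanded by bilinearity.
  •-linComb : ∀ {d} g c (b : Fin d → V n) → g • linComb c b ≋ linComb c (λ j → g • b j)
  •-linComb g c b k = let open ≈-Reasoning in begin
    (g • linComb c b) k                                ≈⟨ sum-δ k (g • linComb c b) ⟨
    ⟨ δ k , g • linComb c b ⟩                          ≈⟨ •-adjoint′ g (δ k) (linComb c b) ⟩
    ⟨ g ⁻¹ᵂ • δ k , linComb c b ⟩                      ≈⟨ ⟨⟩-linCombʳ (g ⁻¹ᵂ • δ k) c b ⟩
    sum (λ j → c j * ⟨ g ⁻¹ᵂ • δ k , b j ⟩)            ≈⟨ sum-cong-≋ (λ j → *-congˡ (trans (sym (•-adjoint′ g (δ k) (b j))) (sum-δ k (g • b j)))) ⟩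
    linComb c (λ j → g • b j) k                        ∎

  root-image : ∀ g j → ∃ λ k → root k ≋ g • root j
  root-image g j with word-surjective g
  ... | is , p = let k , q = go is j in k , ≋-trans q (•-congʳ (root j) p)
    where
    go : ∀ is j → ∃ λ k → root k ≋ word is • root j
    go []       j = j , ≋-sym (•-identity (root j))
    go (i ∷ is) j = let k , p = go is j ; l , q = root-reflect (simple i) k in
      l , ≋-trans q (≋-trans (≋-sym (s-reflects i (root k)))
            (≋-trans (•-congˡ (s i) p) (≋-sym (•-assoc (s i) (word is) (root j)))))

  root-negation : ∀ j → ∃ λ k → root k ≋ -ᵛ root j
  root-negation j = let k , p = root-reflect j j in k , ≋-trans p (reflect-self (root j) (root≉0 j))

  Root : Pred (V n) 0ℓ
  Root v = ∃ λ k → root k ≋ v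

  •-Root : ∀ g {v} → Root v → Root (g • v)
  •-Root g (j , p) = let k , q = root-image g j in k , ≋-trans q (•-congˡ g p)

  -ᵛ-Root : ∀ {v} → Root v → Root (-ᵛ v)
  -ᵛ-Root (j , p) = let k , q = root-negation j in k , ≋-trans q (-ᵛ-cong p)

  α-Root : ∀ i → Root (α i)
  α-Root i = simple i , ≋-refl

  Root≉0 : ∀ {v} → Root v → ¬ v ≋ 0ᵛ
  Root≉0 (j , p) v≋0 = root≉0 j (≋-trans p v≋0)

  α≉0 : ∀ i → ¬ α i ≋ 0ᵛ
  α≉0 i = root≉0 (simple i)

  Cone-resp : ∀ {u v} → u ≋ v → Positive u → Positive v
  Cone-resp p (c , c≥0 , q) = c , c≥0 , ≋-trans (≋-sym p) q

  Root-sign : ∀ {v} → Root v → Positive v ⊎ Negative v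
  Root-sign (j , p) with positive∨negative j
  ... | inj₁ q = inj₁ (Cone-resp p q)
  ... | inj₂ q = inj₂ (Cone-resp (-ᵛ-cong p) q)

  Positive⇒coordinates : ∀ {v} → Positive v → ∀ i → 0# ≤ ⟨ dual i , v ⟩
  Positive⇒coordinates {v} (c , c≥0 , p) i = ≤-resp refl (sym (coordinates-unique c v p i)) (c≥0 i)

  coordinates⇒Positive : ∀ {v} → (∀ i → 0# ≤ ⟨ dual i , v ⟩) → Positive v
  coordinates⇒Positive {v} p = _ , p , expand v

  Negative⇒coordinates : ∀ {v} → Negative v → ∀ i → ⟨ dual i , v ⟩ ≤ 0#
  Negative⇒coordinates {v} p i = -‿nonpos (≤-resp refl (⟨⟩-negʳ (dual i) v) (Positive⇒coordinates p i))

  coordinates≈0⇒≋0 : ∀ {v} → (∀ i → ⟨ dual i , v ⟩ ≈ 0#) → v ≋ 0ᵛ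
  coordinates≈0⇒≋0 {v} p k = trans (expand v k) (sum-zero _ (λ j → trans (*-congʳ (p j)) (zeroˡ _)))

  ¬Positive∧Negative : ∀ {v} → Root v → Positive v → ¬ Negative v
  ¬Positive∧Negative r p q = Root≉0 r (coordinates≈0⇒≋0 λ i →
    ≤-antisym (Negative⇒coordinates q i) (Positive⇒coordinates p i))

  α-Positive : ∀ i → Positive (α i)
  α-Positive i = coordinates⇒Positive λ j → ≤-resp refl (sym (dual-pairing j i)) (δ-nonneg i j)
    where
    δ-nonneg : ∀ (i j : Fin n) → 0# ≤ δ i j
    δ-nonneg i j with i Fin.≟ j
    ... | yes _ = inj₁ 0<1
    ... | no _  = inj₂ refl

  proportional : ∀ {v} i c → Root v → Positive v → v ≋ c *ᵛ α i → v ≋ α i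
  proportional i c (j , p) v>0 q with root-reduced (simple i) j c (≋-trans p q)
  ... | inj₁ r = ≋-trans (≋-sym p) r
  ... | inj₂ r = contradiction (Cone-resp (≋-sym (≋-trans (-ᵛ-cong (≋-trans (≋-sym p) r)) (-ᵛ-involutive (α i)))) (α-Positive i))
                               (¬Positive∧Negative (j , p) v>0)

  coordinate-proportional : ∀ {v} i → (∀ j → j ≢ i → ⟨ dual j , v ⟩ ≈ 0#) → v ≋ ⟨ dual i , v ⟩ *ᵛ α i
  coordinate-proportional {v} i p k =
    trans (expand v k) (sum-single _ i (λ j j≢i → trans (*-congʳ (p j j≢i)) (zeroˡ _)))

  s-negates : ∀ i → s i • α i ≋ -ᵛ α i
  s-negates i = ≋-trans (s-reflects i (α i)) (reflect-self (α i) (α≉0 i))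

  -- The reflection `s i` changes only the i-th coordinate. All others are then at once nonnegative
  -- and nonpositive, so v is a multiple of `α i`.
  negated-by-s : ∀ {v} i → Root v → Positive v → Negative (s i • v) → v ≋ α i
  negated-by-s {v} i r v>0 neg′ = proportional i _ r v>0 (coordinate-proportional i λ j j≢i →
    ≤-antisym (≤-resp (unchanged j j≢i) refl (Negative⇒coordinates neg′ j)) (Positive⇒coordinates v>0 j))
    where
    unchanged : ∀ j → j ≢ i → ⟨ dual j , s i • v ⟩ ≈ ⟨ dual j , v ⟩
    unchanged j j≢i = let open ≈-Reasoning in begin
      ⟨ dual j , s i • v ⟩                                     ≈⟨ ⟨⟩-cong ≋-refl (s-reflects i v) ⟩
      ⟨ dual j , reflect (α i) v ⟩                             ≈⟨ ⟨⟩-reflectʳ (α i) (dual j) v ⟩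
      ⟨ dual j , v ⟩ - coroot (α i) v * ⟨ dual j , α i ⟩       ≈⟨ +-congˡ (-‿cong (*-congˡ (trans (dual-pairing j i) (δ-≢ (j≢i ∘ ≡.sym))))) ⟩
      ⟨ dual j , v ⟩ - coroot (α i) v * 0#                     ≈⟨ +-congˡ (trans (-‿cong (zeroʳ _)) -0#≈0#) ⟩
      ⟨ dual j , v ⟩ + 0#                                      ≈⟨ +-identityʳ _ ⟩
      ⟨ dual j , v ⟩                                           ∎

  -- The isometry t conjugates the reflection in `α i` to the reflection in its image `α j`;
  -- faithfulness carries this from the action to the group.
  conjugate-s : ∀ t i j → t • α i ≋ α j → t ∙ᵂ s i ≈ᵂ s j ∙ᵂ t
  conjugate-s t i j p = •-faithful _ _ λ v → ≋-trans (•-assoc t (s i) v)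
    (≋-trans (λ k → lemma v k) (≋-sym (•-assoc (s j) t v)))
    where
    lemma : ∀ v → t • s i • v ≋ s j • t • v
    lemma v k = let open ≈-Reasoning in begin
      (t • s i • v) k                                           ≈⟨ •-congˡ t (s-reflects i v) k ⟩
      (t • (v -ᵛ (coroot (α i) v *ᵛ α i))) k                    ≈⟨ •-+ᵛ t v _ k ⟩
      (t • v) k + (t • (-ᵛ (coroot (α i) v *ᵛ α i))) k          ≈⟨ +-congˡ (•-neg t _ k) ⟩
      (t • v) k - (t • (coroot (α i) v *ᵛ α i)) k               ≈⟨ +-congˡ (-‿cong (•-*ᵛ t _ _ k)) ⟩
      (t • v) k - coroot (α i) v * (t • α i) k                  ≈⟨ +-congˡ (-‿cong (*-cong (*-cong (*-congˡ eq₁) (⁻¹-cong eq₂)) (p k))) ⟩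
      reflect (α j) (t • v) k                                   ≈⟨ s-reflects j (t • v) k ⟨
      (s j • t • v) k                                           ∎
      where
      eq₁ : ⟨ v , α i ⟩ ≈ ⟨ t • v , α j ⟩
      eq₁ = trans (sym (•-isometry t v (α i))) (⟨⟩-cong ≋-refl p)
      eq₂ : ⟨ α i , α i ⟩ ≈ ⟨ α j , α j ⟩
      eq₂ = trans (sym (•-isometry t (α i) (α i))) (⟨⟩-cong p p)

  -- Letters are stripped from the left as long as the remaining word still makes `α i` negative. At
  -- the letter j whose remainder t makes it positive, `s j` turns a positive root negative, so t
  -- sends `α i` to `α j`; hence s_j t s_i = t, and the letter j drops out.
  exchange : ∀ is i → Negative (word is • α i) →
             ∃ λ js → length is ≡ suc (length js) × word js ≈ᵂ word is ∙ᵂ s i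
  exchange [] i neg′ = contradiction (Cone-resp (-ᵛ-cong (•-identity (α i))) neg′)
                                     (¬Positive∧Negative (α-Root i) (α-Positive i))
  exchange (j ∷ is) i neg′ with Root-sign (•-Root (word is) (α-Root i))
  ... | inj₂ neg″ = let js , len , p = exchange is i neg″ in
        j ∷ js , ≡.cong suc len , Wᴳ.trans (Wᴳ.∙-congˡ p) (Wᴳ.sym (Wᴳ.assoc _ _ _))
  ... | inj₁ pos′ = is , ≡.refl , Wᴳ.sym (let open ≈ᵂ-Reasoning in begin
        s j ∙ᵂ t ∙ᵂ s i          ≈⟨ Wᴳ.assoc _ _ _ ⟩
        s j ∙ᵂ (t ∙ᵂ s i)        ≈⟨ Wᴳ.∙-congˡ (conjugate-s t i j tα≋α) ⟩
        s j ∙ᵂ (s j ∙ᵂ t)        ≈⟨ Wᴳ.assoc _ _ _ ⟨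
        s j ∙ᵂ s j ∙ᵂ t          ≈⟨ Wᴳ.∙-congʳ (s-involutive j) ⟩
        εᵂ ∙ᵂ t                  ≈⟨ Wᴳ.identityˡ t ⟩
        t                        ∎)
    where
    t : |W|
    t = word is
    tα≋α : t • α i ≋ α j
    tα≋α = negated-by-s j (•-Root t (α-Root i)) pos′ (Cone-resp (-ᵛ-cong (•-assoc (s j) t (α i))) neg′)

  -- Dominant vectors and the fundamental chamber

  Dominant : Pred (V n) 0ℓ
  Dominant v = ∀ i → 0# ≤ ⟨ v , α i ⟩

  Dominant-resp : ∀ {u v} → u ≋ v → Dominant u → Dominant v
  Dominant-resp p d i = ≤-resp refl (⟨⟩-cong p ≋-refl) (d i)

  ⟨⟩-nonneg : ∀ {v β} → Dominant v → Positive β → 0# ≤ ⟨ v , β ⟩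
  ⟨⟩-nonneg {v} {β} d p = ≤-resp refl (sym (⟨⟩-expand v β))
    (sum-nonneg _ (λ i → *-nonneg (Positive⇒coordinates p i) (d i)))

  ⟨⟩-nonpos : ∀ {v β} → Dominant v → Negative β → ⟨ v , β ⟩ ≤ 0#
  ⟨⟩-nonpos {v} {β} d p = -‿nonpos (≤-resp refl (⟨⟩-negʳ v β) (⟨⟩-nonneg d p))

  -- The terms of ⟨ v , β ⟩ = Σᵢ ⟨ dual i , β ⟩ ⟨ v , α i ⟩ are nonnegative.
  ⟂-Positive : ∀ {v β} → Dominant v → Positive β → ⟨ v , β ⟩ ≈ 0# →
               ∀ i → ⟨ dual i , β ⟩ * ⟨ v , α i ⟩ ≈ 0#
  ⟂-Positive {v} {β} d p q =
    sum≈0 _ (λ i → *-nonneg (Positive⇒coordinates p i) (d i)) (trans (sym (⟨⟩-expand v β)) q)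

  module _ {q : V n} (q-dom : Dominant q) (u : V n) (q⟂⇒u⟂ : ∀ i → ⟨ q , α i ⟩ ≈ 0# → ⟨ u , α i ⟩ ≈ 0#) where

    private
      positive : ∀ {β} → Positive β → ⟨ q , β ⟩ ≈ 0# → ⟨ u , β ⟩ ≈ 0#
      positive {β} p r = trans (⟨⟩-expand u β) (sum-zero _ term≈0)
        where
        term≈0 : ∀ i → ⟨ dual i , β ⟩ * ⟨ u , α i ⟩ ≈ 0#
        term≈0 i with lem {⟨ dual i , β ⟩ ≈ 0#}
        ... | yes c≈0 = trans (*-congʳ c≈0) (zeroˡ _)
        ... | no c≉0  = trans (*-congˡ (q⟂⇒u⟂ i (x*y≈0⇒y≈0 c≉0 (⟂-Positive q-dom p r i)))) (zeroʳ _)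

    -- A positive root orthogonal to the dominant q involves only simple roots orthogonal to q,
    -- because its coordinates and the pairings of q with simple roots are nonnegative. The zeros of
    -- q on simple roots thus control those on all roots.
    ⟂-transfer : ∀ {β} → Root β → ⟨ q , β ⟩ ≈ 0# → ⟨ u , β ⟩ ≈ 0#
    ⟂-transfer {β} r p with Root-sign r
    ... | inj₁ pos′ = positive pos′ p
    ... | inj₂ neg′ = trans (sym (-‿involutive _)) (trans (-‿cong (trans (sym (⟨⟩-negʳ u β))
            (positive neg′ (trans (⟨⟩-negʳ q β) (trans (-‿cong p) -0#≈0#))))) -0#≈0#)

  FundamentalChamber⇒Dominant : ∀ {v} → FundamentalChamber v → Dominant v
  FundamentalChamber⇒Dominant c i = inj₁ (c i)

  -- A zero pairing would force all coordinates of β to vanish, every pairing of v with a simple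
  -- root being positive; but a root is not zero.
  chamber-pos : ∀ {v β} → FundamentalChamber v → Root β → Positive β → 0# < ⟨ v , β ⟩
  chamber-pos {v} {β} c r p with ⟨⟩-nonneg (FundamentalChamber⇒Dominant c) p
  ... | inj₁ q = q
  ... | inj₂ q = contradiction (coordinates≈0⇒≋0 λ i → x*y≈0⇒y≈0 (pos⇒≉0 (c i))
        (trans (*-comm _ _) (⟂-Positive (FundamentalChamber⇒Dominant c) p (sym q) i))) (Root≉0 r)

  chamber-neg : ∀ {v β} → FundamentalChamber v → Root β → Negative β → ⟨ v , β ⟩ < 0#
  chamber-neg {v} {β} c r p = <-respˡ-≈ (trans (-‿cong (⟨⟩-negʳ v β)) (-‿involutive _))
    (-‿neg (chamber-pos c (-ᵛ-Root r) p))

  -- weight K lies in the relative interior of the face F_K of the fundamental chamber.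

  weight-coefficient : Subset n → Fin n → Carrier
  weight-coefficient K i = if Vec.lookup K i then 0# else 1#

  weight : Subset n → V n
  weight K = linComb (weight-coefficient K) dual

  weight-α : ∀ K i → ⟨ weight K , α i ⟩ ≈ weight-coefficient K i
  weight-α K i = let open ≈-Reasoning in begin
    ⟨ weight K , α i ⟩                                        ≈⟨ ⟨⟩-comm (weight K) (α i) ⟩
    ⟨ α i , weight K ⟩                                        ≈⟨ ⟨⟩-linCombʳ (α i) (weight-coefficient K) dual ⟩
    sum (λ j → weight-coefficient K j * ⟨ α i , dual j ⟩)     ≈⟨ sum-cong-≋ (λ j → trans (*-congˡ (trans (⟨⟩-comm (α i) (dual j)) (dual-pairing j i))) (*-comm _ _)) ⟩
    sum (λ j → δ i j * weight-coefficient K j)                ≈⟨ sum-δ i (weight-coefficient K) ⟩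
    weight-coefficient K i                                    ∎

  weight-∈ : ∀ {K i} → i Subset.∈ K → ⟨ weight K , α i ⟩ ≈ 0#
  weight-∈ {K} {i} i∈K = trans (weight-α K i) (reflexive (≡.cong (if_then 0# else 1#) (Vec.[]=⇒lookup i∈K)))

  weight-cases : ∀ K i → i Subset.∈ K ⊎ 0# < ⟨ weight K , α i ⟩
  weight-cases K i with Vec.lookup K i in eq | weight-α K i
  ... | true  | _ = inj₁ (Vec.lookup⇒[]= i K eq)
  ... | false | p = inj₂ (<-respʳ-≈ (sym p) 0<1)

  weight-∈⁻ : ∀ {K i} → ⟨ weight K , α i ⟩ ≈ 0# → i Subset.∈ K
  weight-∈⁻ {K} {i} p with weight-cases K i
  ... | inj₁ i∈K = i∈K
  ... | inj₂ q   = contradiction q (<-irrefl (sym p))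

  weight-dominant : ∀ K → Dominant (weight K)
  weight-dominant K i with weight-cases K i
  ... | inj₁ i∈K = inj₂ (sym (weight-∈ i∈K))
  ... | inj₂ p   = inj₁ p

  interior : V n
  interior = weight Subset.⊥

  interior-chamber : FundamentalChamber interior
  interior-chamber i with weight-cases Subset.⊥ i
  ... | inj₁ i∈⊥ = contradiction i∈⊥ Subset.∉⊥
  ... | inj₂ p   = p

  -- Reflecting adds - `coroot (α i) v` times ⟨interior, α_i⟩ to the pairing, and that coroot
  -- coefficient is negative. This increase drives both maximisations in `minimal-representative`.
  ⟨⟩-s-increasing : ∀ v {i} → ⟨ v , α i ⟩ < 0# → ⟨ v , interior ⟩ < ⟨ s i • v , interior ⟩
  ⟨⟩-s-increasing v {i} p = <-respʳ-≈ (sym eq) (<-respˡ-≈ (+-identityʳ _) (+-monoʳ-< _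
      (-‿pos (<-respˡ-≈ (*-comm _ _) (*-neg (interior-chamber i) (coroot-neg (α i) v (α≉0 i) p))))))
    where
    eq : ⟨ s i • v , interior ⟩ ≈ ⟨ v , interior ⟩ - coroot (α i) v * ⟨ interior , α i ⟩
    eq = let open ≈-Reasoning in begin
      ⟨ s i • v , interior ⟩                                        ≈⟨ ⟨⟩-cong (s-reflects i v) ≋-refl ⟩
      ⟨ reflect (α i) v , interior ⟩                                ≈⟨ ⟨⟩-comm (reflect (α i) v) interior ⟩
      ⟨ interior , reflect (α i) v ⟩                                ≈⟨ ⟨⟩-reflectʳ (α i) interior v ⟩
      ⟨ interior , v ⟩ - coroot (α i) v * ⟨ interior , α i ⟩        ≈⟨ +-congʳ (⟨⟩-comm interior v) ⟩
      ⟨ v , interior ⟩ - coroot (α i) v * ⟨ interior , α i ⟩        ∎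


-- Stabilisers and parabolic subgroups

module ParabolicSubgroups (lem : ExcludedMiddle 0ℓ) (ℝ : RealNumbers) {n : ℕ}
                          (W : FiniteCoxeterGroup n) (ρ : ReflectionRepresentation ℝ W) where
  open RealNumbers ℝ
  open OrderedField ℝ
  open ListSums ℝ
  open EuclideanSpace ℝ
  open EuclideanProperties ℝ
  open Classical lem
  open Enumeration lem
  open CoxeterGeometry lem ℝ W ρ
  open ReflectionRepresentation ρ
  open CoxeterTheory lem ℝ W ρ using (FundamentalChamber; Parabolic; Fix; MapsOnto)

  listed : ∀ g → ∃ λ h → h ∈ elements × g ≈ᵂ h
  listed g = find (elements-complete g)

  s-fixes : ∀ i v → ⟨ v , α i ⟩ ≈ 0# → s i • v ≋ v
  s-fixes i v p = ≋-trans (s-reflects i v) (reflect-fixes (α i) v p)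

  s-fixes⁻ : ∀ i v → s i • v ≋ v → ⟨ v , α i ⟩ ≈ 0#
  s-fixes⁻ i v p = x≈-x⇒x≈0 (begin
    ⟨ v , α i ⟩                    ≈⟨ •-isometry (s i) v (α i) ⟨
    ⟨ s i • v , s i • α i ⟩        ≈⟨ ⟨⟩-cong p (s-negates i) ⟩
    ⟨ v , -ᵛ α i ⟩                 ≈⟨ ⟨⟩-negʳ v (α i) ⟩
    - ⟨ v , α i ⟩                  ∎)
    where open ≈-Reasoning

  -- Among the elements g maximising ⟨ g v , p ⟩, p = interior in the fundamental chamber,
  -- choose one maximising ⟨ g p , p ⟩: it moves v into the closed fundamental
  -- chamber, and its inverse is the shortest element of its coset.
  minimal-representative : ∀ v → ∃ λ u → ∃ λ q → v ≋ u • q × Dominant q ×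
                           (∀ i → ⟨ q , α i ⟩ ≈ 0# → Positive (u • α i))
  minimal-representative v = g ⁻¹ᵂ , g • v , ≋-sym (•-inverseˡ g v) , dominant , positive
    where
    f h : |W| → Carrier
    f g = ⟨ g • v , interior ⟩
    h g = ⟨ g • interior , interior ⟩

    f-max : ∃ λ m → m ∈ elements × (∀ {b} → b ∈ elements → ¬ f m < f b)
    f-max = maximum f elements (proj₁ (proj₂ (listed εᵂ)))

    m : |W|
    m = proj₁ f-max

    h-max : ∃ λ m′ → m′ ∈ select (λ g → f m ≈ f g) elements ×
            (∀ {b} → b ∈ select (λ g → f m ≈ f g) elements → ¬ h m′ < h b)
    h-max = maximum h _ (∈-select⁺ (proj₁ (proj₂ f-max)) refl)

    g : |W|
    g = proj₁ h-max

    fm≈fg : f m ≈ f g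
    fm≈fg = proj₂ (∈-select⁻ elements (proj₁ (proj₂ h-max)))

    dominant : Dominant (g • v)
    dominant i = ≮⇒≥ λ p → let b , b∈ , sg≈b = listed (s i ∙ᵂ g) in
      proj₂ (proj₂ f-max) b∈ (<-resp (sym fm≈fg)
        (⟨⟩-cong (≋-trans (≋-sym (•-assoc (s i) g v)) (•-congʳ v sg≈b)) ≋-refl)
        (⟨⟩-s-increasing (g • v) p))

    positive : ∀ i → ⟨ g • v , α i ⟩ ≈ 0# → Positive (g ⁻¹ᵂ • α i)
    positive i p with Root-sign (•-Root (g ⁻¹ᵂ) (α-Root i))
    ... | inj₁ q = q
    -- Here `g • v` lies on the wall of `α i`, so `s i ∙ᵂ g` is again a maximiser of `f`, but it
    -- would increase `h`.
    ... | inj₂ q = contradiction (⟨⟩-s-increasing (g • interior) gp<0) not-increasing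
      where
      gp<0 : ⟨ g • interior , α i ⟩ < 0#
      gp<0 = <-respˡ-≈ (sym (•-adjoint g interior (α i)))
               (chamber-neg interior-chamber (•-Root (g ⁻¹ᵂ) (α-Root i)) q)
      not-increasing : ¬ h g < ⟨ s i • g • interior , interior ⟩
      not-increasing r = let b , b∈ , sg≈b = listed (s i ∙ᵂ g)
                             same : ∀ u → s i • g • u ≋ b • u
                             same u = ≋-trans (≋-sym (•-assoc (s i) g u)) (•-congʳ u sg≈b)
                             fg≈fb = ⟨⟩-cong (≋-trans (≋-sym (s-fixes i (g • v) p)) (same v)) ≋-refl
        in proj₂ (proj₂ h-max) (∈-select⁺ b∈ (trans fm≈fg fg≈fb)) (<-respʳ-≈ (⟨⟩-cong (same interior) ≋-refl) r)

  module _ (K : Subset n) (q : V n) (q-dom : Dominant q) (q⟂⇒∈K : ∀ i → ⟨ q , α i ⟩ ≈ 0# → i Subset.∈ K) where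

    private
      -- Induction on a bound for the number of letters. If the word makes `α i` negative, the
      -- pairing of q with `α i` is nonnegative as q is dominant, and nonpositive as the image of q
      -- is; so i lies in K, and `exchange` splits off a last letter `s i`.
      word-stabilizer : ∀ k is → length is ℕ.≤ k → Dominant (word is • q) → Parabolic K (word is)
      word-stabilizer zero    [] len d = unit
      word-stabilizer (suc k) is len d with lem {∃ λ i → Negative (word is • α i)}
      ... | yes (i , neg′) = resp js-back (mul (word-stabilizer k js js≤k js-dom) (gen (i , i∈K , Wᴳ.refl)))
        where
        shorter : ∃ λ js → length is ≡ suc (length js) × word js ≈ᵂ word is ∙ᵂ s i
        shorter = exchange is i neg′
        js : List (Fin n)
        js = proj₁ shorter
        js≤k : length js ℕ.≤ k
        js≤k = ℕ.s≤s⁻¹ (≡.subst (ℕ._≤ suc k) (proj₁ (proj₂ shorter)) len)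
        q⟂α : ⟨ q , α i ⟩ ≈ 0#
        q⟂α = ≤-antisym (≤-resp (•-isometry (word is) q (α i)) refl (⟨⟩-nonpos d neg′)) (q-dom i)
        i∈K : i Subset.∈ K
        i∈K = q⟂⇒∈K i q⟂α
        js-dom : Dominant (word js • q)
        js-dom = Dominant-resp (≋-sym (≋-trans (•-congʳ q (proj₂ (proj₂ shorter)))
                   (≋-trans (•-assoc (word is) (s i) q) (•-congˡ (word is) (s-fixes i q q⟂α))))) d
        js-back : word js ∙ᵂ s i ≈ᵂ word is
        js-back = let open ≈ᵂ-Reasoning in begin
          word js ∙ᵂ s i             ≈⟨ Wᴳ.∙-congʳ (proj₂ (proj₂ shorter)) ⟩
          word is ∙ᵂ s i ∙ᵂ s i      ≈⟨ Wᴳ.assoc _ _ _ ⟩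
          word is ∙ᵂ (s i ∙ᵂ s i)    ≈⟨ Wᴳ.∙-congˡ (s-involutive i) ⟩
          word is ∙ᵂ εᵂ              ≈⟨ Wᴳ.identityʳ _ ⟩
          word is                    ∎
      -- Such a word is empty or not reduced: the part `us` before its last letter i must send `α i`
      -- to a negative root, and exchanging there gives a word for the same element with two letters
      -- fewer.
      ... | no all-positive with List.initLast is
      ... | List.[]       = unit
      ... | us List.∷ʳ′ i = resp js≈is (word-stabilizer k js js≤k (Dominant-resp (•-congʳ q (Wᴳ.sym js≈is)) d))
        where
        is≈us : word (us List.∷ʳ i) ≈ᵂ word us ∙ᵂ s i
        is≈us = Wᴳ.trans (word-++ us (i ∷ [])) (Wᴳ.∙-congˡ (Wᴳ.identityʳ _))
        isα≋-usα : word (us List.∷ʳ i) • α i ≋ -ᵛ (word us • α i)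
        isα≋-usα = ≋-trans (•-congʳ (α i) is≈us) (≋-trans (•-assoc (word us) (s i) (α i))
                     (≋-trans (•-congˡ (word us) (s-negates i)) (•-neg (word us) (α i))))
        us-neg : Negative (word us • α i)
        us-neg with Root-sign (•-Root (word us) (α-Root i))
        ... | inj₂ p = p
        ... | inj₁ p = contradiction (i , Cone-resp (≋-sym (≋-trans (-ᵛ-cong isα≋-usα) (-ᵛ-involutive _))) p) all-positive
        shorter : ∃ λ js → length us ≡ suc (length js) × word js ≈ᵂ word us ∙ᵂ s i
        shorter = exchange us i us-neg
        js : List (Fin n)
        js = proj₁ shorter
        js≈is : word js ≈ᵂ word (us List.∷ʳ i)
        js≈is = Wᴳ.trans (proj₂ (proj₂ shorter)) (Wᴳ.sym is≈us)
        js≤k : length js ℕ.≤ k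
        js≤k = ℕₚ.≤-trans (ℕₚ.n≤1+n _) (≡.subst (ℕ._≤ k) (proj₁ (proj₂ shorter))
                 (ℕ.s≤s⁻¹ (≡.subst (ℕ._≤ suc k) (≡.trans (List.length-++ us) (ℕₚ.+-comm _ 1)) len)))

    -- Assuming `h • q` dominant rather than equal to q yields two facts at once: the stabiliser of
    -- q lies in W_K, and `weight K` is the only dominant vector in its orbit (`dominant-orbit`).
    stabilizer : ∀ h → Dominant (h • q) → Parabolic K h
    stabilizer h d with word-surjective h
    ... | is , p = resp p (word-stabilizer _ is ℕₚ.≤-refl (Dominant-resp (•-congʳ q (Wᴳ.sym p)) d))

  parabolic-fixes : ∀ {K h v} → (∀ i → i Subset.∈ K → ⟨ v , α i ⟩ ≈ 0#) → Parabolic K h → h • v ≋ v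
  parabolic-fixes {v = v} K⟂ (gen (i , i∈K , p)) = ≋-trans (•-congʳ v p) (s-fixes i v (K⟂ i i∈K))
  parabolic-fixes {v = v} K⟂ unit                = •-identity v
  parabolic-fixes {v = v} K⟂ (mul p q)           =
    ≋-trans (•-assoc _ _ v) (≋-trans (•-congˡ _ (parabolic-fixes K⟂ q)) (parabolic-fixes K⟂ p))
  parabolic-fixes {v = v} K⟂ (inv p)             = •-transpose _ (≋-sym (parabolic-fixes K⟂ p))
  parabolic-fixes {v = v} K⟂ (resp p q)          = ≋-trans (•-congʳ v (Wᴳ.sym p)) (parabolic-fixes K⟂ q)

  stabilizer-weight : ∀ {K h} → Dominant (h • weight K) → Parabolic K h
  stabilizer-weight {K} {h} = stabilizer K (weight K) (weight-dominant K) (λ i → weight-∈⁻) h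

  parabolic-fixes-weight : ∀ {K h} → Parabolic K h → h • weight K ≋ weight K
  parabolic-fixes-weight = parabolic-fixes (λ i → weight-∈)

  -- v ⊴ v′ : every root hyperplane through v passes through v′.

  infix 4 _⊴_ _≈₀_

  _⊴_ _≈₀_ : V n → V n → Set
  v ⊴ v′  = ∀ {β} → Root β → ⟨ v , β ⟩ ≈ 0# → ⟨ v′ , β ⟩ ≈ 0#
  v ≈₀ v′ = v ⊴ v′ × v′ ⊴ v

  ≋⇒⊴ : ∀ {u v} → u ≋ v → u ⊴ v
  ≋⇒⊴ p r q = trans (⟨⟩-cong (≋-sym p) ≋-refl) q

  ≋⇒≈₀ : ∀ {u v} → u ≋ v → u ≈₀ v
  ≋⇒≈₀ p = ≋⇒⊴ p , ≋⇒⊴ (≋-sym p)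

  ≈₀-sym : ∀ {u v} → u ≈₀ v → v ≈₀ u
  ≈₀-sym (p , q) = q , p

  ≈₀-trans : ∀ {u v w} → u ≈₀ v → v ≈₀ w → u ≈₀ w
  ≈₀-trans (p , p′) (q , q′) = (λ r → q r ∘ p r) , (λ r → p′ r ∘ q′ r)

  ⊴-• : ∀ g {u v} → u ⊴ v → g • u ⊴ g • v
  ⊴-• g {u} {v} p {β} r q = trans (•-adjoint g v β)
    (p (•-Root (g ⁻¹ᵂ) r) (trans (sym (•-adjoint g u β)) q))

  ≈₀-• : ∀ g {u v} → u ≈₀ v → g • u ≈₀ g • v
  ≈₀-• g (p , q) = ⊴-• g p , ⊴-• g q

  ≈₀-transpose : ∀ g {u v} → g • u ≈₀ v → u ≈₀ g ⁻¹ᵂ • v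
  ≈₀-transpose g {u} p = ≈₀-trans (≋⇒≈₀ (≋-sym (•-inverseˡ g u))) (≈₀-• (g ⁻¹ᵂ) p)

  weight-⊴ : ∀ {K v} → (∀ i → i Subset.∈ K → ⟨ v , α i ⟩ ≈ 0#) → weight K ⊴ v
  weight-⊴ {K} {v} K⟂ r = ⟂-transfer (weight-dominant K) v (λ i p → K⟂ i (weight-∈⁻ p)) r

  ⊴-weight-∈ : ∀ {K v} → weight K ⊴ v → ∀ i → i Subset.∈ K → ⟨ v , α i ⟩ ≈ 0#
  ⊴-weight-∈ p i i∈K = p (α-Root i) (weight-∈ i∈K)

  parabolic-fixes-⊴ : ∀ {K h v} → weight K ⊴ v → Parabolic K h → h • v ≋ v
  parabolic-fixes-⊴ p = parabolic-fixes (⊴-weight-∈ p)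

  -- Normalisers of parabolic subgroups

  module _ {K : Subset n} {g : |W|} where

    -- Normalising W_K amounts to preserving its fixed space, expressed here at the generic point
    -- `weight K`. For i in K both conjugates of `s i`, by g and by its inverse, lie in W_K; so
    -- `s i` fixes the images of `weight K` under g and its inverse, and each of these gives one of
    -- the two inclusions.
    normalizer⇒≈₀ : Normalizes group (Parabolic K) g → g • weight K ≈₀ weight K
    normalizer⇒≈₀ N = gw⊴w , weight-⊴ (λ i i∈K → s-fixes⁻ i _ (s-fixes-gw i i∈K))
      where
      s-fixes-gw : ∀ i → i Subset.∈ K → s i • g • weight K ≋ g • weight K
      s-fixes-gw i i∈K = ≋-trans (≋-sym (•-assoc (s i) g _)) (≋-trans (•-congʳ _ sg≈gh)
                           (≋-trans (•-assoc g h _) (•-congˡ g (parabolic-fixes-weight {K} h∈))))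
        where
        h : |W|
        h = g ⁻¹ᵂ ∙ᵂ (s i ∙ᵂ g)
        gh≈sg : g ∙ᵂ h ≈ᵂ s i ∙ᵂ g
        gh≈sg = Wᴾ.\\-leftDividesˡ g (s i ∙ᵂ g)
        sg≈gh : s i ∙ᵂ g ≈ᵂ g ∙ᵂ h
        sg≈gh = Wᴳ.sym gh≈sg
        h∈ : Parabolic K h
        h∈ = proj₂ (N h) (resp (Wᴳ.sym (Wᴳ.trans (Wᴳ.∙-congʳ gh≈sg) (Wᴾ.//-rightDividesʳ g (s i))))
                               (gen (i , i∈K , Wᴳ.refl)))
      s-fixes-g⁻¹w : ∀ i → i Subset.∈ K → s i • g ⁻¹ᵂ • weight K ≋ g ⁻¹ᵂ • weight K
      s-fixes-g⁻¹w i i∈K = ≋-sym (•-transpose g (≋-trans (≋-sym (parabolic-fixes-weight {K} conj∈))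
                             (≋-trans (•-assoc _ _ _) (•-assoc g (s i) _))))
        where
        conj∈ : Parabolic K (g ∙ᵂ s i ∙ᵂ g ⁻¹ᵂ)
        conj∈ = proj₁ (N (s i)) (gen (i , i∈K , Wᴳ.refl))
      gw⊴w : g • weight K ⊴ weight K
      gw⊴w r = ≋⇒⊴ (•-inverseʳ g _) r ∘
               ⊴-• g (weight-⊴ (λ i i∈K → s-fixes⁻ i _ (s-fixes-g⁻¹w i i∈K))) r

    -- W_K fixes its fixed space pointwise, in particular the images of `weight K` under g and its
    -- inverse. The conjugates therefore fix `weight K`, and `stabilizer-weight` applies.
    ≈₀⇒normalizer : g • weight K ≈₀ weight K → Normalizes group (Parabolic K) g
    ≈₀⇒normalizer p h = forth , back
      where
      forth : Parabolic K h → Parabolic K (g ∙ᵂ h ∙ᵂ g ⁻¹ᵂ)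
      forth h∈ = stabilizer-weight (Dominant-resp (≋-sym fixed) (weight-dominant K))
        where
        fixed : (g ∙ᵂ h ∙ᵂ g ⁻¹ᵂ) • weight K ≋ weight K
        fixed = ≋-trans (•-assoc _ _ _) (≋-trans (•-assoc g h _)
          (≋-trans (•-congˡ g (parabolic-fixes-⊴ (proj₁ (≈₀-transpose g p)) h∈)) (•-inverseʳ g _)))
      back : Parabolic K (g ∙ᵂ h ∙ᵂ g ⁻¹ᵂ) → Parabolic K h
      back c∈ = stabilizer-weight (Dominant-resp (≋-sym fixed) (weight-dominant K))
        where
        conjugate : (g ∙ᵂ h ∙ᵂ g ⁻¹ᵂ) • g • weight K ≋ g • h • weight K
        conjugate = ≋-trans (•-assoc _ _ _) (≋-trans (•-congˡ _ (•-inverseˡ g _)) (•-assoc g h _))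
        fixed : h • weight K ≋ weight K
        fixed = ≋-trans (≋-sym (•-inverseˡ g _)) (•-transpose g
          (≋-trans (≋-sym conjugate) (parabolic-fixes-⊴ (proj₂ p) c∈)))

  dominant-orbit : ∀ {K h} → Dominant (h • weight K) → h • weight K ≋ weight K
  dominant-orbit {K} d = parabolic-fixes-weight {K} (stabilizer-weight {K} d)

  -- Here γ is a combination of the simple roots orthogonal to q.
  keeps-positive : ∀ {q u γ} → Dominant q → (∀ i → ⟨ q , α i ⟩ ≈ 0# → Positive (u • α i)) →
                   Positive γ → ⟨ q , γ ⟩ ≈ 0# → Positive (u • γ)
  keeps-positive {q} {u} {γ} q-dom u-pos γ-pos q⟂γ = coordinates⇒Positive λ l →
    ≤-resp refl (sym (expansion l)) (sum-nonneg _ (term l))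
    where
    open ≈-Reasoning
    expansion : ∀ l → ⟨ dual l , u • γ ⟩ ≈ sum (λ i → ⟨ dual i , γ ⟩ * ⟨ dual l , u • α i ⟩)
    expansion l = begin
      ⟨ dual l , u • γ ⟩                                              ≈⟨ •-adjoint′ u (dual l) γ ⟩
      ⟨ u ⁻¹ᵂ • dual l , γ ⟩                                          ≈⟨ ⟨⟩-expand _ γ ⟩
      sum (λ i → ⟨ dual i , γ ⟩ * ⟨ u ⁻¹ᵂ • dual l , α i ⟩)           ≈⟨ sum-cong-≋ (λ i → *-congˡ (•-adjoint′ u (dual l) (α i))) ⟨
      sum (λ i → ⟨ dual i , γ ⟩ * ⟨ dual l , u • α i ⟩)               ∎
    term : ∀ l i → 0# ≤ ⟨ dual i , γ ⟩ * ⟨ dual l , u • α i ⟩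
    term l i with lem {⟨ dual i , γ ⟩ ≈ 0#}
    ... | yes c≈0 = inj₂ (sym (trans (*-congʳ c≈0) (zeroˡ _)))
    ... | no c≉0  = *-nonneg (Positive⇒coordinates γ-pos i)
                      (Positive⇒coordinates (u-pos i (x*y≈0⇒y≈0 c≉0 (⟂-Positive q-dom γ-pos q⟂γ i))) l)

  -- Elements carrying simple roots to simple roots

  PositiveOn : |W| → Subset n → Set
  PositiveOn u J = ∀ j → j Subset.∈ J → Positive (u • α j)

  module _ {u : |W|} {J K : Subset n} (uJ≈₀K : u • weight J ≈₀ weight K) (u-pos : PositiveOn u J) where

    -- If the inverse of u made `α k` negative, the negative γ of the image would be a positive root
    -- orthogonal to `weight J`, which u keeps positive; but u sends γ to the negative of `α k`.
    inverse-positive : PositiveOn (u ⁻¹ᵂ) K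
    inverse-positive k k∈K with Root-sign (•-Root (u ⁻¹ᵂ) (α-Root k))
    ... | inj₁ p = p
    ... | inj₂ p = contradiction (Cone-resp u-γ (keeps-positive (weight-dominant J) (λ i q → u-pos i (weight-∈⁻ q)) p J⟂γ))
                                 (¬Positive∧Negative (α-Root k) (α-Positive k))
      where
      γ : V n
      γ = -ᵛ (u ⁻¹ᵂ • α k)
      J⟂γ : ⟨ weight J , γ ⟩ ≈ 0#
      J⟂γ = trans (⟨⟩-negʳ (weight J) (u ⁻¹ᵂ • α k)) (trans (-‿cong (trans (sym (•-adjoint u (weight J) (α k)))
              (proj₂ uJ≈₀K (α-Root k) (weight-∈ k∈K)))) -0#≈0#)
      u-γ : u • γ ≋ -ᵛ α k
      u-γ = ≋-trans (•-neg u _) (-ᵛ-cong (•-inverseʳ u (α k)))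

    -- Simple roots are indecomposable. The image of `α j` involves only simple roots of K, which
    -- the inverse of u keeps positive; applying that inverse writes `α j` as a nonnegative
    -- combination of positive roots, and each one that occurs is a multiple of `α j`, hence `α j`
    -- itself.
    simple-to-simple : ∀ j → j Subset.∈ J → ∃ λ k → k Subset.∈ K × u • α j ≋ α k
    simple-to-simple j j∈J = k , k∈K , ≋-trans (•-congˡ u (≋-sym u⁻¹α≋α)) (•-inverseʳ u (α k))
      where
      open ≈-Reasoning
      β : V n
      β = u • α j
      K⟂β : ⟨ weight K , β ⟩ ≈ 0#
      K⟂β = proj₁ uJ≈₀K (•-Root u (α-Root j)) (trans (•-isometry u _ (α j)) (weight-∈ j∈J))
      c : Fin n → Carrier
      c i = ⟨ dual i , β ⟩
      c≉0⇒∈K : ∀ i → ¬ c i ≈ 0# → i Subset.∈ K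
      c≉0⇒∈K i c≉0 = weight-∈⁻ (x*y≈0⇒y≈0 c≉0 (⟂-Positive (weight-dominant K) (u-pos j j∈J) K⟂β i))
      nonzero : ∃ λ k → ¬ c k ≈ 0#
      nonzero with lem {∃ λ k → ¬ c k ≈ 0#}
      ... | yes p = p
      ... | no ¬p = contradiction (coordinates≈0⇒≋0 λ i → decidable-stable lem (λ q → ¬p (i , q)))
                                  (Root≉0 (•-Root u (α-Root j)))
      k : Fin n
      k = proj₁ nonzero
      k∈K : k Subset.∈ K
      k∈K = c≉0⇒∈K k (proj₂ nonzero)
      expansion : ∀ i → sum (λ l → c l * ⟨ dual i , u ⁻¹ᵂ • α l ⟩) ≈ ⟨ dual i , α j ⟩
      expansion i = begin
        sum (λ l → c l * ⟨ dual i , u ⁻¹ᵂ • α l ⟩)    ≈⟨ sum-cong-≋ (λ l → *-congˡ (•-adjoint u (dual i) (α l))) ⟨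
        sum (λ l → c l * ⟨ u • dual i , α l ⟩)        ≈⟨ ⟨⟩-expand _ β ⟨
        ⟨ u • dual i , u • α j ⟩                      ≈⟨ •-isometry u (dual i) (α j) ⟩
        ⟨ dual i , α j ⟩                              ∎
      term : ∀ i l → 0# ≤ c l * ⟨ dual i , u ⁻¹ᵂ • α l ⟩
      term i l with lem {c l ≈ 0#}
      ... | yes c≈0 = inj₂ (sym (trans (*-congʳ c≈0) (zeroˡ _)))
      ... | no c≉0  = *-nonneg (Positive⇒coordinates (u-pos j j∈J) l)
                        (Positive⇒coordinates (inverse-positive l (c≉0⇒∈K l c≉0)) i)
      u⁻¹α≋α : u ⁻¹ᵂ • α k ≋ α j
      u⁻¹α≋α = proportional j _ (•-Root (u ⁻¹ᵂ) (α-Root k)) (inverse-positive k k∈K)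
        (coordinate-proportional j λ i i≢j → x*y≈0⇒y≈0 (proj₂ nonzero)
          (sum≈0 _ (term i) (trans (expansion i) (trans (dual-pairing i j) (δ-≢ (i≢j ∘ ≡.sym)))) k))

  mapsOnto⇒≈₀ : ∀ {w K J} → MapsOnto w K J → w ⁻¹ᵂ • weight J ≈₀ weight K
  mapsOnto⇒≈₀ {w} {K} {J} (forth , back) = ≈₀-sym (≈₀-transpose w
      ((λ r → ≋⇒⊴ (•-inverseʳ w _) r ∘ ⊴-• w (weight-⊴ K⟂) r) , weight-⊴ J⟂))
    where
    J⟂ : ∀ j → j Subset.∈ J → ⟨ w • weight K , α j ⟩ ≈ 0#
    J⟂ j j∈J = let i , i∈K , p = back j j∈J in
      trans (⟨⟩-cong ≋-refl (≋-sym p)) (trans (•-isometry w _ (α i)) (weight-∈ i∈K))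
    K⟂ : ∀ i → i Subset.∈ K → ⟨ w ⁻¹ᵂ • weight J , α i ⟩ ≈ 0#
    K⟂ i i∈K = let j , j∈J , p = forth i i∈K in
      trans (⟨⟩-comm _ (α i)) (trans (sym (•-adjoint w (α i) _)) (trans (⟨⟩-cong p ≋-refl)
        (trans (⟨⟩-comm (α j) _) (weight-∈ j∈J))))

  -- The element `a` may make roots of J negative. The minimal representative u of `a • weight J`
  -- takes `weight J` to the same point, because the dominant q in this orbit is `weight J`, and it
  -- is positive on J; so u maps J onto K.
  ≈₀⇒mapsOnto : ∀ {a K J} → a • weight J ≈₀ weight K → ∃ λ w → MapsOnto w K J
  ≈₀⇒mapsOnto {a} {K} {J} aJ≈₀K with minimal-representative (a • weight J)
  ... | u , q , aJ≋uq , q-dom , u-pos = u ⁻¹ᵂ , forth , back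
    where
    q≋J : q ≋ weight J
    q≋J = ≋-trans q≋ (dominant-orbit {J} (Dominant-resp q≋ q-dom))
      where
      q≋ : q ≋ (u ⁻¹ᵂ ∙ᵂ a) • weight J
      q≋ = ≋-trans (≋-sym (•-transpose u aJ≋uq)) (≋-sym (•-assoc _ a _))
    uJ≈₀K : u • weight J ≈₀ weight K
    uJ≈₀K = ≈₀-trans (≋⇒≈₀ (≋-sym (≋-trans aJ≋uq (•-congˡ u q≋J)))) aJ≈₀K
    u-posJ : PositiveOn u J
    u-posJ j j∈J = u-pos j (trans (⟨⟩-cong q≋J ≋-refl) (weight-∈ j∈J))
    forth : ∀ k → k Subset.∈ K → ∃ λ j → j Subset.∈ J × u ⁻¹ᵂ • α k ≋ α j
    forth = simple-to-simple (≈₀-sym (≈₀-transpose u uJ≈₀K)) (inverse-positive uJ≈₀K u-posJ)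
    back : ∀ j → j Subset.∈ J → ∃ λ k → k Subset.∈ K × u ⁻¹ᵂ • α k ≋ α j
    back j j∈J = let k , k∈K , p = simple-to-simple uJ≈₀K u-posJ j j∈J in k , k∈K , •-transpose u (≋-sym p)


-- Faces and chambers of the Coxeter arrangement

flip : Sign → Sign
flip zer = zer
flip pos = neg
flip neg = pos

lookup-≢ : ∀ {A : Set} {k} {u v : Vec A k} → ExcludedMiddle 0ℓ → u ≢ v →
           ∃ λ i → Vec.lookup u i ≢ Vec.lookup v i
lookup-≢ {u = u} {v} lem u≢v with lem {∃ λ i → Vec.lookup u i ≢ Vec.lookup v i}
... | yes p = p
... | no ¬p = contradiction
  (≡.trans (≡.sym (Vec.tabulate∘lookup u))
    (≡.trans (Vec.tabulate-cong λ i → decidable-stable lem (λ q → ¬p (i , q))) (Vec.tabulate∘lookup v))) u≢v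

module CoxeterArrangement (lem : ExcludedMiddle 0ℓ) (ℝ : RealNumbers) {n : ℕ}
                          (W : FiniteCoxeterGroup n) (ρ : ReflectionRepresentation ℝ W) where
  open RealNumbers ℝ
  open OrderedField ℝ
  open EuclideanSpace ℝ
  open EuclideanProperties ℝ
  open Classical lem
  open Enumeration lem
  open CoxeterGeometry lem ℝ W ρ
  open ParabolicSubgroups lem ℝ W ρ
  open ReflectionRepresentation ρ
  open CoxeterTheory lem ℝ W ρ
  open Arrangement coxeterArrangement using (size; normal)

  normal-Root : ∀ i → Root (normal i)
  normal-Root i = List.lookup positiveRoots i , ≋-refl

  normal-Positive : ∀ i → Positive (normal i)
  normal-Positive i = proj₂ (∈-select⁻ (allFin rootCount) (∈-lookup {xs = positiveRoots} i))

  root-normal : ∀ {β} → Root β → Positive β → ∃ λ i → normal i ≋ β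
  root-normal (j , p) β-pos = Any.index j∈ , ≋-trans (λ k → reflexive (≡.cong (λ l → root l k) (≡.sym (Any.lookup-index j∈)))) p
    where
    j∈ : j ∈ positiveRoots
    j∈ = ∈-select⁺ (∈-allFin j) (Cone-resp (≋-sym p) β-pos)

  sign : Carrier → Sign
  sign x with compare x 0#
  ... | tri< _ _ _ = neg
  ... | tri≈ _ _ _ = zer
  ... | tri> _ _ _ = pos

  sign-zer : ∀ {x} → x ≈ 0# → sign x ≡ zer
  sign-zer {x} p with compare x 0#
  ... | tri< _ ¬p _ = contradiction p ¬p
  ... | tri≈ _ _ _  = ≡.refl
  ... | tri> _ ¬p _ = contradiction p ¬p

  sign-pos : ∀ {x} → 0# < x → sign x ≡ pos
  sign-pos {x} p with compare x 0#
  ... | tri< _ _ ¬p = contradiction p ¬p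
  ... | tri≈ _ _ ¬p = contradiction p ¬p
  ... | tri> _ _ _  = ≡.refl

  sign-neg : ∀ {x} → x < 0# → sign x ≡ neg
  sign-neg {x} p with compare x 0#
  ... | tri< _ _ _  = ≡.refl
  ... | tri≈ ¬p _ _ = contradiction p ¬p
  ... | tri> ¬p _ _ = contradiction p ¬p

  sign-zer⁻ : ∀ {x} → sign x ≡ zer → x ≈ 0#
  sign-zer⁻ {x} eq with compare x 0# | eq
  ... | tri≈ _ p _ | _ = p

  sign-pos⁻ : ∀ {x} → sign x ≡ pos → 0# < x
  sign-pos⁻ {x} eq with compare x 0# | eq
  ... | tri> _ _ p | _ = p

  sign-neg⁻ : ∀ {x} → sign x ≡ neg → x < 0#
  sign-neg⁻ {x} eq with compare x 0# | eq
  ... | tri< p _ _ | _ = p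

  sign-cong : ∀ {x y} → x ≈ y → sign x ≡ sign y
  sign-cong {x} {y} p with compare x 0#
  ... | tri< q _ _ = ≡.sym (sign-neg (<-respˡ-≈ p q))
  ... | tri≈ _ q _ = ≡.sym (sign-zer (trans (sym p) q))
  ... | tri> _ _ q = ≡.sym (sign-pos (<-respʳ-≈ p q))

  sign-‿ : ∀ x → sign (- x) ≡ flip (sign x)
  sign-‿ x with compare x 0#
  ... | tri< q _ _ = sign-pos (-‿pos q)
  ... | tri≈ _ q _ = sign-zer (trans (-‿cong q) -0#≈0#)
  ... | tri> _ _ q = sign-neg (-‿neg q)

  sign-nonneg : ∀ {x y} → 0# ≤ x → 0# ≤ y → (x ≈ 0# → y ≈ 0#) → (y ≈ 0# → x ≈ 0#) → sign x ≡ sign y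
  sign-nonneg (inj₂ p) _        f g = ≡.trans (sign-zer (sym p)) (≡.sym (sign-zer (f (sym p))))
  sign-nonneg (inj₁ p) (inj₁ q) f g = ≡.trans (sign-pos p) (≡.sym (sign-pos q))
  sign-nonneg (inj₁ p) (inj₂ q) f g = ≡.trans (sign-zer (g (sym q))) (≡.sym (sign-zer (sym q)))

  0≤⇒sign≢neg : ∀ {x} → 0# ≤ x → sign x ≢ neg
  0≤⇒sign≢neg p eq = <⇒≱ (sign-neg⁻ eq) p

  sign≢neg⇒0≤ : ∀ {x} → sign x ≢ neg → 0# ≤ x
  sign≢neg⇒0≤ p = ≮⇒≥ (p ∘ sign-neg)

  HalfSpace⇒sign : ∀ σ {i v} → HalfSpace σ i v → sign ⟨ normal i , v ⟩ ≡ σ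
  HalfSpace⇒sign zer = sign-zer
  HalfSpace⇒sign pos = sign-pos
  HalfSpace⇒sign neg = sign-neg

  sign⇒HalfSpace : ∀ σ {i v} → sign ⟨ normal i , v ⟩ ≡ σ → HalfSpace σ i v
  sign⇒HalfSpace zer = sign-zer⁻
  sign⇒HalfSpace pos = sign-pos⁻
  sign⇒HalfSpace neg = sign-neg⁻

  position : V n → SignVector size
  position v = Vec.tabulate (λ i → sign ⟨ normal i , v ⟩)

  lookup-position : ∀ v i → Vec.lookup (position v) i ≡ sign ⟨ normal i , v ⟩
  lookup-position v i = Vec.lookup∘tabulate _ i

  Cell-position : ∀ v → Cell (position v) v
  Cell-position v i = sign⇒HalfSpace _ (≡.sym (lookup-position v i))

  Cell⇒≡ : ∀ {σ v} → Cell σ v → σ ≡ position v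
  Cell⇒≡ {σ} {v} c = ≡.trans (≡.sym (Vec.tabulate∘lookup σ))
    (Vec.tabulate-cong λ i → ≡.sym (HalfSpace⇒sign (Vec.lookup σ i) (c i)))

  position-face : ∀ v → position v ∈ faces
  position-face v = ∈-select⁺ (∈-allVecs (λ { zer → here ≡.refl ; pos → there (here ≡.refl) ; neg → there (there (here ≡.refl)) }) _)
                              (v , Cell-position v)

  face-position : ∀ {σ} → σ ∈ faces → ∃ λ v → σ ≡ position v
  face-position σ∈ = let v , c = proj₂ (∈-select⁻ {P = IsFace} (allVecs (zer ∷ pos ∷ neg ∷ []) size) σ∈) in v , Cell⇒≡ c

  faces-unique : Unique faces
  faces-unique = select-unique (allVecs-unique (((λ ()) ∷ (λ ()) ∷ []) ∷ ((λ ()) ∷ []) ∷ [] ∷ []) size)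

  infix 4 _≈±_

  _≈±_ : V n → V n → Set
  v ≈± v′ = ∀ {β} → Root β → sign ⟨ v , β ⟩ ≡ sign ⟨ v′ , β ⟩

  ≈±-sym : ∀ {u v} → u ≈± v → v ≈± u
  ≈±-sym p r = ≡.sym (p r)

  ≈±-trans : ∀ {u v w} → u ≈± v → v ≈± w → u ≈± w
  ≈±-trans p q r = ≡.trans (p r) (q r)

  ≋⇒≈± : ∀ {u v} → u ≋ v → u ≈± v
  ≋⇒≈± p r = sign-cong (⟨⟩-cong p ≋-refl)

  ≈±-• : ∀ g {u v} → u ≈± v → g • u ≈± g • v
  ≈±-• g {u} {v} p {β} r = ≡.trans (sign-cong (•-adjoint g u β))
    (≡.trans (p (•-Root (g ⁻¹ᵂ) r)) (≡.sym (sign-cong (•-adjoint g v β))))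

  ≈±⇒≈₀ : ∀ {u v} → u ≈± v → u ≈₀ v
  ≈±⇒≈₀ p = (λ r q → sign-zer⁻ (≡.trans (≡.sym (p r)) (sign-zer q))) ,
            (λ r q → sign-zer⁻ (≡.trans (p r) (sign-zer q)))

  ≈±-dominant : ∀ {u v} → u ≈± v → Dominant u → Dominant v
  ≈±-dominant p d i = sign≢neg⇒0≤ λ eq → 0≤⇒sign≢neg (d i) (≡.trans (p (α-Root i)) eq)

  ≈±⇒position : ∀ {u v} → u ≈± v → position u ≡ position v
  ≈±⇒position {u} {v} p = Vec.tabulate-cong λ i →
    ≡.trans (sign-cong (⟨⟩-comm (normal i) u)) (≡.trans (p (normal-Root i)) (sign-cong (⟨⟩-comm v (normal i))))

  position⇒≈± : ∀ {u v} → position u ≡ position v → u ≈± v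
  position⇒≈± {u} {v} eq {β} r = case Root-sign r of λ where
      (inj₁ p) → positive r p
      (inj₂ p) → ≡.trans (negated u) (≡.trans (≡.cong flip (positive (-ᵛ-Root r) p)) (≡.sym (negated v)))
    where
    negated : ∀ w → sign ⟨ w , β ⟩ ≡ flip (sign ⟨ w , -ᵛ β ⟩)
    negated w = ≡.trans (sign-cong (trans (sym (-‿involutive _)) (-‿cong (sym (⟨⟩-negʳ w β))))) (sign-‿ _)
    positive : ∀ {β} → Root β → Positive β → sign ⟨ u , β ⟩ ≡ sign ⟨ v , β ⟩
    positive {β} r p = let i , q = root-normal r p in
      ≡.trans (sign-cong (trans (⟨⟩-comm u β) (⟨⟩-cong (≋-sym q) ≋-refl)))
        (≡.trans (≡.trans (≡.sym (lookup-position u i)) (≡.trans (≡.cong (λ σ → Vec.lookup σ i) eq) (lookup-position v i)))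
          (sign-cong (trans (⟨⟩-cong q ≋-refl) (⟨⟩-comm β v))))

  -- Dominant vectors pair nonnegatively with positive roots, so their signs there can differ only
  -- by vanishing, which `⟂-transfer` decides on the simple roots.
  dominant-≈± : ∀ {u v} → Dominant u → Dominant v →
                (∀ i → ⟨ u , α i ⟩ ≈ 0# → ⟨ v , α i ⟩ ≈ 0#) → (∀ i → ⟨ v , α i ⟩ ≈ 0# → ⟨ u , α i ⟩ ≈ 0#) → u ≈± v
  dominant-≈± {u} {v} u-dom v-dom f g = position⇒≈± (Vec.tabulate-cong λ i →
    ≡.trans (sign-cong (⟨⟩-comm (normal i) u)) (≡.trans
      (sign-nonneg (⟨⟩-nonneg u-dom (normal-Positive i)) (⟨⟩-nonneg v-dom (normal-Positive i))
        (⟂-transfer u-dom v f (normal-Root i)) (⟂-transfer v-dom u g (normal-Root i)))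
      (sign-cong (⟨⟩-comm v (normal i)))))

  weight-position-injective : ∀ {J K} → weight J ≈± weight K → J ≡ K
  weight-position-injective p = Subset.⊆-antisym
    (λ {i} i∈J → weight-∈⁻ (proj₁ (≈±⇒≈₀ p) (α-Root i) (weight-∈ i∈J)))
    (λ {i} i∈K → weight-∈⁻ (proj₂ (≈±⇒≈₀ p) (α-Root i) (weight-∈ i∈K)))

  -- Every point lies in the face u F_K for some K and u, u being positive on K.
  face-representative : ∀ v → ∃ λ u → ∃ λ K → v ≈± u • weight K × PositiveOn u K
  face-representative v with minimal-representative v
  ... | u , q , v≋uq , q-dom , u-pos = u , K , ≈±-trans (≋⇒≈± v≋uq) (≈±-• u q≈K) , λ i i∈K → u-pos i (∈-subset⁻ i∈K)
    where
    K : Subset n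
    K = subset (λ i → ⟨ q , α i ⟩ ≈ 0#)
    q≈K : q ≈± weight K
    q≈K = dominant-≈± q-dom (weight-dominant K) (λ i p → weight-∈ (∈-subset⁺ p))
                      (λ i p → ∈-subset⁻ (weight-∈⁻ p))

  -- The code of the smallest flat through v, read off from v alone; it is the support of the face
  -- through v (`z-position`).
  zeros : V n → Subset size
  zeros v = subset (λ i → ⟨ normal i , v ⟩ ≈ 0#)

  z-position : ∀ v → z (position v) ≡ zeros v
  z-position v = subset-cong (λ i p → p v (Cell-position v))
    (λ i p u c → sign-zer⁻ (≡.trans (≡.sym (lookup-position u i))
      (≡.trans (≡.cong (λ σ → Vec.lookup σ i) (≡.sym (Cell⇒≡ {position v} c))) (≡.trans (lookup-position v i) (sign-zer p)))))

  zeros-cong : ∀ {u v} → u ≈₀ v → zeros u ≡ zeros v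
  zeros-cong (p , q) = subset-cong
    (λ i r → trans (⟨⟩-comm (normal i) _) (p (normal-Root i) (trans (⟨⟩-comm _ (normal i)) r)))
    (λ i r → trans (⟨⟩-comm (normal i) _) (q (normal-Root i) (trans (⟨⟩-comm _ (normal i)) r)))

  zeros⇒⊴ : ∀ {u v} → zeros u ≡ zeros v → u ⊴ v
  zeros⇒⊴ {u} {v} eq {β} r ⟂β = case Root-sign r of λ where
      (inj₁ p) → positive r p ⟂β
      (inj₂ p) → trans (sym (-‿involutive _)) (trans (-‿cong (trans (sym (⟨⟩-negʳ v β))
        (positive (-ᵛ-Root r) p (trans (⟨⟩-negʳ u β) (trans (-‿cong ⟂β) -0#≈0#))))) -0#≈0#)
    where
    positive : ∀ {β} → Root β → Positive β → ⟨ u , β ⟩ ≈ 0# → ⟨ v , β ⟩ ≈ 0#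
    positive {β} r p q = let i , eqβ = root-normal r p in
      trans (⟨⟩-comm v β) (trans (⟨⟩-cong (≋-sym eqβ) ≋-refl)
        (∈-subset⁻ {P = λ i → ⟨ normal i , v ⟩ ≈ 0#} (≡.subst (i Subset.∈_) eq
          (∈-subset⁺ (trans (⟨⟩-cong eqβ ≋-refl) (trans (⟨⟩-comm β u) q))))))

  zeros⇒≈₀ : ∀ {u v} → zeros u ≡ zeros v → u ≈₀ v
  zeros⇒≈₀ eq = zeros⇒⊴ eq , zeros⇒⊴ (≡.sym eq)


-- The faces which move the identity chamber to a given chamber

module FaceMoves (lem : ExcludedMiddle 0ℓ) (ℝ : RealNumbers) {n : ℕ}
                 (W : FiniteCoxeterGroup n) (ρ : ReflectionRepresentation ℝ W) where
  open RealNumbers ℝ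
  open OrderedField ℝ
  open EuclideanSpace ℝ
  open EuclideanProperties ℝ
  open Classical lem
  open Enumeration lem
  open CoxeterGeometry lem ℝ W ρ
  open ParabolicSubgroups lem ℝ W ρ
  open CoxeterArrangement lem ℝ W ρ
  open ReflectionRepresentation ρ
  open CoxeterTheory lem ℝ W ρ
  open Arrangement coxeterArrangement using (size; normal)

  ⟨normal,•⟩ : ∀ w i v → ⟨ normal i , w • v ⟩ ≈ ⟨ v , w ⁻¹ᵂ • normal i ⟩
  ⟨normal,•⟩ w i v = trans (•-adjoint′ w (normal i) v) (⟨⟩-comm _ v)

  -- Moved back by w, `normal i` is a positive or a negative root, so it has one sign on all of wC,
  -- and the single point `w • interior` detects that sign.
  chamber-position : ∀ w → chamber w ≡ position (w • interior)
  chamber-position w = Vec.tabulate-cong entry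
    where
    wC : Pred (V n) 0ℓ
    wC u = ∃ λ v → FundamentalChamber v × u ≋ w • v
    pairing : ∀ i {u v} → u ≋ w • v → ⟨ normal i , u ⟩ ≈ ⟨ v , w ⁻¹ᵂ • normal i ⟩
    pairing i {v = v} p = trans (⟨⟩-cong ≋-refl p) (⟨normal,•⟩ w i v)
    entry : ∀ i → (if decide (wC ⊆′ HalfSpace pos i) then pos else
                   if decide (wC ⊆′ HalfSpace neg i) then neg else zer) ≡ sign ⟨ normal i , w • interior ⟩
    entry i with Root-sign (•-Root (w ⁻¹ᵂ) (normal-Root i))
    ... | inj₁ p = ≡.trans (≡.cong (if_then pos else (if decide (wC ⊆′ HalfSpace neg i) then neg else zer)) (decide-true wC-pos))
                           (≡.sym (sign-pos (wC-pos _ (interior , interior-chamber , ≋-refl))))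
      where
      wC-pos : wC ⊆′ HalfSpace pos i
      wC-pos u (v , v∈C , q) = <-respʳ-≈ (sym (pairing i q)) (chamber-pos v∈C (•-Root (w ⁻¹ᵂ) (normal-Root i)) p)
    ... | inj₂ p = ≡.trans (≡.cong₂ (λ b c → if b then pos else if c then neg else zer) (decide-false not-pos) (decide-true wC-neg))
                           (≡.sym (sign-neg inner-neg))
      where
      wC-neg : wC ⊆′ HalfSpace neg i
      wC-neg u (v , v∈C , q) = <-respˡ-≈ (sym (pairing i q)) (chamber-neg v∈C (•-Root (w ⁻¹ᵂ) (normal-Root i)) p)
      inner-neg : ⟨ normal i , w • interior ⟩ < 0#
      inner-neg = wC-neg _ (interior , interior-chamber , ≋-refl)
      not-pos : ¬ wC ⊆′ HalfSpace pos i
      not-pos q = <-asym inner-neg (q _ (interior , interior-chamber , ≋-refl))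

  -- The quotient h preserves the signs of `interior` and so lies in the parabolic subgroup of the
  -- empty set; that subgroup fixes every vector, and the action is faithful.
  chamber-injective : ∀ {u w} → chamber u ≡ chamber w → u ≈ᵂ w
  chamber-injective {u} {w} eq = Wᴳ.trans (Wᴳ.sym (Wᴳ.identityʳ u)) (Wᴳ.trans (Wᴳ.∙-congˡ (Wᴳ.sym h≈ε)) (Wᴾ.\\-leftDividesˡ u w))
    where
    h : |W|
    h = u ⁻¹ᵂ ∙ᵂ w
    p≈hp : interior ≈± h • interior
    p≈hp = ≈±-trans (≋⇒≈± (≋-sym (•-inverseˡ u interior)))
      (≈±-trans (≈±-• (u ⁻¹ᵂ) (position⇒≈± (≡.trans (≡.sym (chamber-position u)) (≡.trans eq (chamber-position w)))))
                (≋⇒≈± (≋-sym (•-assoc _ w interior))))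
    h≈ε : h ≈ᵂ εᵂ
    h≈ε = •-faithful h εᵂ λ v → ≋-trans
      (parabolic-fixes {Subset.⊥} (λ i i∈⊥ → contradiction i∈⊥ Subset.∉⊥)
        (stabilizer-weight {Subset.⊥} (≈±-dominant p≈hp (FundamentalChamber⇒Dominant interior-chamber))))
      (≋-sym (•-identity v))

  lookup-chamber : ∀ w i → Vec.lookup (chamber w) i ≡ sign ⟨ interior , w ⁻¹ᵂ • normal i ⟩
  lookup-chamber w i = ≡.trans (≡.cong (λ σ → Vec.lookup σ i) (chamber-position w))
    (≡.trans (lookup-position _ i) (sign-cong (⟨normal,•⟩ w i interior)))

  lookup-chamber-ε : ∀ i → Vec.lookup (chamber εᵂ) i ≡ pos
  lookup-chamber-ε i = ≡.trans (lookup-chamber εᵂ i) (sign-pos (<-respʳ-≈ (⟨⟩-cong ≋-refl (≋-sym ε⁻¹-fixes))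
      (chamber-pos interior-chamber (normal-Root i) (normal-Positive i))))
    where
    ε⁻¹-fixes : εᵂ ⁻¹ᵂ • normal i ≋ normal i
    ε⁻¹-fixes = ≋-trans (•-congʳ _ Wᴾ.ε⁻¹≈ε) (•-identity _)

  interior-sign≢zer : ∀ {β} → Root β → sign ⟨ interior , β ⟩ ≢ zer
  interior-sign≢zer r eq with Root-sign r
  ... | inj₁ p = <-irrefl (sym (sign-zer⁻ eq)) (chamber-pos interior-chamber r p)
  ... | inj₂ p = <-irrefl (sign-zer⁻ eq) (chamber-neg interior-chamber r p)

  chamber-isChamber : ∀ w → IsChamber (chamber w)
  chamber-isChamber w = (w • interior , ≡.subst (λ σ → Cell σ (w • interior)) (≡.sym (chamber-position w)) (Cell-position _)) ,
    λ i eq → interior-sign≢zer (•-Root (w ⁻¹ᵂ) (normal-Root i)) (≡.trans (≡.sym (lookup-chamber w i)) eq)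

  interior-sign : ∀ {q β} → Dominant q → Root β → sign ⟨ q , β ⟩ ≢ zer → sign ⟨ interior , β ⟩ ≡ sign ⟨ q , β ⟩
  interior-sign {q} {β} q-dom r q≢0 with Root-sign r
  ... | inj₁ p with ⟨⟩-nonneg q-dom p
  ...   | inj₁ s = ≡.trans (sign-pos (chamber-pos interior-chamber r p)) (≡.sym (sign-pos s))
  ...   | inj₂ s = contradiction (sign-zer (sym s)) q≢0
  interior-sign {q} {β} q-dom r q≢0 | inj₂ p with ⟨⟩-nonpos q-dom p
  ...   | inj₁ s = ≡.trans (sign-neg (chamber-neg interior-chamber r p)) (≡.sym (sign-neg s))
  ...   | inj₂ s = contradiction (sign-zer s) q≢0

  -- For a chamber D, this says that F lies in the closure of D.
  _Extends_ : SignVector size → SignVector size → Set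
  D Extends F = ∀ i → Vec.lookup F i ≢ zer → Vec.lookup D i ≡ Vec.lookup F i

  -- Only weak inequalities pass to the closure, but they suffice to exclude that D has the sign
  -- opposite to a nonzero sign of F.
  closure⇒extends : ∀ {F D} → IsFace F → IsChamberAt F D → D Extends F
  closure⇒extends {F} {D} (v , v∈F) ((_ , D≢zer) , F⊆) i F≢zer = compare-signs (Vec.lookup D i) ≡.refl (Vec.lookup F i) ≡.refl
    where
    cell : ∀ {σ u} → Vec.lookup D i ≡ σ → Cell D u → HalfSpace σ i u
    cell {u = u} eq u∈D = ≡.subst (λ σ → HalfSpace σ i u) eq (u∈D i)
    v∈ : ∀ {σ} → Vec.lookup F i ≡ σ → HalfSpace σ i v
    v∈ eq = ≡.subst (λ σ → HalfSpace σ i v) eq (v∈F i)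
    compare-signs : ∀ σ → Vec.lookup D i ≡ σ → ∀ τ → Vec.lookup F i ≡ τ → Vec.lookup D i ≡ Vec.lookup F i
    compare-signs zer eqD _   _   = contradiction eqD (D≢zer i)
    compare-signs pos _   zer eqF = contradiction eqF F≢zer
    compare-signs neg _   zer eqF = contradiction eqF F≢zer
    compare-signs pos eqD pos eqF = ≡.trans eqD (≡.sym eqF)
    compare-signs neg eqD neg eqF = ≡.trans eqD (≡.sym eqF)
    compare-signs pos eqD neg eqF = contradiction
      (closure-nonneg (Cell D) (normal i) v (λ u → cell eqD) (F⊆ v v∈F)) (<⇒≱ (v∈ eqF))
    compare-signs neg eqD pos eqF = contradiction
      (closure-nonpos (Cell D) (normal i) v (λ u → cell eqD) (F⊆ v v∈F)) (<⇒≱ (v∈ eqF))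

  -- Add to v a small positive multiple of a point d of D. Where F vanishes, d alone decides the
  -- sign; elsewhere v and d have the same sign, and so has the sum. The smallness serves only to
  -- stay in the cube, the hyperplanes being linear.
  extends⇒closure : ∀ {F D} → IsFace D → D Extends F → Cell F ⊆′ Closure (Cell D)
  extends⇒closure {F} {D} (d , d∈D) D-ext v v∈F ε ε>0 with small-multiple d ε>0
  ... | t , t>0 , small = v +ᵛ t *ᵛ d , in-cell , near
    where
    near : ∀ k → v k + t * d k - v k < ε × v k - (v k + t * d k) < ε
    near k = <-respˡ-≈ (sym (xyx⁻¹≈y _ _)) (proj₁ (small k)) ,
             <-respˡ-≈ (trans (-‿cong (sym (xyx⁻¹≈y _ _))) (⁻¹-anti-homo‿- _ _)) (proj₂ (small k))
    module _ (i : Fin size) where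
      a b : Carrier
      a = ⟨ normal i , v ⟩
      b = ⟨ normal i , d ⟩
      pairing : ⟨ normal i , v +ᵛ t *ᵛ d ⟩ ≈ a + t * b
      pairing = trans (⟨⟩-+ʳ (normal i) v (t *ᵛ d)) (+-congˡ (⟨⟩-*ʳ (normal i) t d))
      tb : ∀ σ → HalfSpace σ i d → sign (t * b) ≡ σ
      tb zer p = sign-zer (trans (*-congˡ p) (zeroʳ t))
      tb pos p = sign-pos (*-pos t>0 p)
      tb neg p = sign-neg (*-neg t>0 p)
      sum-sign : ∀ σ τ → HalfSpace σ i d → HalfSpace τ i v → τ ≡ zer ⊎ σ ≡ τ → sign (a + t * b) ≡ σ
      sum-sign σ   zer p q _ = ≡.trans (sign-cong (trans (+-congʳ q) (+-identityˡ _))) (tb σ p)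
      sum-sign pos pos p q _ = sign-pos (0<+ q (inj₁ (*-pos t>0 p)))
      sum-sign neg neg p q _ = sign-neg (<-trans (<-respʳ-≈ (+-identityʳ a) (+-monoʳ-< a (*-neg t>0 p))) q)
      sum-sign zer pos p q (inj₂ ())
      sum-sign zer neg p q (inj₂ ())
      sum-sign pos neg p q (inj₂ ())
      sum-sign neg pos p q (inj₂ ())
      dichotomy : ∀ τ → Vec.lookup F i ≡ τ → Vec.lookup F i ≡ zer ⊎ Vec.lookup D i ≡ Vec.lookup F i
      dichotomy zer eq = inj₁ eq
      dichotomy pos eq = inj₂ (D-ext i (λ eq′ → case ≡.trans (≡.sym eq) eq′ of λ ()))
      dichotomy neg eq = inj₂ (D-ext i (λ eq′ → case ≡.trans (≡.sym eq) eq′ of λ ()))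
    in-cell : Cell D (v +ᵛ t *ᵛ d)
    in-cell i = sign⇒HalfSpace (Vec.lookup D i) (≡.trans (sign-cong (pairing i))
      (sum-sign i (Vec.lookup D i) (Vec.lookup F i) (d∈D i) (v∈F i) (dichotomy i _ ≡.refl)))

  position-isFace : ∀ v → IsFace (position v)
  position-isFace v = v , Cell-position v

  -- All signs of the identity chamber are positive, so among the chambers at F
  -- the nearest one is positive wherever F is zero.
  nearest⇒moves : ∀ {F D} → IsFace F → IsChamber D → D Extends F →
                  (∀ i → Vec.lookup F i ≡ zer → Vec.lookup D i ≡ pos) → Moves F (chamber εᵂ) D
  nearest⇒moves {F} {D} F-face D-chamber D-ext D-pos =
    (D-chamber , extends⇒closure {F} {D} (proj₁ D-chamber) D-ext) , nearest
    where
    C : SignVector size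
    C = chamber εᵂ
    nearest : ∀ E → IsChamberAt F E → E ≢ D → separation C D ℕ.< separation C E
    -- D and E agree wherever F is nonzero, so they differ at a zero i of F, where D has the sign of
    -- C and E has not. A hyperplane separating C from D is not a zero of F, so it also separates C
    -- from E.
    nearest E E-at E≢D with lookup-≢ lem E≢D
    ... | i , Eᵢ≢Dᵢ = count-mono-< separated (∈-allFin i)
          (λ eq → Eᵢ≢Dᵢ (≡.trans (≡.sym eq) (≡.trans (lookup-chamber-ε i) (≡.sym Dᵢ≡pos))))
          (λ C≢D → C≢D (≡.trans (lookup-chamber-ε i) (≡.sym Dᵢ≡pos)))
      where
      E-ext : E Extends F
      E-ext = closure⇒extends {F} {E} F-face E-at
      Fᵢ≡zer : Vec.lookup F i ≡ zer
      Fᵢ≡zer = decidable-stable lem λ F≢zer → Eᵢ≢Dᵢ (≡.trans (E-ext i F≢zer) (≡.sym (D-ext i F≢zer)))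
      Dᵢ≡pos : Vec.lookup D i ≡ pos
      Dᵢ≡pos = D-pos i Fᵢ≡zer
      separated : ∀ j → Vec.lookup C j ≢ Vec.lookup D j → Vec.lookup C j ≢ Vec.lookup E j
      separated j C≢D C≡E = C≢D (≡.trans C≡E (≡.trans (E-ext j F≢zer) (≡.sym (D-ext j F≢zer))))
        where
        F≢zer : Vec.lookup F j ≢ zer
        F≢zer F≡zer = C≢D (≡.trans (lookup-chamber-ε j) (≡.sym (D-pos j F≡zer)))

  moves-unique : ∀ F C {D E} → Moves F C D → Moves F C E → D ≡ E
  moves-unique F C (D-at , D-near) (E-at , E-near) = decidable-stable lem λ D≢E →
    ℕₚ.<-asym (D-near _ E-at (D≢E ∘ ≡.sym)) (E-near _ D-at D≢E)

  -- At a zero of w F_K, moving `normal i` back by w gives a root orthogonal to `weight K`. Were it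
  -- negative, its negative would be a nonnegative combination of K, which w keeps positive; but the
  -- result is the negative of `normal i`. So the chamber of w is positive there.
  face-moves : ∀ {w K} → PositiveOn w K → Moves (position (w • weight K)) (chamber εᵂ) (chamber w)
  face-moves {w} {K} w-pos = nearest⇒moves {position (w • weight K)} {chamber w} (position-isFace _) (chamber-isChamber w) extends positive
    where
    lookup-F : ∀ i → Vec.lookup (position (w • weight K)) i ≡ sign ⟨ weight K , w ⁻¹ᵂ • normal i ⟩
    lookup-F i = ≡.trans (lookup-position _ i) (sign-cong (⟨normal,•⟩ w i (weight K)))
    extends : chamber w Extends position (w • weight K)
    extends i F≢zer = ≡.trans (lookup-chamber w i) (≡.trans
      (interior-sign (weight-dominant K) (•-Root (w ⁻¹ᵂ) (normal-Root i)) (F≢zer ∘ ≡.trans (lookup-F i)))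
      (≡.sym (lookup-F i)))
    positive : ∀ i → Vec.lookup (position (w • weight K)) i ≡ zer → Vec.lookup (chamber w) i ≡ pos
    positive i F≡zer with Root-sign (•-Root (w ⁻¹ᵂ) (normal-Root i))
    ... | inj₁ p = ≡.trans (lookup-chamber w i) (sign-pos (chamber-pos interior-chamber (•-Root (w ⁻¹ᵂ) (normal-Root i)) p))
    ... | inj₂ p = contradiction (Cone-resp (≋-trans (•-neg w _) (-ᵛ-cong (•-inverseʳ w (normal i))))
                     (keeps-positive (weight-dominant K) (λ j q → w-pos j (weight-∈⁻ q)) p
                       (trans (⟨⟩-negʳ (weight K) (w ⁻¹ᵂ • normal i)) (trans (-‿cong K⟂) -0#≈0#))))
                     (¬Positive∧Negative (normal-Root i) (normal-Positive i))
      where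
      K⟂ : ⟨ weight K , w ⁻¹ᵂ • normal i ⟩ ≈ 0#
      K⟂ = sign-zer⁻ (≡.trans (≡.sym (lookup-F i)) F≡zer)

  PositiveOn⇒⊆∁Des : ∀ {w K} → PositiveOn w K → K Subset.⊆ ∁ (Des w)
  PositiveOn⇒⊆∁Des w-pos {i} i∈K = Subset.x∉p⇒x∈∁p λ i∈Des →
    ¬Positive∧Negative (•-Root _ (α-Root i)) (w-pos i i∈K) (∈-subset⁻ i∈Des)

  ⊆∁Des⇒PositiveOn : ∀ {w K} → K Subset.⊆ ∁ (Des w) → PositiveOn w K
  ⊆∁Des⇒PositiveOn {w} K⊆ i i∈K with Root-sign (•-Root w (α-Root i))
  ... | inj₁ p = p
  ... | inj₂ p = contradiction (∈-subset⁺ p) (Subset.x∈∁p⇒x∉p (K⊆ i∈K))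

  -- The face has a representative u F_K of its own and so moves the identity chamber to the chamber
  -- of u; the target is unique and determines the element, so u is w.
  moving-face : ∀ v w → Moves (position v) (chamber εᵂ) (chamber w) →
                ∃ λ K → PositiveOn w K × v ≈± w • weight K
  moving-face v w v-moves = K , (λ i i∈K → Cone-resp (•-congʳ (α i) u≈w) (u-pos i i∈K)) ,
                            ≈±-trans v≈uK (≋⇒≈± (•-congʳ (weight K) u≈w))
    where
    u : |W|
    u = proj₁ (face-representative v)
    K : Subset n
    K = proj₁ (proj₂ (face-representative v))
    v≈uK : v ≈± u • weight K
    v≈uK = proj₁ (proj₂ (proj₂ (face-representative v)))
    u-pos : PositiveOn u K
    u-pos = proj₂ (proj₂ (proj₂ (face-representative v)))
    u-moves : Moves (position v) (chamber εᵂ) (chamber u)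
    u-moves = ≡.subst (λ F → Moves F (chamber εᵂ) (chamber u)) (≡.sym (≈±⇒position v≈uK)) (face-moves u-pos)
    u≈w : u ≈ᵂ w
    u≈w = chamber-injective (moves-unique (position v) (chamber εᵂ) u-moves v-moves)

  descentFree : |W| → List (Subset n)
  descentFree w = select (λ K → K Subset.⊆ ∁ (Des w)) (allSubsets n)

  movingFaces : |W| → List (SignVector size)
  movingFaces w = select (λ F → Moves F (chamber εᵂ) (chamber w)) faces

  descentFree⤖movingFaces : ∀ w → descentFree w ⤖ᴸ movingFaces w
  descentFree⤖movingFaces w = record
    { to         = λ K → position (w • weight K)
    ; to-∈       = λ K∈ → ∈-select⁺ (position-face _)
                     (face-moves (⊆∁Des⇒PositiveOn (proj₂ (∈-select⁻ (allSubsets n) K∈))))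
    ; injective  = λ _ _ eq → weight-position-injective (≈±-trans (≋⇒≈± (≋-sym (•-inverseˡ w _)))
                     (≈±-trans (≈±-• (w ⁻¹ᵂ) (position⇒≈± eq)) (≋⇒≈± (•-inverseˡ w _))))
    ; surjective = surjective
    }
    where
    surjective : ∀ {F} → F ∈ movingFaces w → ∃ λ K → K ∈ descentFree w × position (w • weight K) ≡ F
    surjective {F} F∈ =
      let F∈faces , F-moves = ∈-select⁻ {P = λ F → Moves F (chamber εᵂ) (chamber w)} faces F∈
          v , F≡v = face-position F∈faces
          K , w-pos , v≈wK = moving-face v w (≡.subst (λ F → Moves F (chamber εᵂ) (chamber w)) F≡v F-moves)
      in K , ∈-select⁺ (∈-allSubsets K) (λ {_} → PositiveOn⇒⊆∁Des w-pos) ,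
         ≡.trans (≈±⇒position (≈±-sym v≈wK)) (≡.sym F≡v)


-- Invariance of the characteristic polynomials under W

module FlatInvariance (lem : ExcludedMiddle 0ℓ) (ℝ : RealNumbers) {n : ℕ}
                      (W : FiniteCoxeterGroup n) (ρ : ReflectionRepresentation ℝ W) where
  open RealNumbers ℝ
  open OrderedField ℝ
  open ListSums ℝ
  open EuclideanSpace ℝ
  open EuclideanProperties ℝ
  open Classical lem
  open Enumeration lem
  open CoxeterGeometry lem ℝ W ρ
  open ParabolicSubgroups lem ℝ W ρ
  open CoxeterArrangement lem ℝ W ρ
  open ReflectionRepresentation ρ
  open CoxeterTheory lem ℝ W ρ
  open Arrangement coxeterArrangement using (size; normal)

  root-hyperplane : ∀ {β} → Root β → ∃ λ i → (∀ {v} → ⟨ normal i , v ⟩ ≈ 0# → ⟨ β , v ⟩ ≈ 0#) ×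
                                             (∀ {v} → ⟨ β , v ⟩ ≈ 0# → ⟨ normal i , v ⟩ ≈ 0#)
  root-hyperplane {β} r with Root-sign r
  ... | inj₁ p = let i , q = root-normal r p in
        i , trans (⟨⟩-cong (≋-sym q) ≋-refl) , trans (⟨⟩-cong q ≋-refl)
  ... | inj₂ p = let i , q = root-normal (-ᵛ-Root r) p in
        i , (λ {v} s → trans (⟨⟩-cong (≋-trans (≋-sym (-ᵛ-involutive β)) (-ᵛ-cong (≋-sym q))) ≋-refl) (negated (normal i) v s)) ,
            (λ {v} s → trans (⟨⟩-cong q ≋-refl) (negated β v s))
    where
    negated : ∀ u v → ⟨ u , v ⟩ ≈ 0# → ⟨ -ᵛ u , v ⟩ ≈ 0#
    negated u v s = trans (⟨⟩-negˡ u v) (trans (-‿cong s) -0#≈0#)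

  Intersection-resp : ∀ S {u v} → u ≋ v → Intersection S u → Intersection S v
  Intersection-resp S p u∈ i i∈S = trans (⟨⟩-cong ≋-refl (≋-sym p)) (u∈ i i∈S)

  -- Since g does not permute the positive roots, the image of a flat is encoded through its set of
  -- points rather than by permuting indices.
  act : |W| → Subset size → Subset size
  act g S = support (λ v → Intersection S (g ⁻¹ᵂ • v))

  Intersection-act⁺ : ∀ g S {v} → Intersection S (g ⁻¹ᵂ • v) → Intersection (act g S) v
  Intersection-act⁺ g S {v} v∈ i i∈ = ∈-subset⁻ {P = λ i → (λ v → Intersection S (g ⁻¹ᵂ • v)) ⊆′ Hyperplane i} i∈ v v∈

  Intersection-act⁻ : ∀ g S {v} → Intersection (act g S) v → Intersection S (g ⁻¹ᵂ • v)
  Intersection-act⁻ g S {v} v∈ j j∈S =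
    let i , to-β , from-β = root-hyperplane (•-Root g (normal-Root j)) in
    trans (sym (•-adjoint g (normal j) v)) (to-β (v∈ i (∈-subset⁺ λ u u∈ →
      from-β (trans (•-adjoint g (normal j) u) (u∈ j j∈S)))))

  Intersection-act : ∀ g S {v} → Intersection S v → Intersection (act g S) (g • v)
  Intersection-act g S {v} v∈ = Intersection-act⁺ g S (Intersection-resp S (≋-sym (•-inverseˡ g v)) v∈)

  act-flat : ∀ g {S} → IsFlat S → IsFlat (act g S)
  act-flat g {S} ((v , v∈) , _) = (g • v , Intersection-act g S v∈) ,
    subset-cong (λ i p u u∈ → p u (Intersection-act⁺ g S u∈)) (λ i p u u∈ → p u (Intersection-act⁻ g S u∈))

  -- Here h inverts g only through the action, so that one lemma covers both orders of g and its
  -- inverse. Closedness of the flat turns equality of point sets into equality of codes.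
  act-cancel : ∀ g h {S} → (∀ v → g ⁻¹ᵂ • h ⁻¹ᵂ • v ≋ v) → IsFlat S → act h (act g S) ≡ S
  act-cancel g h {S} cancel (_ , closed) = ≡.trans
    (subset-cong (λ i p u u∈ → p u (Intersection-act⁺ g S (Intersection-resp S (≋-sym (cancel u)) u∈)))
                 (λ i p u u∈ → p u (Intersection-resp S (cancel u) (Intersection-act⁻ g S u∈))))
    closed

  act-injective : ∀ g {S T} → IsFlat S → IsFlat T → act g S ≡ act g T → S ≡ T
  act-injective g {S} {T} S-flat T-flat eq = ≡.trans (≡.sym (act-cancel g (g ⁻¹ᵂ) (•-inverseʳ (g ⁻¹ᵂ)) S-flat))
    (≡.trans (≡.cong (act (g ⁻¹ᵂ)) eq) (act-cancel g (g ⁻¹ᵂ) (•-inverseʳ (g ⁻¹ᵂ)) T-flat))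

  act-≼⁺ : ∀ g {X Y} → X ≼ Y → act g X ≼ act g Y
  act-≼⁺ g {X} {Y} p v v∈ = Intersection-act⁺ g X (p _ (Intersection-act⁻ g Y v∈))

  act-≼⁻ : ∀ g {X Y} → act g X ≼ act g Y → X ≼ Y
  act-≼⁻ g {X} {Y} p v v∈ = Intersection-resp X (•-inverseˡ g v)
    (Intersection-act⁻ g X (p _ (Intersection-act g Y v∈)))

  ∈-flats⁺ : ∀ {S} → IsFlat S → S ∈ flats
  ∈-flats⁺ S-flat = ∈-select⁺ (∈-allSubsets _) S-flat

  ∈-flats⁻ : ∀ {S} → S ∈ flats → IsFlat S
  ∈-flats⁻ S∈ = proj₂ (∈-select⁻ {P = IsFlat} (allSubsets size) S∈)

  flats-unique : Unique flats
  flats-unique = select-unique (allSubsets-unique size)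

  -- W permutes the flats. With P and Q left open, one bijection serves the intervals in
  -- `möbius-act` and the upper sets in `χ-act`.
  act-⤖ : ∀ g {P Q : Pred (Subset size) 0ℓ} → (∀ {Z} → IsFlat Z → P Z → Q (act g Z)) →
          (∀ {Z} → IsFlat Z → Q (act g Z) → P Z) → select P flats ⤖ᴸ select Q flats
  act-⤖ g {P} {Q} P⇒Q Q⇒P = record
    { to         = act g
    ; to-∈       = λ Z∈ → let Z∈flats , p = ∈-select⁻ {P = P} flats Z∈ ; Z-flat = ∈-flats⁻ Z∈flats in
                          ∈-select⁺ (∈-flats⁺ (act-flat g Z-flat)) (P⇒Q Z-flat p)
    ; injective  = λ Y∈ Z∈ → act-injective g (∈-flats⁻ (proj₁ (∈-select⁻ {P = P} flats Y∈)))
                                             (∈-flats⁻ (proj₁ (∈-select⁻ {P = P} flats Z∈)))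
    ; surjective = λ {Z} Z∈ →
        let Z∈flats , q = ∈-select⁻ {P = Q} flats Z∈
            Z-flat      = ∈-flats⁻ Z∈flats
            Y-flat      = act-flat (g ⁻¹ᵂ) Z-flat
            gY≡Z        = act-cancel (g ⁻¹ᵂ) g (•-inverseˡ (g ⁻¹ᵂ)) Z-flat
        in act (g ⁻¹ᵂ) Z , ∈-select⁺ (∈-flats⁺ Y-flat) (Q⇒P Y-flat (≡.subst Q (≡.sym gY≡Z) q)) , gY≡Z
    }

  if-cong : ∀ {b b′ x x′ y y′} → b ≡ b′ → x ≈ x′ → y ≈ y′ → (if b then x else y) ≈ (if b′ then x′ else y′)
  if-cong {true}  ≡.refl p q = p
  if-cong {false} ≡.refl p q = q

  möbius-act : ∀ g k {X Y} → IsFlat X → IsFlat Y → möbiusUpTo k X Y ≈ möbiusUpTo k (act g X) (act g Y)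
  möbius-act g zero            _      _      = refl
  möbius-act g (suc k) {X} {Y} X-flat Y-flat =
    if-cong (decide-cong (≡.cong (act g)) (act-injective g X-flat Y-flat)) refl
      (-‿cong (sumList-⤖ (act-⤖ g interval⇒ ⇒interval) (select-unique flats-unique) (select-unique flats-unique)
        λ Z∈ → möbius-act g k X-flat (∈-flats⁻ (proj₁ (∈-select⁻ {P = λ Z → X ≼ Z × Z ≺ Y} flats Z∈)))))
    where
    interval⇒ : ∀ {Z} → IsFlat Z → X ≼ Z × Z ≺ Y → act g X ≼ act g Z × act g Z ≺ act g Y
    interval⇒ {Z} Z-flat (p , q , r) = act-≼⁺ g {X} {Z} p , act-≼⁺ g {Z} {Y} q , r ∘ act-injective g Z-flat Y-flat
    ⇒interval : ∀ {Z} → IsFlat Z → act g X ≼ act g Z × act g Z ≺ act g Y → X ≼ Z × Z ≺ Y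
    ⇒interval {Z} Z-flat (p , q , r) = act-≼⁻ g {X} {Z} p , act-≼⁻ g {Z} {Y} q , r ∘ ≡.cong (act g)

  HasIndependent-• : ∀ g {P Q : Pred (V n) 0ℓ} → (∀ {u v} → u ≋ v → Q u → Q v) → (∀ {v} → P v → Q (g • v)) →
                     ∀ {d} → HasIndependent P d → HasIndependent Q d
  HasIndependent-• g Q-resp P⇒Q (p , b , b-independent , p∈ , pb∈) =
    g • p , (λ j → g • b j) ,
    (λ c gcb≋0 → b-independent c (≋-trans (≋-sym (•-transpose g (≋-trans (≋-sym gcb≋0) (≋-sym (•-linComb g c b))))) g⁻¹0≋0)) ,
    P⇒Q p∈ , λ j → Q-resp (•-+ᵛ g p (b j)) (P⇒Q (pb∈ j))
    where
    0≋0*0 : 0ᵛ {n} ≋ 0# *ᵛ 0ᵛ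
    0≋0*0 k = sym (zeroˡ 0#)
    g⁻¹0≋0 : g ⁻¹ᵂ • 0ᵛ ≋ 0ᵛ
    g⁻¹0≋0 = ≋-trans (•-congˡ (g ⁻¹ᵂ) 0≋0*0) (≋-trans (•-*ᵛ (g ⁻¹ᵂ) 0# 0ᵛ) (λ k → zeroˡ _))

  largestUpTo-cong : ∀ {P Q : Pred ℕ 0ℓ} → (∀ {d} → P d → Q d) → (∀ {d} → Q d → P d) →
                     ∀ d → largestUpTo P d ≡ largestUpTo Q d
  largestUpTo-cong P⇒Q Q⇒P zero    = ≡.refl
  largestUpTo-cong P⇒Q Q⇒P (suc d) =
    ≡.cong₂ (λ b e → if b then suc d else e) (decide-cong P⇒Q Q⇒P) (largestUpTo-cong P⇒Q Q⇒P d)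

  dim-act : ∀ g Y → dim (Intersection Y) ≡ dim (Intersection (act g Y))
  dim-act g Y = largestUpTo-cong
    (HasIndependent-• g (λ {u} {v} → Intersection-resp (act g Y)) (λ {v} → Intersection-act g Y))
    (HasIndependent-• (g ⁻¹ᵂ) (λ {u} {v} → Intersection-resp Y) (λ {v} → Intersection-act⁻ g Y)) n

  χ-act : ∀ g {X} x → IsFlat X → χ X x ≈ χ (act g X) x
  χ-act g {X} x X-flat = sumList-⤖
    (act-⤖ g (λ {Y} _ → act-≼⁺ g {X} {Y}) (λ {Y} _ → act-≼⁻ g {X} {Y}))
    (select-unique flats-unique) (select-unique flats-unique)
    λ {Y} Y∈ → *-cong (möbius-act g (length flats) X-flat (∈-flats⁻ (proj₁ (∈-select⁻ {P = X ≼_} flats Y∈))))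
                      (reflexive (≡.cong (x ^_) (dim-act g Y)))

  zeros-flat : ∀ v → IsFlat (zeros v)
  zeros-flat v = (v , v∈) , subset-cong (λ i p → p v v∈) (λ i p u u∈ → u∈ i (∈-subset⁺ p))
    where
    v∈ : Intersection (zeros v) v
    v∈ i = ∈-subset⁻ {P = λ i → ⟨ normal i , v ⟩ ≈ 0#}

  act-zeros : ∀ g v → act g (zeros v) ≡ zeros (g • v)
  act-zeros g v = subset-cong
    (λ i p → p (g • v) (Intersection-resp (zeros v) (≋-sym (•-inverseˡ g v)) (proj₂ (proj₁ (zeros-flat v)))))
    (λ i p u u∈ → let j , to-β , from-β = root-hyperplane (•-Root (g ⁻¹ᵂ) (normal-Root i)) in
      trans (⟨⟩-cong ≋-refl (≋-sym (•-inverseʳ g u))) (trans (•-adjoint′ g (normal i) (g ⁻¹ᵂ • u))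
        (to-β (u∈ j (∈-subset⁺ (from-β (trans (sym (•-adjoint′ g (normal i) v)) p)))))))

  χ-zeros : ∀ g v x → χ (zeros (g • v)) x ≈ χ (zeros v) x
  χ-zeros g v x = trans (reflexive (≡.cong (λ X → χ X x) (≡.sym (act-zeros g v)))) (sym (χ-act g x (zeros-flat v)))

  -- The point `weight K` is generic in Fix(W_K): it is fixed, and every other fixed vector is
  -- orthogonal to the simple roots of K, hence to all roots orthogonal to `weight K`.
  support-Fix : ∀ K → support (Fix (Parabolic K)) ≡ zeros (weight K)
  support-Fix K = subset-cong (λ i p → p (weight K) (λ g → parabolic-fixes-weight {K}))
    (λ i p v v∈ → trans (⟨⟩-comm (normal i) v) (weight-⊴
      (λ k k∈K → s-fixes⁻ k v (v∈ (s k) (gen (k , k∈K , Wᴳ.refl)))) (normal-Root i) (trans (⟨⟩-comm (weight K) (normal i)) p)))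


-- The number of faces with a given support

module FaceCount (lem : ExcludedMiddle 0ℓ) (ℝ : RealNumbers) {n : ℕ}
                 (W : FiniteCoxeterGroup n) (ρ : ReflectionRepresentation ℝ W) where
  open EuclideanSpace ℝ
  open EuclideanProperties ℝ
  open Classical lem
  open Enumeration lem
  open CoxeterGeometry lem ℝ W ρ
  open ParabolicSubgroups lem ℝ W ρ
  open CoxeterArrangement lem ℝ W ρ
  open ReflectionRepresentation ρ
  open CoxeterTheory lem ℝ W ρ
  open Arrangement coxeterArrangement using (size)

  elements-≈⇒≡ : ∀ {g h} → g ∈ elements → h ∈ elements → g ≈ᵂ h → g ≡ h
  elements-≈⇒≡ g∈ h∈ p with ∈-AllPairs₂ elements-unique g∈ h∈
  ... | inj₁ q        = q
  ... | inj₂ (inj₁ q) = contradiction p q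
  ... | inj₂ (inj₂ q) = contradiction (Wᴳ.sym p) q

  elements-unique-≡ : Unique elements
  elements-unique-≡ = AllPairs.map (λ p q → p (Wᴳ.reflexive q)) elements-unique

  -- The list `elements` exhausts W only up to `≈ᵂ`, while bijections of lists need propositional
  -- equality; computed products are therefore replaced by their listed copies.
  canonical : |W| → |W|
  canonical g = proj₁ (listed g)

  canonical-∈ : ∀ g → canonical g ∈ elements
  canonical-∈ g = proj₁ (proj₂ (listed g))

  canonical-≈ : ∀ g → g ≈ᵂ canonical g
  canonical-≈ g = proj₂ (proj₂ (listed g))

  module _ (w : |W|) (K : Subset n) where

    facesAt : List (SignVector size)
    facesAt = select (λ F → z F ≡ zeros (w • weight K)) faces

    W-K N-K : List |W|
    W-K = select (Parabolic K) elements
    N-K = select (Normalizes group (Parabolic K)) elements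

    λ-K : List (Subset n)
    λ-K = select (λ J → ∃ λ w → MapsOnto w K J) (allSubsets n)

    private
      Represents : SignVector size → |W| × Subset n → Set
      Represents F (u , J) = F ≡ position (u • weight J)

      -- Depends on F alone. For a face F the subset J is determined, but u only up to right
      -- multiplication by W_J, which the surjectivity argument has to compensate.
      representative : SignVector size → |W| × Subset n
      representative F = choose (Represents F) (εᵂ , Subset.⊥)

      rep : SignVector size → |W|
      rep F = proj₁ (representative F)

      type : SignVector size → Subset n
      type F = proj₂ (representative F)

      rep-spec : ∀ {F} → F ∈ faces → F ≡ position (rep F • weight (type F))
      rep-spec {F} F∈ = choose-spec {P = Represents F} (εᵂ , Subset.⊥)
        (let v , F≡v = face-position F∈ ; u , J , v≈uJ , _ = face-representative v in
         (u , J) , ≡.trans F≡v (≈±⇒position v≈uJ))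

      -- A base point, fixed once for each J, of the coset of N_W(W_K) formed by the elements taking
      -- Fix(W_J) to Fix(W_K). The default is returned only for J outside λ(K).
      transporter : Subset n → |W|
      transporter J = choose (λ a → a • weight J ≈₀ weight K) εᵂ

      transporter-spec : ∀ J {a} → a • weight J ≈₀ weight K → transporter J • weight J ≈₀ weight K
      transporter-spec J p = choose-spec {P = λ a → a • weight J ≈₀ weight K} εᵂ (_ , p)

      transporter-λ : ∀ {J} → J ∈ λ-K → transporter J • weight J ≈₀ weight K
      transporter-λ {J} J∈ = let w , m = proj₂ (∈-select⁻ {P = λ J → ∃ λ w → MapsOnto w K J} (allSubsets n) J∈) in
        transporter-spec J (mapsOnto⇒≈₀ m)

      transporter⁻¹ : ∀ J → transporter J • weight J ≈₀ weight K → transporter J ⁻¹ᵂ • weight K ≈₀ weight J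
      transporter⁻¹ J p = ≈₀-sym (≈₀-transpose _ p)

      ∈-facesAt⁺ : ∀ v → v ≈₀ w • weight K → position v ∈ facesAt
      ∈-facesAt⁺ v p = ∈-select⁺ (position-face v) (≡.trans (z-position v) (zeros-cong p))

      facesAt-faces : ∀ {F} → F ∈ facesAt → F ∈ faces
      facesAt-faces F∈ = proj₁ (∈-select⁻ {P = λ F → z F ≡ zeros (w • weight K)} faces F∈)

      rep-≈₀ : ∀ {F} → F ∈ facesAt → (w ⁻¹ᵂ ∙ᵂ rep F) • weight (type F) ≈₀ weight K
      rep-≈₀ {F} F∈ = ≈₀-trans (≋⇒≈₀ (•-assoc _ _ _)) (≈₀-sym (≈₀-transpose w (≈₀-sym uJ≈₀wK)))
        where
        uJ≈₀wK : rep F • weight (type F) ≈₀ w • weight K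
        uJ≈₀wK = zeros⇒≈₀ (≡.trans (≡.sym (z-position _)) (≡.trans (≡.cong z (≡.sym (rep-spec (facesAt-faces F∈))))
          (proj₂ (∈-select⁻ {P = λ F → z F ≡ zeros (w • weight K)} faces F∈))))

      W-K-parabolic : ∀ {h} → h ∈ W-K → Parabolic K h
      W-K-parabolic h∈ = proj₂ (∈-select⁻ {P = Parabolic K} elements h∈)

      -- As F has support w Fix(W_K), the product w⁻¹u carries Fix(W_J) to Fix(W_K), and the inverse
      -- of the transporter leads back from Fix(W_K) to Fix(W_J). With h in W_K in front, the whole
      -- preserves Fix(W_K).
      normalizer-part : SignVector size → |W| → |W|
      normalizer-part F h = h ∙ᵂ (w ⁻¹ᵂ ∙ᵂ rep F ∙ᵂ transporter (type F) ⁻¹ᵂ)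

      normalizer-part-≈₀ : ∀ {F h} → F ∈ facesAt → Parabolic K h → normalizer-part F h • weight K ≈₀ weight K
      normalizer-part-≈₀ {F} {h} F∈ h∈ = ≈₀-trans
        (≋⇒≈₀ (≋-trans (•-assoc h _ _) (•-congˡ h (•-assoc _ _ _))))
        (≈₀-trans (≈₀-• h (≈₀-trans (≈₀-• (w ⁻¹ᵂ ∙ᵂ rep F) (transporter⁻¹ (type F) (transporter-spec (type F) (rep-≈₀ F∈)))) (rep-≈₀ F∈)))
                  (≋⇒≈₀ (parabolic-fixes-weight {K} h∈)))

      -- The factor h fixes Fix(W_K) pointwise and drops out. So the normaliser part and J determine
      -- a point of F, hence F itself, and h is then recovered by cancellation: this is the
      -- injectivity of `to`.
      normalizer-part-weight : ∀ F h → Parabolic K h → transporter (type F) • weight (type F) ≈₀ weight K →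
        (w ⁻¹ᵂ ∙ᵂ rep F) • weight (type F) ≈₀ weight K →
        normalizer-part F h • transporter (type F) • weight (type F) ≋ w ⁻¹ᵂ • rep F • weight (type F)
      normalizer-part-weight F h h∈ p q = ≋-trans (•-assoc h _ _) (≋-trans (•-congˡ h (≋-trans (•-assoc _ _ _)
        (•-congˡ (w ⁻¹ᵂ ∙ᵂ rep F) (•-inverseˡ _ _)))) (≋-trans (parabolic-fixes-⊴ (proj₂ q) h∈) (•-assoc _ _ _)))

      to : SignVector size × |W| → |W| × Subset n
      to (F , h) = canonical (normalizer-part F h) , type F

      to-∈ : ∀ {F h} → F ∈ facesAt → h ∈ W-K → to (F , h) ∈ cartesianProduct N-K λ-K
      to-∈ {F} {h} F∈ h∈ = ∈-cartesianProduct⁺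
        (∈-select⁺ (canonical-∈ _) (≈₀⇒normalizer (≈₀-trans (≋⇒≈₀ (•-congʳ _ (Wᴳ.sym (canonical-≈ _))))
                                                            (normalizer-part-≈₀ F∈ (W-K-parabolic h∈)))))
        (∈-select⁺ (∈-allSubsets _) (≈₀⇒mapsOnto (rep-≈₀ F∈)))

      to-injective : ∀ {F h F′ h′} → F ∈ facesAt → h ∈ W-K → F′ ∈ facesAt → h′ ∈ W-K →
                     to (F , h) ≡ to (F′ , h′) → (F , h) ≡ (F′ , h′)
      to-injective {F} {h} {F′} {h′} F∈ h∈ F′∈ h′∈ eq = conclude F≡F′
        where
        parts≈ : normalizer-part F h ≈ᵂ normalizer-part F′ h′
        parts≈ = Wᴳ.trans (canonical-≈ _) (Wᴳ.trans (Wᴳ.reflexive (≡.cong proj₁ eq)) (Wᴳ.sym (canonical-≈ _)))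
        a•J : |W| × Subset n → V n
        a•J (_ , J) = transporter J • weight J
        points≋ : w ⁻¹ᵂ • rep F • weight (type F) ≋ w ⁻¹ᵂ • rep F′ • weight (type F′)
        points≋ = ≋-trans (≋-sym (normalizer-part-weight F h (W-K-parabolic h∈) (transporter-spec (type F) (rep-≈₀ F∈)) (rep-≈₀ F∈)))
          (≋-trans (•-cong parts≈ a•J≋)
            (normalizer-part-weight F′ h′ (W-K-parabolic h′∈) (transporter-spec (type F′) (rep-≈₀ F′∈)) (rep-≈₀ F′∈)))
          where
          a•J≋ : a•J (to (F , h)) ≋ a•J (to (F′ , h′))
          a•J≋ = ≡.subst (λ x → a•J (to (F , h)) ≋ a•J x) eq ≋-refl
        F≡F′ : F ≡ F′
        F≡F′ = ≡.trans (rep-spec (facesAt-faces F∈)) (≡.trans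
          (≈±⇒position (≋⇒≈± (≋-trans (≋-sym (•-inverseʳ w _)) (≋-trans (•-congˡ w points≋) (•-inverseʳ w _)))))
          (≡.sym (rep-spec (facesAt-faces F′∈))))
        conclude : F ≡ F′ → (F , h) ≡ (F′ , h′)
        conclude ≡.refl = ≡.cong (F ,_) (elements-≈⇒≡ (proj₁ (∈-select⁻ {P = Parabolic K} elements h∈))
          (proj₁ (∈-select⁻ {P = Parabolic K} elements h′∈)) (Wᴾ.∙-cancelʳ _ h h′ parts≈))

      module _ {g : |W|} {J : Subset n} (g∈ : g ∈ N-K) (J∈ : J ∈ λ-K) where

        a : |W|
        a = transporter J

        aJ≈₀K : a • weight J ≈₀ weight K
        aJ≈₀K = transporter-λ J∈

        gK≈₀K : g • weight K ≈₀ weight K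
        gK≈₀K = normalizer⇒≈₀ (proj₂ (∈-select⁻ {P = Normalizes group (Parabolic K)} elements g∈))

        -- Forced by `normalizer-part-weight`: whatever h is, a preimage of (g , J) has the face w g
        -- a F_J.
        F : SignVector size
        F = position (w • g • a • weight J)

        F∈ : F ∈ facesAt
        F∈ = ∈-facesAt⁺ _ (≈₀-• w (≈₀-trans (≈₀-• g aJ≈₀K) gK≈₀K))

        u : |W|
        u = rep F

        y : V n → V n
        y v = u ⁻¹ᵂ • w • g • a • v

        -- The discrepancy between w g a and the chosen representative u of the face w g a F_J.
        y-element : |W|
        y-element = u ⁻¹ᵂ ∙ᵂ (w ∙ᵂ (g ∙ᵂ a))

        y-action : ∀ v → y-element • v ≋ y v
        y-action v = ≋-trans (•-assoc _ _ v) (•-congˡ (u ⁻¹ᵂ)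
          (≋-trans (•-assoc w _ v) (•-congˡ w (•-assoc g a v))))

        -- The chosen type of F has a dominant weight in the same face as `y-element • weight J`,
        -- which is therefore dominant too. This forces the type to be J and puts y in W_J.
        type≈yJ : weight (type F) ≈± y-element • weight J
        type≈yJ = ≈±-trans (≋⇒≈± (≋-sym (•-inverseˡ u _))) (≈±-trans
          (≈±-• (u ⁻¹ᵂ) (position⇒≈± (≡.sym (rep-spec (position-face _)))))
          (≋⇒≈± (≋-sym (y-action _))))

        yJ-dominant : Dominant (y-element • weight J)
        yJ-dominant = ≈±-dominant type≈yJ (weight-dominant (type F))

        type≡J : type F ≡ J
        type≡J = weight-position-injective (≈±-trans type≈yJ (≋⇒≈± (dominant-orbit {J} yJ-dominant)))

        y∈ : Parabolic J y-element
        y∈ = stabilizer-weight {J} yJ-dominant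

        -- This is y conjugated by g a, which carries Fix(W_J) to Fix(W_K): (g a) y (g a)⁻¹ = g a
        -- u⁻¹ w. It lies in W_K, and h w⁻¹ u a⁻¹ = g.
        h : |W|
        h = g ∙ᵂ (a ∙ᵂ (u ⁻¹ᵂ ∙ᵂ w))

        -- The point of Fix(W_J) that g a sends to `weight K`. As y fixes it, the conjugate h fixes
        -- `weight K`.
        x : V n
        x = a ⁻¹ᵂ • g ⁻¹ᵂ • weight K

        J⊴x : weight J ⊴ x
        J⊴x = proj₂ (≈₀-trans (≈₀-• (a ⁻¹ᵂ) (≈₀-sym (≈₀-transpose g gK≈₀K))) (transporter⁻¹ J aJ≈₀K))

        K≋gax : weight K ≋ g • a • x
        K≋gax = ≋-sym (≋-trans (•-congˡ g (•-inverseʳ a _)) (•-inverseʳ g _))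

        h∈ : Parabolic K h
        h∈ = stabilizer-weight {K} (Dominant-resp (≋-sym hK≋K) (weight-dominant K))
          where
          hK≋K : h • weight K ≋ weight K
          hK≋K = ≋-trans (•-assoc g _ _) (≋-trans (•-congˡ g (≋-trans (•-assoc a _ _) (•-congˡ a
            (≋-trans (•-assoc _ w _) (≋-trans (•-congˡ (u ⁻¹ᵂ) (•-congˡ w K≋gax))
              (≋-trans (≋-sym (y-action x)) (parabolic-fixes-⊴ J⊴x y∈))))))) (≋-sym K≋gax))

        part≈g : normalizer-part F (canonical h) ≈ᵂ g
        part≈g = begin
          canonical h ∙ᵂ (w ⁻¹ᵂ ∙ᵂ u ∙ᵂ transporter (type F) ⁻¹ᵂ)       ≈⟨ Wᴳ.∙-congʳ (Wᴳ.sym (canonical-≈ h)) ⟩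
          h ∙ᵂ (w ⁻¹ᵂ ∙ᵂ u ∙ᵂ transporter (type F) ⁻¹ᵂ)                 ≡⟨ ≡.cong (λ J → h ∙ᵂ (w ⁻¹ᵂ ∙ᵂ u ∙ᵂ transporter J ⁻¹ᵂ)) type≡J ⟩
          h ∙ᵂ (w ⁻¹ᵂ ∙ᵂ u ∙ᵂ a ⁻¹ᵂ)                                    ≈⟨ Wᴳ.assoc _ _ _ ⟨
          h ∙ᵂ (w ⁻¹ᵂ ∙ᵂ u) ∙ᵂ a ⁻¹ᵂ                                    ≈⟨ Wᴳ.∙-congʳ lemma ⟩
          g ∙ᵂ a ∙ᵂ a ⁻¹ᵂ                                               ≈⟨ Wᴾ.//-rightDividesʳ a g ⟩
          g                                                             ∎
          where
          open ≈ᵂ-Reasoning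
          t : |W|
          t = u ⁻¹ᵂ ∙ᵂ w
          t⁻¹ : w ⁻¹ᵂ ∙ᵂ u ≈ᵂ t ⁻¹ᵂ
          t⁻¹ = Wᴳ.sym (Wᴳ.trans (Wᴾ.⁻¹-anti-homo-∙ _ _) (Wᴳ.∙-congˡ (Wᴾ.⁻¹-involutive u)))
          lemma : h ∙ᵂ (w ⁻¹ᵂ ∙ᵂ u) ≈ᵂ g ∙ᵂ a
          lemma = begin
            g ∙ᵂ (a ∙ᵂ t) ∙ᵂ (w ⁻¹ᵂ ∙ᵂ u)    ≈⟨ Wᴳ.∙-cong (Wᴳ.sym (Wᴳ.assoc g a t)) t⁻¹ ⟩
            g ∙ᵂ a ∙ᵂ t ∙ᵂ t ⁻¹ᵂ             ≈⟨ Wᴾ.//-rightDividesʳ t (g ∙ᵂ a) ⟩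
            g ∙ᵂ a                           ∎

        preimage : ∃ λ p → p ∈ cartesianProduct facesAt W-K × to p ≡ (g , J)
        preimage = (F , canonical h) ,
          ∈-cartesianProduct⁺ F∈ (∈-select⁺ (canonical-∈ h) (resp (canonical-≈ h) h∈)) ,
          ≡.cong₂ _,_ (elements-≈⇒≡ (canonical-∈ _) (proj₁ (∈-select⁻ {P = Normalizes group (Parabolic K)} elements g∈))
                         (Wᴳ.trans (Wᴳ.sym (canonical-≈ _)) part≈g)) type≡J

    -- A pair (F , h), F = u F_J and h in W_K, corresponds to (h w⁻¹ u a⁻¹ , J),
    -- where a F_J spans the fixed space of W_K.
    faces×parabolic : cartesianProduct facesAt W-K ⤖ᴸ cartesianProduct N-K λ-K
    faces×parabolic = record
      { to         = to
      ; to-∈       = λ p∈ → let F∈ , h∈ = ∈-cartesianProduct⁻ facesAt W-K p∈ in to-∈ F∈ h∈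
      ; injective  = λ p∈ q∈ → let F∈ , h∈ = ∈-cartesianProduct⁻ facesAt W-K p∈
                                   F′∈ , h′∈ = ∈-cartesianProduct⁻ facesAt W-K q∈
                               in to-injective F∈ h∈ F′∈ h′∈
      ; surjective = λ p∈ → let g∈ , J∈ = ∈-cartesianProduct⁻ N-K λ-K p∈ in preimage g∈ J∈
      }

    facesWithSupport-count : facesWithSupport (zeros (w • weight K)) ℕ.* |Parabolic| K ≡ |Normalizer| K ℕ.* |λ| K
    facesWithSupport-count = ≡.trans (≡.sym (length-cartesianProduct facesAt W-K)) (≡.trans
      (_⤖ᴸ_.length-≡ faces×parabolic
        (Unique.cartesianProduct⁺ (select-unique faces-unique) (select-unique elements-unique-≡))
        (Unique.cartesianProduct⁺ (select-unique elements-unique-≡) (select-unique (allSubsets-unique n))))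
      (length-cartesianProduct N-K λ-K))

    facesWithSupport-pos : 0 ℕ.< facesWithSupport (zeros (w • weight K))
    facesWithSupport-pos = ∈-length (∈-facesAt⁺ _ (≋⇒≈₀ ≋-refl))

  |Parabolic|-pos : ∀ K → 0 ℕ.< |Parabolic| K
  |Parabolic|-pos K = count-pos (canonical-∈ εᵂ) (resp (canonical-≈ εᵂ) unit)


-- Termwise comparison of the two sums

theorem1 : (lem : ExcludedMiddle 0ℓ) (ℝ : RealNumbers) →
    let open RealNumbers ℝ in
    (n : ℕ) (W : FiniteCoxeterGroup n) (ρ : ReflectionRepresentation ℝ W) →
    let open FiniteCoxeterGroup W using (ε) renaming (Carrier to |W|)
        open CoxeterTheory lem ℝ W ρ in
    (x : Carrier) → ¬ (x ≈ 0#) →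
    (w : |W|) → transitionWeight x (chamber ε) (chamber w) ≈ H x w
theorem1 lem ℝ n W ρ x x≉0 w = sym (sumList-⤖ (descentFree⤖movingFaces w)
    (select-unique (allSubsets-unique n)) (select-unique faces-unique) (λ {K} _ → sym (weight≈term K)))
  where
  open RealNumbers ℝ
  open OrderedField ℝ
  open ListSums ℝ
  open Enumeration lem
  open CoxeterTheory lem ℝ W ρ
  open ReflectionRepresentation ρ using (_•_)
  open CoxeterGeometry lem ℝ W ρ using (weight)
  open CoxeterArrangement lem ℝ W ρ
  open FaceMoves lem ℝ W ρ
  open FlatInvariance lem ℝ W ρ
  open FaceCount lem ℝ W ρ
  open SetoidReasoning setoid
  weight≈term : ∀ K → faceWeight x (position (w • weight K)) ≈
    (fromℕ (|Parabolic| K) * χ (support (Fix (Parabolic K))) x) / (x ^ n * fromℕ (|Normalizer| K) * fromℕ (|λ| K))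
  weight≈term K = begin
    χ (z F) x / (x ^ n * fromℕ (facesWithSupport (z F)))
      ≡⟨ ≡.cong (λ S → χ S x / (x ^ n * fromℕ (facesWithSupport S))) (z-position (w • weight K)) ⟩
    χ S x / (x ^ n * fromℕ (facesWithSupport S))
      ≈⟨ *-congʳ (χ-zeros w (weight K) x) ⟩
    χ (zeros (weight K)) x / (x ^ n * fromℕ (facesWithSupport S))
      ≈⟨ fraction (|Parabolic| K) (|Normalizer| K) (facesWithSupport S) (|λ| K) (x ^ n) _
           (|Parabolic|-pos K) (facesWithSupport-pos w K) (^≉0 n x≉0) (facesWithSupport-count w K) ⟩
    (fromℕ (|Parabolic| K) * χ (zeros (weight K)) x) / (x ^ n * fromℕ (|Normalizer| K) * fromℕ (|λ| K))
      ≡⟨ ≡.cong (λ X → (fromℕ (|Parabolic| K) * χ X x) / (x ^ n * fromℕ (|Normalizer| K) * fromℕ (|λ| K))) (support-Fix K) ⟨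
    (fromℕ (|Parabolic| K) * χ (support (Fix (Parabolic K))) x) / (x ^ n * fromℕ (|Normalizer| K) * fromℕ (|λ| K)) ∎
    where
    F : SignVector _
    F = position (w • weight K)
    S : Subset _
    S = zeros (w • weight K)
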